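{- Let $\mathsf{M}$ be a loopless matroid, let $\mathcal{G}$ be a building set on $\mathcal{L}(\mathsf{M})$, and let $G\in\mathcal{G}$ be such that $\mathcal{G}'=\mathcal{G}\setminus\{G\}$ is also a building set on $\mathcal{L}(\mathsf{M})$. Writing $k=|f(\mathcal{G}'|_G)|$, one has \[ \mathrm{H}_\mathsf{M}^{\mathcal{G}}(x) = \mathrm{H}_\mathsf{M}^{\mathcal{G}'}(x) + (x+x^2+\cdots + x^{k-1})\, \mathrm{H}_{\mathsf{M}|_G}^{\mathcal{G}'|_G}(x)\,\mathrm{H}_{\mathsf{M}/G}^{\mathcal{G}'/G}(x).\]
   Context: A matroid $\mathsf{M}=(E,\operatorname{rk})$: finite $E$, $\operatorname{rk}:2^E\to\mathbb{Z}_{\ge0}$ with $\operatorname{rk}(\varnothing)=0$, monotone, submodular, and $\operatorname{rk}(A)\le|A|$. Flats: $F$ with $\operatorname{rk}(F\cup\{e\})>\operatorname{rk}(F)$ for $e\notin F$; lattice $\mathcal L(\mathsf{M})$ with join $\vee$; loopless: $\varnothing$ is a flat. $f(\mathcal{G})$ = inclusion-maximal elements of a set $\mathcal{G}$ of flats; $\mathcal{G}_{\le F}=\{H\in\mathcal{G}:H\subseteq F\}$. A building set is $\mathcal{G}\subseteq\mathcal L(\mathsf{M})\setminus\{\varnothing\}$ such that for every flat $F$ the map $\prod_{H\in f(\mathcal{G}_{\le F})}[\varnothing,H]\to[\varnothing,F]$, $(F_H)\mapsto\bigvee F_H$, is a lattice isomorphism and $\operatorname{rk}(F)=\sum_{H\in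 f(\mathcal{G}_{\le F})}\operatorname{rk}(H)$. For a flat $G$: $\mathsf{M}|_G=(G,\operatorname{rk}|_{2^G})$ with building set $\mathcal{G}'|_G=\{H\in\mathcal{G}':H\subseteq G\}$; $\mathsf{M}/G$ is the matroid on $E\setminus G$ with rank $A\mapsto\operatorname{rk}(A\cup G)-\operatorname{rk}(G)$, lattice of flats identified with $[G,E]$, with building set $\mathcal{G}'/G=\{H\vee G:H\in\mathcal{G}',H\not\subseteq G\}$. The Chow ring $D(\mathsf{N},\mathcal{B})$ is $\mathbb{Q}[x_B:B\in\mathcal{B}]$ (degree-1 generators) modulo the ideal generated by $\big(\prod_{i=1}^m x_{B_i}\big)\big(\sum_{H\in\mathcal{B},H\supseteq B}x_H\big)^{\operatorname{rk}(B)-\operatorname{rk}(\sup(S,B))}$ for each subset $S=\{B_1,\dots,B_m\}\subseteq\mathcal{B}$ and $B\in\mathcal{B}$, with $\sup(S,B)=\bigvee_{B'\in S,B'\subsetneq B}B'$ (empty join $=\varnothing$); $\mathrm{H}^{\mathcal{B}}_\mathsf{N}(x)=\sum_i\dim D^i(\mathsf{N},\mathcal{B})x^i$, and $\mathrm{H}=1$ for the empty matroid. The sum $x+\cdots+x^{k-1}$ is $0$ if $k\le1$. -}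

module Defs where

open import Data.Nat as ℕ using (ℕ; zero; suc; _+_; _*_; _∸_; _≤_; _<_)
open import Data.Bool using (Bool; true; false; _∧_; not; if_then_else_)
import Data.Bool.Properties as BoolP
open import Data.Fin as Fin using (Fin; zero; suc)
open import Data.Fin.Subset using (Subset; _∪_; _∩_; _⊆_; _∉_; ⁅_⁆; ∣_∣)
  renaming (⊥ to ∅ₛ)
open import Data.Vec as Vec using (Vec; []; _∷_)
open import Data.Vec.Properties using (≡-dec)
open import Data.Fin.Subset.Properties using (_⊆?_)
open import Data.List as List using (List; []; _∷_; _++_)
open import Data.List.Membership.Propositional using () renaming (_∈_ to _∈ₗ_)
open import Data.List.Relation.Unary.All using (All)
open import Data.Product using (Σ; ∃; _×_; _,_; proj₁; proj₂)
open import Data.Rational as ℚ using (ℚ; 0ℚ; 1ℚ)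
open import Relation.Nullary.Decidable using (⌊_⌋)
open import Relation.Binary.PropositionalEquality using (_≡_; _≢_)
open import Function.Bundles using (_⇔_)
open import Data.Bool.ListAction using () renaming (any to anyᵇ)
open import Data.Nat.ListAction using () renaming (sum to sumℕ)

record Matroid (n : ℕ) : Set where
  field
    rk        : Subset n → ℕ
    rk-∅      : rk ∅ₛ ≡ 0
    rk-card   : ∀ A → rk A ≤ ∣ A ∣
    rk-mono   : ∀ A B → A ⊆ B → rk A ≤ rk B
    rk-submod : ∀ A B → rk (A ∪ B) + rk (A ∩ B) ≤ rk A + rk B
open Matroid public

_≟ₛ_ : ∀ {n} (A B : Subset n) → _
_≟ₛ_ = ≡-dec BoolP._≟_

eqₛ : ∀ {n} → Subset n → Subset n → Bool
eqₛ A B = ⌊ A ≟ₛ B ⌋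

subₛ : ∀ {n} → Subset n → Subset n → Bool
subₛ A B = ⌊ A ⊆? B ⌋

allSubsets : ∀ n → List (Subset n)
allSubsets zero    = [] ∷ []
allSubsets (suc n) = List.concatMap (λ s → (true ∷ s) ∷ (false ∷ s) ∷ []) (allSubsets n)

module _ {n : ℕ} (M : Matroid n) where

  IsFlat : Subset n → Set
  IsFlat F = ∀ e → e ∉ F → rk M F < rk M (F ∪ ⁅ e ⁆)

  Loopless : Set
  Loopless = IsFlat ∅ₛ

  cl : Subset n → Subset n
  cl A = Vec.tabulate (λ e → ⌊ rk M (A ∪ ⁅ e ⁆) ℕ.≟ rk M A ⌋)

  _∨ₗ_ : Subset n → Subset n → Subset n
  F ∨ₗ H = cl (F ∪ H)

SetOfSubsets : ℕ → Set
SetOfSubsets n = Subset n → Bool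

maxBelow : ∀ {n} → SetOfSubsets n → Subset n → List (Subset n)
maxBelow {n} β F = List.filterᵇ isMax (allSubsets n)
  where
  isMax : Subset n → Bool
  isMax H = β H ∧ subₛ H F ∧
    not (anyᵇ (λ H' → β H' ∧ subₛ H' F ∧ subₛ H H' ∧ not (eqₛ H H')) (allSubsets n))

module _ {n : ℕ} (M : Matroid n) (β : SetOfSubsets n) where

  ValidTuple : (F : Subset n) → Vec (Subset n) (List.length (maxBelow β F)) → Set
  ValidTuple F t = ∀ j → IsFlat M (Vec.lookup t j)
                       × Vec.lookup t j ⊆ Vec.lookup (Vec.fromList (maxBelow β F)) j

  joinTuple : ∀ {k} → Vec (Subset n) k → Subset n
  joinTuple t = List.foldr (_∨ₗ_ M) ∅ₛ (Vec.toList t)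

  record JoinMapIso (F : Subset n) : Set where
    field
      into : ∀ t → ValidTuple F t → IsFlat M (joinTuple t) × joinTuple t ⊆ F
      inj  : ∀ t t' → ValidTuple F t → ValidTuple F t' → joinTuple t ≡ joinTuple t' → t ≡ t'
      surj : ∀ K → IsFlat M K → K ⊆ F → ∃ λ t → ValidTuple F t × joinTuple t ≡ K
      ord  : ∀ t t' → ValidTuple F t → ValidTuple F t' →
             (∀ j → Vec.lookup t j ⊆ Vec.lookup t' j) ⇔ (joinTuple t ⊆ joinTuple t')

  record IsBuildingSet : Set where
    field
      flats    : ∀ H → β H ≡ true → IsFlat M H × H ≢ ∅ₛ
      iso      : ∀ F → IsFlat M F → JoinMapIso F
      rank-sum : ∀ F → IsFlat M F → rk M F ≡ sumℕ (List.map (rk M) (maxBelow β F))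

removeB : ∀ {n} → SetOfSubsets n → Subset n → SetOfSubsets n
removeB β G H = β H ∧ not (eqₛ H G)

restrictB : ∀ {n} → SetOfSubsets n → Subset n → SetOfSubsets n
restrictB β G H = β H ∧ subₛ H G

-- 𝒢'/G = { H ∨ G : H ∈ 𝒢', H ⊈ G }  (inside [G,E] ≅ 𝓛(M/G))
contractB : ∀ {n} → Matroid n → SetOfSubsets n → Subset n → SetOfSubsets n
contractB {n} M β G K =
  anyᵇ (λ H → β H ∧ not (subₛ H G) ∧ eqₛ K (_∨ₗ_ M H G)) (allSubsets n)

Mono : ℕ → Set
Mono m = Vec ℕ m

Poly : ℕ → Set
Poly m = List (ℚ × Mono m)

module _ {m : ℕ} where

  coeff : Poly m → Mono m → ℚ
  coeff p α = List.foldr (λ t acc → if ⌊ ≡-dec ℕ._≟_ (proj₂ t) α ⌋ then proj₁ t ℚ.+ acc else acc) 0ℚ p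

  _≈ₚ_ : Poly m → Poly m → Set
  p ≈ₚ q = ∀ α → coeff p α ≡ coeff q α

  _*ₚ_ : Poly m → Poly m → Poly m
  p *ₚ q = List.concatMap (λ s → List.map (λ t → (proj₁ s ℚ.* proj₁ t , Vec.zipWith _+_ (proj₂ s) (proj₂ t))) q) p

  scaleₚ : ℚ → Poly m → Poly m
  scaleₚ c p = List.map (λ t → (c ℚ.* proj₁ t , proj₂ t)) p

  _-ₚ_ : Poly m → Poly m → Poly m
  p -ₚ q = p ++ scaleₚ (ℚ.- 1ℚ) q

  oneₚ : Poly m
  oneₚ = (1ℚ , Vec.replicate m 0) ∷ []

  _^ₚ_ : Poly m → ℕ → Poly m
  p ^ₚ zero  = oneₚ
  p ^ₚ suc e = p *ₚ (p ^ₚ e)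

  varₚ : Fin m → Poly m
  varₚ j = (1ℚ , Vec.tabulate (λ i → if ⌊ i Fin.≟ j ⌋ then 1 else 0)) ∷ []

  Homogeneous : ℕ → Poly m → Set
  Homogeneous i p = All (λ t → Vec.sum (proj₂ t) ≡ i) p

  linComb : ∀ {d} → Vec ℚ d → Vec (Poly m) d → Poly m
  linComb cs vs = List.concat (Vec.toList (Vec.zipWith scaleₚ cs vs))

  InIdeal : List (Poly m) → Poly m → Set
  InIdeal gens p = ∃ λ (qs : List (Poly m × Poly m)) →
    All (λ qg → proj₂ qg ∈ₗ gens) qs ×
    (List.concatMap (λ qg → proj₁ qg *ₚ proj₂ qg) qs ≈ₚ p)

-- Chow ring D(N, 𝓑) for N = the matroid whose lattice of flats is the
-- interval [Z, E] of 𝓛(M) (rank rk(·) − rk(Z), join = join of 𝓛(M),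
-- bottom Z), and 𝓑 ⊆ [Z,E] given by β.
--   Z = ∅          : M itself, or M|_G when 𝓑 consists of flats ⊆ G;
--   Z = G          : M/G.

module Chow {n : ℕ} (M : Matroid n) (Z : Subset n) (β : SetOfSubsets n) where

  elemList : List (Subset n)
  elemList = List.filterᵇ β (allSubsets n)

  m : ℕ
  m = List.length elemList

  elems : Vec (Subset n) m
  elems = Vec.fromList elemList

  B[_] : Fin m → Subset n
  B[ j ] = Vec.lookup elems j

  rkN : Subset n → ℕ
  rkN A = rk M A ∸ rk M Z

  gen : Subset m → Fin m → Poly m
  gen S b = prodS *ₚ (sumAbove ^ₚ (rkN B ∸ rkN supSB))
    where
    B : Subset n
    B = B[ b ]
    prodS : Poly m
    prodS = (1ℚ , Vec.map (λ s → if s then 1 else 0) S) ∷ []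
    below : Fin m → Bool
    below j = Vec.lookup S j ∧ subₛ B[ j ] B ∧ not (eqₛ B[ j ] B)
    supSB : Subset n
    supSB = List.foldr (λ j acc → if below j then _∨ₗ_ M B[ j ] acc else acc) Z (List.allFin m)
    sumAbove : Poly m
    sumAbove = List.concatMap (λ j → if subₛ B B[ j ] then varₚ j else []) (List.allFin m)

  gens : List (Poly m)
  gens = List.concatMap (λ S → List.map (gen S) (List.allFin m)) (allSubsets m)

  -- dim_ℚ D^i(N,𝓑) = d : there are d homogeneous degree-i polynomials whose
  -- classes form a basis of (degree-i polynomials) / (ideal ∩ degree i)
  HasDim : ℕ → ℕ → Set
  HasDim i d = ∃ λ (vs : Vec (Poly m) d) →
      (∀ j → Homogeneous i (Vec.lookup vs j))
    × (∀ (cs : Vec ℚ d) → InIdeal gens (linComb cs vs) → ∀ j → Vec.lookup cs j ≡ 0ℚ)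
    × (∀ p → Homogeneous i p → ∃ λ (cs : Vec ℚ d) → InIdeal gens (p -ₚ linComb cs vs))

sumTo : (ℕ → ℕ) → ℕ → ℕ
sumTo f zero    = f 0
sumTo f (suc i) = sumTo f i + f (suc i)

conv : (ℕ → ℕ) → (ℕ → ℕ) → ℕ → ℕ
conv f g i = sumTo (λ a → f a * g (i ∸ a)) i

-- coefficients of x + x² + ⋯ + x^{k-1}  (zero polynomial if k ≤ 1)
geomCoeff : ℕ → ℕ → ℕ
geomCoeff k j = if ⌊ 1 ℕ.≤? j ⌋ ∧ ⌊ suc j ℕ.≤? k ⌋ then 1 else 0

{-# OPTIONS --safe #-}
-- In D(N, 𝓑) put y_B = Σ_{H ⊇ B} x_H. The defining relations are a Gröbner basis with leading terms (∏ x_{B_i}) x_B^d, for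
-- the partial order in which replacing some x_B by x_H with H ⊋ B makes a monomial smaller. The S-pair of relations for B ⊊ C
-- is resolved by expanding y_B: factors x_H with H ⊊ C or with H incomparable to C (then H ∨ C ∈ 𝓑) give smaller relations,
-- and those with H ⊇ C recombine to powers of y_C, which vanish by submodularity. Independence of the standard monomials is
-- obtained from functionals on monomials defined by rewriting. Hence dim Dⁱ counts the exponent functions f of degree i with
-- f(B) < rk B - rk(Z ∪ ⋃ {C ⊊ B : f(C) > 0}) for all B ∈ 𝓑.
--
-- Standard functions for 𝒢 vanishing at G are those for 𝒢' whose support below G does not span G. All other functions, for 𝒢
-- and for 𝒢', split into an exponent j at G, a function f for 𝒢'|_G and one for 𝒢'/G, with 1 ≤ j < c(f) in the case of 𝒢 and
-- j = c(f) = 0 in the case of 𝒢', where c(f) is the corank in G of the support of f. As c(f) is a sum over the k factors of G,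
-- exchanging j against the exponents at these factors one factor at a time replaces the bound c(f) by k.
module Submission where

open import Defs
open import Algebra.Structures using (IsCommutativeMonoid; IsAbelianGroup)
open import Data.Nat as ℕ using (ℕ; zero; suc; _+_; _*_; _∸_; _≤_; _<_; z≤n; s≤s; _≤?_; _<?_)
open import Data.Nat.Properties
open import Data.Nat.Solver using (module +-*-Solver)
open +-*-Solver using (solve; _:+_; _:*_; _:=_)
open import Data.Bool using (Bool; true; false; _∧_; not; if_then_else_; T; T?)
import Data.Bool.Properties as BoolP
open import Data.Bool.ListAction using () renaming (any to anyᵇ)
open import Data.Nat.ListAction using () renaming (sum to sumℕ)
open import Data.Fin as Fin using (Fin; zero; suc)
import Data.Fin.Properties as Finₚ
open import Data.Fin.Subset using (Subset; _∪_; _∩_; _⊆_; _∈_; ⁅_⁆; ∣_∣; ⋃)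
  renaming (⊥ to ∅ₛ)
open import Data.Fin.Subset.Properties
  using (_⊆?_; _∈?_; x∈⁅x⁆; x∈⁅y⁆⇒x≡y; ⊆-antisym; ⊆-refl; ⊆-trans; ∉⊥; p⊆p∪q; q⊆p∪q; x∈p∪q⁻; x∈p∩q⁺;
         p⊂q⇒∣p∣<∣q∣; p⊆q⇒∣p∣≤∣q∣; ∣p∣≤n; _⊂?_)
open import Data.Vec as Vec using (Vec; []; _∷_; lookup; updateAt; tabulate)
import Data.Vec.Properties as Vecₚ
open import Data.List as List using (List; []; _∷_; _++_; map; concatMap; filter; filterᵇ; allFin; length)
import Data.List.Properties as Listₚ
open import Data.List.Membership.Propositional using () renaming (_∈_ to _∈ₗ_)
import Data.List.Membership.Propositional.Properties as ∈ₚ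
open import Data.List.Relation.Unary.All as All using (All; []; _∷_)
import Data.List.Relation.Unary.All.Properties as Allₚ
open import Data.List.Relation.Unary.Any as Any using (Any; here; there)
import Data.List.Relation.Unary.Any.Properties as Anyₚ
open import Data.List.Relation.Unary.AllPairs using ([]; _∷_)
open import Data.List.Relation.Unary.Unique.Propositional using (Unique)
import Data.List.Relation.Unary.Unique.Propositional.Properties as Uniqueₚ
open import Data.Product using (∃; _×_; _,_; proj₁; proj₂)
open import Data.Sum using (_⊎_; inj₁; inj₂; [_,_]′)
open import Data.Sum.Relation.Binary.Pointwise using (Pointwise; inj₁; inj₂; ⊎-refl; ⊎-symmetric; ⊎-transitive)
open import Data.Empty using (⊥; ⊥-elim)
open import Data.Unit using (⊤; tt)
open import Data.Rational as ℚ using (ℚ; 0ℚ; 1ℚ)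
import Data.Rational.Properties as ℚₚ
import Data.Rational.Solver as ℚSolver
open import Function using (_∘_; id)
open import Relation.Nullary using (¬_; Dec; yes; no; contradiction)
open import Relation.Nullary.Decidable using (⌊_⌋; _×-dec_; _⊎-dec_; ¬?; map′)
open import Relation.Binary.PropositionalEquality hiding (J)

-- Finite sums over lists

-- The ideal is known only through its generators and polynomials are unnormalised lists of terms,
-- so nothing is computed in a quotient. A functional with prescribed values on the standard
-- monomials is defined by recursion on a weight. By construction it respects one chosen relation at
-- each non-standard monomial; that it kills every relation is what the S-pair computation is for.
-- The functionals dual to the standard monomials of a degree then detect membership in the ideal in
-- that degree.
--
-- The property of the family of flats that drives this is that two members containing a common
-- member have their join in the family. It passes directly to `𝒢'|_G` and `𝒢'/G`, so one argument
-- serves all four rings.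
--
-- All counting is done by degree-preserving bijections between sets of functions on subsets. A
-- bound with exponent 0 is still a condition: it says that the support below a member does not span
-- that member. At `G` this is exactly what distinguishes the two building sets on functions that
-- vanish at `G`.

when : ∀ {A P : Set} → A → Dec P → A → A
when ε (yes _) a = a
when ε (no _)  a = ε

module Summation {A : Set} {_∙_ : A → A → A} {ε : A} (isCM : IsCommutativeMonoid _≡_ _∙_ ε) where
  open IsCommutativeMonoid isCM using (assoc; comm; identityˡ; identityʳ)
  open ≡-Reasoning

  ⅀ : ∀ {I : Set} → List I → (I → A) → A
  ⅀ []       f = ε
  ⅀ (x ∷ xs) f = f x ∙ ⅀ xs f

  medial : ∀ a b c d → ((a ∙ b) ∙ (c ∙ d)) ≡ ((a ∙ c) ∙ (b ∙ d))
  medial a b c d = begin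
    (a ∙ b) ∙ (c ∙ d)  ≡⟨ assoc a b (c ∙ d) ⟩
    a ∙ (b ∙ (c ∙ d))  ≡⟨ cong (a ∙_) (assoc b c d) ⟨
    a ∙ ((b ∙ c) ∙ d)  ≡⟨ cong (λ z → a ∙ (z ∙ d)) (comm b c) ⟩
    a ∙ ((c ∙ b) ∙ d)  ≡⟨ cong (a ∙_) (assoc c b d) ⟩
    a ∙ (c ∙ (b ∙ d))  ≡⟨ assoc a c (b ∙ d) ⟨
    (a ∙ c) ∙ (b ∙ d)  ∎

  module _ {I : Set} where

    ⅀-cong : ∀ (xs : List I) {f g} → (∀ x → f x ≡ g x) → ⅀ xs f ≡ ⅀ xs g
    ⅀-cong []       e = refl
    ⅀-cong (x ∷ xs) e = cong₂ _∙_ (e x) (⅀-cong xs e)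

    ⅀-zero : ∀ (xs : List I) → ⅀ xs (λ _ → ε) ≡ ε
    ⅀-zero []       = refl
    ⅀-zero (x ∷ xs) = trans (identityˡ _) (⅀-zero xs)

    ⅀-distrib : ∀ (xs : List I) f g → ⅀ xs (λ x → f x ∙ g x) ≡ (⅀ xs f ∙ ⅀ xs g)
    ⅀-distrib []       f g = sym (identityˡ ε)
    ⅀-distrib (x ∷ xs) f g = trans (cong (_ ∙_) (⅀-distrib xs f g)) (medial _ _ _ _)

    ⅀-single : ∀ {xs : List I} {a} f → Unique xs → a ∈ₗ xs → (∀ x → x ≢ a → f x ≡ ε) → ⅀ xs f ≡ f a
    ⅀-single {x ∷ xs} f (x∉ ∷ u) (here refl) z = begin
      f x ∙ ⅀ xs f  ≡⟨ cong (f x ∙_) (tail-zero xs x∉) ⟩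
      f x ∙ ε       ≡⟨ identityʳ _ ⟩
      f x           ∎
      where
      tail-zero : ∀ ys → All (x ≢_) ys → ⅀ ys f ≡ ε
      tail-zero []       []       = refl
      tail-zero (y ∷ ys) (p ∷ ps) =
        trans (cong₂ _∙_ (z y (p ∘ sym)) (tail-zero ys ps)) (identityˡ ε)
    ⅀-single {x ∷ xs} f (x∉ ∷ u) (there a∈) z =
      trans (cong₂ _∙_ (z x λ { refl → All.lookup x∉ a∈ refl }) (⅀-single f u a∈ z)) (identityˡ _)

    ⅀-map : ∀ {J : Set} (h : J → I) (xs : List J) f → ⅀ (map h xs) f ≡ ⅀ xs (f ∘ h)
    ⅀-map h []       f = refl
    ⅀-map h (x ∷ xs) f = cong (_ ∙_) (⅀-map h xs f)

  ⅀-swap : ∀ {I J : Set} (xs : List I) (ys : List J) (f : I → J → A) →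
           ⅀ xs (λ x → ⅀ ys (f x)) ≡ ⅀ ys (λ y → ⅀ xs (λ x → f x y))
  ⅀-swap []       ys f = sym (⅀-zero ys)
  ⅀-swap (x ∷ xs) ys f = trans (cong (_ ∙_) (⅀-swap xs ys f)) (sym (⅀-distrib ys _ _))

  when-ε : ∀ {P : Set} (p : Dec P) {a} → (P → a ≡ ε) → when ε p a ≡ ε
  when-ε (yes p) e = e p
  when-ε (no _)  e = refl

  when-cong : ∀ {P : Set} (p : Dec P) {a b} → (P → a ≡ b) → when ε p a ≡ when ε p b
  when-cong (yes p) e = e p
  when-cong (no _)  e = refl

  when-⅀ : ∀ {P I : Set} (p : Dec P) (xs : List I) f → when ε p (⅀ xs f) ≡ ⅀ xs (λ x → when ε p (f x))
  when-⅀ (yes _) xs f = refl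
  when-⅀ (no _)  xs f = sym (⅀-zero xs)

  when-comm : ∀ {P R : Set} (p : Dec P) (r : Dec R) a → when ε p (when ε r a) ≡ when ε r (when ε p a)
  when-comm (yes _) r       a = refl
  when-comm (no _)  (yes _) a = refl
  when-comm (no _)  (no _)  a = refl

when-yes : ∀ {A P : Set} {ε : A} (p : Dec P) {a} → P → when ε p a ≡ a
when-yes (yes _) _ = refl
when-yes (no ¬p) p = contradiction p ¬p

when-no : ∀ {A P : Set} {ε : A} (p : Dec P) {a} → ¬ P → when ε p a ≡ ε
when-no (yes p) ¬p = contradiction p ¬p
when-no (no _)  _  = refl

allSubsets-complete : ∀ {n} (A : Subset n) → A ∈ₗ allSubsets n
allSubsets-complete []      = here refl
allSubsets-complete (b ∷ A) = ∈ₚ.∈-concatMap⁺ _ (Any.map (λ { refl → both b }) (allSubsets-complete A))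
  where
  both : ∀ b → (b ∷ A) ∈ₗ ((true ∷ A) ∷ (false ∷ A) ∷ [])
  both true  = here refl
  both false = there (here refl)

allSubsets-unique : ∀ n → Unique (allSubsets n)
allSubsets-unique zero    = [] ∷ []
allSubsets-unique (suc n) = double (allSubsets n) (allSubsets-unique n)
  where
  extend : Subset n → List (Subset (suc n))
  extend s = (true ∷ s) ∷ (false ∷ s) ∷ []
  fresh : ∀ {s b} xs → All (s ≢_) xs → All ((b ∷ s) ≢_) (concatMap extend xs)
  fresh []       []       = []
  fresh (x ∷ xs) (p ∷ ps) = (λ { refl → p refl }) ∷ (λ { refl → p refl }) ∷ fresh xs ps
  double : ∀ xs → Unique xs → Unique (concatMap extend xs)
  double []       []       = []
  double (x ∷ xs) (p ∷ ps) = ((λ ()) ∷ fresh xs p) ∷ fresh xs p ∷ double xs ps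

when-⇔ : ∀ {A P R : Set} {ε : A} (p : Dec P) (r : Dec R) {a} → (P → R) → (R → P) → when ε p a ≡ when ε r a
when-⇔ (yes _) (yes _) f g = refl
when-⇔ (yes p) (no ¬r) f g = contradiction (f p) ¬r
when-⇔ (no ¬p) (yes r) f g = contradiction (g r) ¬p
when-⇔ (no _)  (no _)  f g = refl

-- Unions, ranks and closures

∪-lub : ∀ {n} {A B C : Subset n} → A ⊆ C → B ⊆ C → (A ∪ B) ⊆ C
∪-lub {A = A} {B} A⊆C B⊆C x∈ = [ A⊆C , B⊆C ]′ (x∈p∪q⁻ A B x∈)

⊆∪ˡ : ∀ {n} {A B : Subset n} → A ⊆ (A ∪ B)
⊆∪ˡ {A = A} {B} = p⊆p∪q {p = A} B

⊆∪ʳ : ∀ {n} {A B : Subset n} → B ⊆ (A ∪ B)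
⊆∪ʳ {A = A} {B} = q⊆p∪q A B

∩-glb : ∀ {n} {A B C : Subset n} → C ⊆ A → C ⊆ B → C ⊆ (A ∩ B)
∩-glb C⊆A C⊆B x∈ = x∈p∩q⁺ (C⊆A x∈ , C⊆B x∈)

∅⊆ : ∀ {n} {A : Subset n} → ∅ₛ ⊆ A
∅⊆ x∈ = ⊥-elim (∉⊥ x∈)

⋃-upper : ∀ {n} {A : Subset n} {xs} → A ∈ₗ xs → A ⊆ ⋃ xs
⋃-upper (here refl) = ⊆∪ˡ
⋃-upper (there A∈)  = ⊆-trans (⋃-upper A∈) ⊆∪ʳ

⋃-least : ∀ {n} {B : Subset n} (xs : List (Subset n)) → (∀ {A} → A ∈ₗ xs → A ⊆ B) → ⋃ xs ⊆ B
⋃-least []       h = ∅⊆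
⋃-least (A ∷ xs) h = ∪-lub (h (here refl)) (⋃-least xs (h ∘ there))

_⊊_ : ∀ {n} → Subset n → Subset n → Set
A ⊊ B = A ⊆ B × ¬ (B ⊆ A)

_⊊?_ : ∀ {n} (A B : Subset n) → Dec (A ⊊ B)
A ⊊? B = (A ⊆? B) ×-dec ¬? (B ⊆? A)

⊆∧≢⇒⊊ : ∀ {n} {A B : Subset n} → A ⊆ B → A ≢ B → A ⊊ B
⊆∧≢⇒⊊ A⊆B A≢B = A⊆B , λ B⊆A → A≢B (⊆-antisym A⊆B B⊆A)

⊊-⊆-trans : ∀ {n} {A B C : Subset n} → A ⊊ B → B ⊆ C → A ⊊ C
⊊-⊆-trans (A⊆B , B⊈A) B⊆C = ⊆-trans A⊆B B⊆C , λ C⊆A → B⊈A (⊆-trans B⊆C C⊆A)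

⊆-⊊-trans : ∀ {n} {A B C : Subset n} → A ⊆ B → B ⊊ C → A ⊊ C
⊆-⊊-trans A⊆B (B⊆C , C⊈B) = ⊆-trans A⊆B B⊆C , λ C⊆A → C⊈B (⊆-trans C⊆A A⊆B)

⊊⇒≢ : ∀ {n} {A B : Subset n} → A ⊊ B → A ≢ B
⊊⇒≢ (_ , B⊈A) refl = B⊈A ⊆-refl

⊊⇒∣∣< : ∀ {n} {A B : Subset n} → A ⊊ B → ∣ A ∣ < ∣ B ∣
⊊⇒∣∣< {A = A} {B} (A⊆B , B⊈A) with A ⊂? B
... | yes A⊂B = p⊂q⇒∣p∣<∣q∣ A⊂B
... | no  A⊄B = ⊥-elim (B⊈A B⊆A)
  where
  B⊆A : B ⊆ A
  B⊆A {x} x∈B with x ∈? A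
  ... | yes x∈A = x∈A
  ... | no  x∉A = ⊥-elim (A⊄B (A⊆B , x , x∈B , x∉A))

unionOver : ∀ {n} {I : Set} {P : I → Set} → Subset n → (I → Subset n) → List I → (∀ i → Dec (P i)) → Subset n
unionOver Z B xs P? = Z ∪ ⋃ (map B (filter P? xs))

module _ {n : ℕ} {I : Set} {P : I → Set} (P? : ∀ i → Dec (P i)) {Z : Subset n} {B : I → Subset n} {xs : List I} where

  base⊆unionOver : Z ⊆ unionOver Z B xs P?
  base⊆unionOver = ⊆∪ˡ

  ⊆unionOver : ∀ {i} → i ∈ₗ xs → P i → B i ⊆ unionOver Z B xs P?
  ⊆unionOver i∈ p = ⊆-trans (⋃-upper (∈ₚ.∈-map⁺ B (∈ₚ.∈-filter⁺ P? i∈ p))) ⊆∪ʳ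

  unionOver⊆ : ∀ {C} → Z ⊆ C → (∀ i → i ∈ₗ xs → P i → B i ⊆ C) → unionOver Z B xs P? ⊆ C
  unionOver⊆ {C} Z⊆C h = ∪-lub Z⊆C (⋃-least (map B (filter P? xs)) below)
    where
    below : ∀ {A} → A ∈ₗ map B (filter P? xs) → A ⊆ C
    below A∈ with ∈ₚ.∈-map⁻ B A∈
    ... | i , i∈ , refl = h i (proj₁ (∈ₚ.∈-filter⁻ P? {xs = xs} i∈)) (proj₂ (∈ₚ.∈-filter⁻ P? {xs = xs} i∈))

module Rank {n : ℕ} (M : Matroid n) where
  open ≤-Reasoning

  r : Subset n → ℕ
  r = rk M

  r-mono : ∀ {A B} → A ⊆ B → r A ≤ r B
  r-mono = rk-mono M _ _

  -- Neither the union nor the intersection has to be identified: a set inside the one and a set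
  -- inside both arguments suffice.
  submodular : ∀ X Y {V W} → V ⊆ (X ∪ Y) → W ⊆ X → W ⊆ Y → r V + r W ≤ r X + r Y
  submodular X Y {V} {W} V⊆ W⊆X W⊆Y = begin
    r V + r W              ≤⟨ +-mono-≤ (r-mono V⊆) (r-mono (∩-glb W⊆X W⊆Y)) ⟩
    r (X ∪ Y) + r (X ∩ Y)  ≤⟨ rk-submod M X Y ⟩
    r X + r Y              ∎

  subadditive : ∀ X Y → r (X ∪ Y) ≤ r X + r Y
  subadditive X Y = ≤-trans (m≤m+n _ _) (rk-submod M X Y)

  -- Submodularity of `B` and `A ∪ C`: adding `C` raises the rank of the larger set by at most as
  -- much as that of the smaller one.
  absorb : ∀ {A B} C → A ⊆ B → r (A ∪ C) ≤ r A → r (B ∪ C) ≤ r B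
  absorb {A} {B} C A⊆B h = +-cancelʳ-≤ (r A) _ _ (begin
    r (B ∪ C) + r A  ≤⟨ submodular B (A ∪ C) (∪-lub ⊆∪ˡ (⊆-trans ⊆∪ʳ ⊆∪ʳ)) A⊆B ⊆∪ˡ ⟩
    r B + r (A ∪ C)  ≤⟨ +-monoʳ-≤ (r B) h ⟩
    r B + r A        ∎)

  absorb-all : ∀ X Y → (∀ {e} → e ∈ Y → r (X ∪ ⁅ e ⁆) ≤ r X) → r (X ∪ Y) ≤ r X
  absorb-all X Y h = ≤-trans (r-mono (∪-lub ⊆∪ˡ Y⊆)) (go (filter (_∈? Y) (allFin n)) (λ e∈ → h (proj₂ (∈ₚ.∈-filter⁻ (_∈? Y) {xs = allFin n} e∈))))
    where
    Y⊆ : Y ⊆ (X ∪ ⋃ (map ⁅_⁆ (filter (_∈? Y) (allFin n))))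
    Y⊆ {e} e∈ = ⊆-trans (⋃-upper (∈ₚ.∈-map⁺ ⁅_⁆ (∈ₚ.∈-filter⁺ (_∈? Y) (∈ₚ.∈-allFin e) e∈))) ⊆∪ʳ (x∈⁅x⁆ e)
    go : ∀ es → (∀ {e} → e ∈ₗ es → r (X ∪ ⁅ e ⁆) ≤ r X) → r (X ∪ ⋃ (map ⁅_⁆ es)) ≤ r X
    go []       _ = r-mono (∪-lub ⊆-refl ∅⊆)
    go (e ∷ es) k = begin
      r (X ∪ (⁅ e ⁆ ∪ W))  ≤⟨ r-mono (∪-lub (⊆-trans ⊆∪ˡ ⊆∪ˡ) (∪-lub ⊆∪ʳ (⊆-trans ⊆∪ʳ ⊆∪ˡ))) ⟩
      r ((X ∪ W) ∪ ⁅ e ⁆)  ≤⟨ absorb ⁅ e ⁆ ⊆∪ˡ (k (here refl)) ⟩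
      r (X ∪ W)            ≤⟨ go es (k ∘ there) ⟩
      r X                  ∎
      where
      W : Subset n
      W = ⋃ (map ⁅_⁆ es)

  ∈cl⁺ : ∀ {A e} → r (A ∪ ⁅ e ⁆) ≤ r A → e ∈ cl M A
  ∈cl⁺ {A} {e} h = Vecₚ.lookup⇒[]= e _ (trans (Vecₚ.lookup∘tabulate _ e) (dec-true≡ (≤-antisym h (r-mono ⊆∪ˡ))))
    where
    dec-true≡ : r (A ∪ ⁅ e ⁆) ≡ r A → ⌊ r (A ∪ ⁅ e ⁆) ℕ.≟ r A ⌋ ≡ true
    dec-true≡ p with r (A ∪ ⁅ e ⁆) ℕ.≟ r A
    ... | yes _ = refl
    ... | no ¬p = contradiction p ¬p

  ∈cl⁻ : ∀ {A e} → e ∈ cl M A → r (A ∪ ⁅ e ⁆) ≤ r A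
  ∈cl⁻ {A} {e} e∈ = from (trans (sym (Vecₚ.lookup∘tabulate _ e)) (Vecₚ.[]=⇒lookup e∈))
    where
    from : ⌊ r (A ∪ ⁅ e ⁆) ℕ.≟ r A ⌋ ≡ true → r (A ∪ ⁅ e ⁆) ≤ r A
    from q with r (A ∪ ⁅ e ⁆) ℕ.≟ r A
    ... | yes p = ≤-reflexive p
    from () | no _

  ⊆cl : ∀ {A} → A ⊆ cl M A
  ⊆cl {A} {e} e∈ = ∈cl⁺ (r-mono (∪-lub ⊆-refl λ x∈ → subst (_∈ A) (sym (x∈⁅y⁆⇒x≡y e x∈)) e∈))

  r-cl : ∀ A → r (cl M A) ≤ r A
  r-cl A = ≤-trans (r-mono ⊆∪ʳ) (absorb-all A (cl M A) ∈cl⁻)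

  cl-flat : ∀ A → IsFlat M (cl M A)
  cl-flat A e e∉ = ≰⇒> λ h → e∉ (∈cl⁺ (begin
    r (A ∪ ⁅ e ⁆)       ≤⟨ r-mono (∪-lub (⊆-trans ⊆cl ⊆∪ˡ) ⊆∪ʳ) ⟩
    r (cl M A ∪ ⁅ e ⁆)  ≤⟨ h ⟩
    r (cl M A)          ≤⟨ r-cl A ⟩
    r A                 ∎))

  flat-absorbs : ∀ {A F} → IsFlat M F → r (F ∪ A) ≤ r F → A ⊆ F
  flat-absorbs {A} {F} flat h {e} e∈ with e ∈? F
  ... | yes e∈F = e∈F
  ... | no  e∉F = ⊥-elim (<⇒≱ (flat e e∉F) (≤-trans (r-mono (∪-lub ⊆∪ˡ ⁅e⁆⊆)) h))
    where
    ⁅e⁆⊆ : ⁅ e ⁆ ⊆ (F ∪ A)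
    ⁅e⁆⊆ x∈ = ⊆∪ʳ (subst (_∈ A) (sym (x∈⁅y⁆⇒x≡y e x∈)) e∈)

  cl-least : ∀ {A F} → A ⊆ F → IsFlat M F → cl M A ⊆ F
  cl-least {A} {F} A⊆F flat = flat-absorbs flat (absorb (cl M A) A⊆F (≤-trans (r-mono (∪-lub ⊆cl ⊆-refl)) (r-cl A)))

  cl-mono : ∀ {A B} → A ⊆ B → cl M A ⊆ cl M B
  cl-mono {B = B} A⊆B = cl-least (⊆-trans A⊆B ⊆cl) (cl-flat B)

  ⊆cl-rank : ∀ {A B} → A ⊆ B → r B ≤ r A → B ⊆ cl M A
  ⊆cl-rank {A} {B} A⊆B h = flat-absorbs (cl-flat A) (absorb B ⊆cl (≤-trans (r-mono (∪-lub A⊆B ⊆-refl)) h))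

-- Normal forms of monomials

infixl 7 _⊕_

_⊕_ : ∀ {m} → Mono m → Fin m → Mono m
ν ⊕ j = updateAt ν j suc

pow : ∀ {m} → Mono m → Fin m → ℕ → Mono m
pow ν j l = updateAt ν j (l +_)

clear : ∀ {m} → Mono m → Fin m → Mono m
clear ν j = updateAt ν j (λ _ → 0)

module _ {m : ℕ} where

  ⊕-comm : ∀ (ν : Mono m) i j → ν ⊕ i ⊕ j ≡ ν ⊕ j ⊕ i
  ⊕-comm ν i j with i Fin.≟ j
  ... | yes refl = refl
  ... | no  i≢j  = Vecₚ.updateAt-commutes j i (i≢j ∘ sym) ν

  pow-⊕ : ∀ (ν : Mono m) j l → pow (ν ⊕ j) j l ≡ pow ν j (suc l)
  pow-⊕ ν j l = trans (Vecₚ.updateAt-updateAt j ν) (Vecₚ.updateAt-cong j (+-suc l) ν)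

  pow-clear : ∀ (ν : Mono m) j → pow (clear ν j) j (lookup ν j) ≡ ν
  pow-clear ν j = trans (Vecₚ.updateAt-updateAt j ν) (Vecₚ.updateAt-id-local j ν (+-identityʳ _))

  clear-pow : ∀ (ν : Mono m) j l → clear (pow ν j l) j ≡ clear ν j
  clear-pow ν j l = Vecₚ.updateAt-updateAt j ν

  clear-comm : ∀ (ν : Mono m) i j → i ≢ j → clear (clear ν i) j ≡ clear (clear ν j) i
  clear-comm ν i j i≢j = Vecₚ.updateAt-commutes j i (i≢j ∘ sym) ν

  pow-clear₂ : ∀ (ν : Mono m) i j → i ≢ j → pow (clear (clear ν i) j) j (lookup ν j) ≡ clear ν i
  pow-clear₂ ν i j i≢j = begin
    pow (clear (clear ν i) j) j (lookup ν j)            ≡⟨ cong (pow _ j) (Vecₚ.lookup∘updateAt′ j i (i≢j ∘ sym) ν) ⟨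
    pow (clear (clear ν i) j) j (lookup (clear ν i) j)  ≡⟨ pow-clear (clear ν i) j ⟩
    clear ν i                                           ∎
    where open ≡-Reasoning

  pow-≥ : ∀ (ν : Mono m) j l i → lookup ν i ≤ lookup (pow ν j l) i
  pow-≥ ν j l i with i Fin.≟ j
  ... | yes refl rewrite Vecₚ.lookup∘updateAt j {f = l +_} ν = m≤n+m _ l
  ... | no  i≢j  rewrite Vecₚ.lookup∘updateAt′ i j {f = l +_} i≢j ν = ≤-refl

  ⊕-≥ : ∀ (ν : Mono m) j i → lookup ν i ≤ lookup (ν ⊕ j) i
  ⊕-≥ ν j = pow-≥ ν j 1

  1≤⊕ : ∀ (ν : Mono m) j → 1 ≤ lookup (ν ⊕ j) j
  1≤⊕ ν j rewrite Vecₚ.lookup∘updateAt j {f = suc} ν = s≤s z≤n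

weigh : ∀ {m} → (Fin m → ℕ) → Mono m → ℕ
weigh w []      = 0
weigh w (x ∷ ν) = x * w zero + weigh (w ∘ suc) ν

weigh-⊕ : ∀ {m} w (ν : Mono m) j → weigh w (ν ⊕ j) ≡ weigh w ν + w j
weigh-⊕ w (x ∷ ν) zero    = trans (+-assoc (w zero) _ _) (+-comm (w zero) _)
weigh-⊕ w (x ∷ ν) (suc j) = trans (cong (x * w zero +_) (weigh-⊕ (w ∘ suc) ν j)) (sym (+-assoc (x * w zero) _ _))

weigh-pow : ∀ {m} w (ν : Mono m) j l → weigh w (pow ν j l) ≡ weigh w ν + l * w j
weigh-pow w ν j zero    = trans (cong (weigh w) (Vecₚ.updateAt-id j ν)) (sym (+-identityʳ _))
weigh-pow w ν j (suc l) = begin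
  weigh w (pow ν j (suc l))      ≡⟨ cong (weigh w) (pow-⊕ ν j l) ⟨
  weigh w (pow (ν ⊕ j) j l)      ≡⟨ weigh-pow w (ν ⊕ j) j l ⟩
  weigh w (ν ⊕ j) + l * w j      ≡⟨ cong (_+ l * w j) (weigh-⊕ w ν j) ⟩
  weigh w ν + w j + l * w j      ≡⟨ +-assoc (weigh w ν) _ _ ⟩
  weigh w ν + (w j + l * w j)    ∎
  where open ≡-Reasoning

-- What the reduction theory asks of the flats that index the variables. The lower bound `c` in
-- `join` is essential: members without a common lower bound in the family may have a join outside
-- it.
record JoinClosed {n : ℕ} (M : Matroid n) (Z : Subset n) {m : ℕ} (B : Fin m → Subset n) : Set where
  field
    above-base : ∀ i → Z ⊆ B i
    injective  : ∀ {i j} → B i ⊆ B j → B j ⊆ B i → i ≡ j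
    join       : ∀ a b c → B c ⊆ B a → B c ⊆ B b →
                 ∃ λ e → B a ⊆ B e × B b ⊆ B e × rk M (B e) ≤ rk M (B a ∪ B b)
                         × (∀ x → B a ⊆ B x → B b ⊆ B x → B e ⊆ B x)

module Reduction {n : ℕ} (M : Matroid n) (Z : Subset n) {m : ℕ} (B : Fin m → Subset n) where
  open Rank M using (r)

  Contributes : Mono m → Fin m → Fin m → Set
  Contributes ν b c = 1 ≤ lookup ν c × B c ⊊ B b

  contributes? : ∀ ν b c → Dec (Contributes ν b c)
  contributes? ν b c = (1 ≤? lookup ν c) ×-dec (B c ⊊? B b)

  abstract
    -- A union in place of the join in the defining relations: only its rank enters, and closing up
    -- does not change the rank. The definition is sealed because it is used only as the least set
    -- containing `Z` and the contributing flats.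
    U : Mono m → Fin m → Subset n
    U ν b = unionOver Z B (allFin m) (contributes? ν b)

    ∈U : ∀ {ν b} c → 1 ≤ lookup ν c → B c ⊊ B b → B c ⊆ U ν b
    ∈U {ν} {b} c p q = ⊆unionOver (contributes? ν b) {B = B} {xs = allFin m} (∈ₚ.∈-allFin c) (p , q)

    U-least : ∀ {ν b C} → Z ⊆ C → (∀ c → 1 ≤ lookup ν c → B c ⊊ B b → B c ⊆ C) → U ν b ⊆ C
    U-least {ν} {b} Z⊆ h = unionOver⊆ (contributes? ν b) {B = B} {xs = allFin m} Z⊆ (λ c _ (p , q) → h c p q)

    Z⊆U : ∀ {ν b} → Z ⊆ U ν b
    Z⊆U {ν} {b} = base⊆unionOver (contributes? ν b) {B = B} {xs = allFin m}

  -- The relations put ν · (Σ_{B j ⊇ B b} x_j)^k into the ideal.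
  Member : Mono m → Fin m → ℕ → Set
  Member ν b k = r (B b) ≤ k + r (U ν b)

  -- Every `b` is tested, also with exponent 0. There the condition says that the variables of `μ`
  -- strictly below `B b` do not span it; otherwise `μ` itself lies in the ideal.
  Standard : Mono m → Set
  Standard μ = ∀ b → ¬ Member μ b (lookup μ b)

  member? : ∀ μ → Dec (∃ λ b → Member μ b (lookup μ b))
  member? μ = Finₚ.any? (λ b → r (B b) ≤? lookup μ b + r (U μ b))

  -- The complementary cardinality of the flats strictly decreases when a variable is replaced by one of a larger flat.
  wt : Fin m → ℕ
  wt j = n ∸ ∣ B j ∣

  meas : Mono m → ℕ
  meas = weigh wt

  wt-≤ : ∀ {i j} → B i ⊆ B j → wt j ≤ wt i
  wt-≤ B⊆ = ∸-monoʳ-≤ n (p⊆q⇒∣p∣≤∣q∣ B⊆)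

  wt-< : ∀ {i j} → B i ⊊ B j → wt j < wt i
  wt-< {j = j} B⊊ = ∸-monoʳ-< (⊊⇒∣∣< B⊊) (∣p∣≤n (B j))

  meas-⊕-≤ : ∀ {b j} k ν → B b ⊆ B j → meas (ν ⊕ j) + k * wt b ≤ meas ν + suc k * wt b
  meas-⊕-≤ {b} {j} k ν b⊆j = begin
    meas (ν ⊕ j) + k * wt b      ≡⟨ cong (_+ _) (weigh-⊕ wt ν j) ⟩
    meas ν + wt j + k * wt b     ≡⟨ +-assoc (meas ν) _ _ ⟩
    meas ν + (wt j + k * wt b)   ≤⟨ +-monoʳ-≤ (meas ν) (+-monoˡ-≤ _ (wt-≤ b⊆j)) ⟩
    meas ν + suc k * wt b        ∎
    where open ≤-Reasoning

  meas-⊕-< : ∀ {b j} k ν → B b ⊊ B j → meas (ν ⊕ j) + k * wt b < meas ν + suc k * wt b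
  meas-⊕-< {b} {j} k ν b⊊j = begin-strict
    meas (ν ⊕ j) + k * wt b      ≡⟨ cong (_+ _) (weigh-⊕ wt ν j) ⟩
    meas ν + wt j + k * wt b     ≡⟨ +-assoc (meas ν) _ _ ⟩
    meas ν + (wt j + k * wt b)   <⟨ +-monoʳ-< (meas ν) (+-monoˡ-< _ (wt-< b⊊j)) ⟩
    meas ν + suc k * wt b        ∎
    where open ≤-Reasoning

  U-mono : ∀ {ν ν' b} → (∀ c → lookup ν c ≤ lookup ν' c) → U ν b ⊆ U ν' b
  U-mono {ν' = ν'} {b} h = U-least Z⊆U (λ c p q → ∈U {ν'} {b} c (≤-trans p (h c)) q)

  Member-mono : ∀ {ν ν' b k} → (∀ c → lookup ν c ≤ lookup ν' c) → Member ν b k → Member ν' b k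
  Member-mono {ν} {ν'} {b} {k} h mem = ≤-trans mem (+-monoʳ-≤ k (Rank.r-mono M (U-mono {ν} {ν'} {b} h)))

  Member-≥ : ∀ {ν b k l} → k ≤ l → Member ν b k → Member ν b l
  Member-≥ k≤l mem = ≤-trans mem (+-monoˡ-≤ _ k≤l)

  module Values {Q : Set} {_∙_ : Q → Q → Q} {ε : Q} {neg : Q → Q} (isAG : IsAbelianGroup _≡_ _∙_ ε neg) where
    open IsAbelianGroup isAG using (isCommutativeMonoid)
    open Summation isCommutativeMonoid

    Σ↑ : Fin m → (Fin m → Q) → Q
    Σ↑ b t = ⅀ (allFin m) (λ j → when ε (B b ⊆? B j) (t j))

    -- Y ψ b k ν is the value at ν · y_b^k, y_b = Σ_{B j ⊇ B b} x_j, of the functional that is ψ on monomials; an exponent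
    -- vector stands for its monomial, and ν ⊕ j for x_j ν.
    Y : (Mono m → Q) → Fin m → ℕ → Mono m → Q
    Y ψ b zero    ν = ψ ν
    Y ψ b (suc k) ν = Σ↑ b (λ j → Y ψ b k (ν ⊕ j))

    Σ↑-cong : ∀ b {t t'} → (∀ j → B b ⊆ B j → t j ≡ t' j) → Σ↑ b t ≡ Σ↑ b t'
    Σ↑-cong b h = ⅀-cong (allFin m) (λ j → when-cong (B b ⊆? B j) (λ b⊆ → h j b⊆))

    Σ↑-zero : ∀ b {t} → (∀ j → B b ⊆ B j → t j ≡ ε) → Σ↑ b t ≡ ε
    Σ↑-zero b h = trans (⅀-cong (allFin m) (λ j → when-ε (B b ⊆? B j) (λ b⊆ → h j b⊆))) (⅀-zero (allFin m))

    Σ↑-single : ∀ b {t} → (∀ j → B b ⊆ B j → j ≢ b → t j ≡ ε) → Σ↑ b t ≡ t b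
    Σ↑-single b {t} h = trans
      (⅀-single (λ j → when ε (B b ⊆? B j) (t j)) (Uniqueₚ.allFin⁺ m) (∈ₚ.∈-allFin b)
        (λ j j≢b → when-ε (B b ⊆? B j) (λ b⊆ → h j b⊆ j≢b)))
      (when-yes (B b ⊆? B b) ⊆-refl)

    Σ↑-swap : ∀ b c (f : Fin m → Fin m → Q) → Σ↑ b (λ i → Σ↑ c (f i)) ≡ Σ↑ c (λ j → Σ↑ b (λ i → f i j))
    Σ↑-swap b c f = begin
      ⅀ (allFin m) (λ i → when ε (B b ⊆? B i) (⅀ (allFin m) (λ j → when ε (B c ⊆? B j) (f i j))))
        ≡⟨ ⅀-cong (allFin m) (λ i → when-⅀ (B b ⊆? B i) (allFin m) _) ⟩
      ⅀ (allFin m) (λ i → ⅀ (allFin m) (λ j → when ε (B b ⊆? B i) (when ε (B c ⊆? B j) (f i j))))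
        ≡⟨ ⅀-swap (allFin m) (allFin m) _ ⟩
      ⅀ (allFin m) (λ j → ⅀ (allFin m) (λ i → when ε (B b ⊆? B i) (when ε (B c ⊆? B j) (f i j))))
        ≡⟨ ⅀-cong (allFin m) (λ j → ⅀-cong (allFin m) (λ i → when-comm (B b ⊆? B i) (B c ⊆? B j) (f i j))) ⟩
      ⅀ (allFin m) (λ j → ⅀ (allFin m) (λ i → when ε (B c ⊆? B j) (when ε (B b ⊆? B i) (f i j))))
        ≡⟨ ⅀-cong (allFin m) (λ j → when-⅀ (B c ⊆? B j) (allFin m) _) ⟨
      ⅀ (allFin m) (λ j → when ε (B c ⊆? B j) (⅀ (allFin m) (λ i → when ε (B b ⊆? B i) (f i j)))) ∎
      where open ≡-Reasoning

    Σ↑-restrict : ∀ {b c t} → B b ⊆ B c → (∀ j → B b ⊆ B j → ¬ (B c ⊆ B j) → t j ≡ ε) → Σ↑ b t ≡ Σ↑ c t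
    Σ↑-restrict {b} {c} {t} b⊆c h = ⅀-cong (allFin m) pointwise
      where
      pointwise : ∀ j → when ε (B b ⊆? B j) (t j) ≡ when ε (B c ⊆? B j) (t j)
      pointwise j with B b ⊆? B j | B c ⊆? B j
      ... | yes _   | yes _   = refl
      ... | no b⊈j  | yes c⊆j = ⊥-elim (b⊈j (⊆-trans b⊆c c⊆j))
      ... | no _    | no _    = refl
      ... | yes b⊆j | no c⊈j  = h j b⊆j c⊈j

    -- Multiplication by `y_c` commutes with multiplication by a power of `y_b`. On the right-hand
    -- side `y_c` has been absorbed into the functional, the form in which it can be iterated.
    Y-shift : ∀ χ b c k ν → Σ↑ c (λ j → Y χ b k (ν ⊕ j)) ≡ Y (λ σ → Σ↑ c (λ j → χ (σ ⊕ j))) b k ν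
    Y-shift χ b c zero    ν = refl
    Y-shift χ b c (suc k) ν = begin
      Σ↑ c (λ j → Σ↑ b (λ i → Y χ b k (ν ⊕ j ⊕ i)))  ≡⟨ Σ↑-swap c b (λ j i → Y χ b k (ν ⊕ j ⊕ i)) ⟩
      Σ↑ b (λ i → Σ↑ c (λ j → Y χ b k (ν ⊕ j ⊕ i)))  ≡⟨ Σ↑-cong b (λ i _ → Σ↑-cong c (λ j _ → cong (Y χ b k) (⊕-comm ν j i))) ⟩
      Σ↑ b (λ i → Σ↑ c (λ j → Y χ b k (ν ⊕ i ⊕ j)))  ≡⟨ Σ↑-cong b (λ i _ → Y-shift χ b c k (ν ⊕ i)) ⟩
      Σ↑ b (λ i → Y (λ σ → Σ↑ c (λ j → χ (σ ⊕ j))) b k (ν ⊕ i)) ∎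
      where open ≡-Reasoning

    Y-comm : ∀ ψ b c k l ν → Y (Y ψ b k) c l ν ≡ Y (Y ψ c l) b k ν
    Y-comm ψ b c k zero    ν = refl
    Y-comm ψ b c k (suc l) ν = trans (Σ↑-cong c (λ j _ → Y-comm ψ b c k l (ν ⊕ j))) (Y-shift (Y ψ c l) b c k ν)

    Y-+ : ∀ ψ b k l ν → Y (Y ψ b k) b l ν ≡ Y ψ b (l + k) ν
    Y-+ ψ b k zero    ν = refl
    Y-+ ψ b k (suc l) ν = Σ↑-cong b (λ j _ → Y-+ ψ b k l (ν ⊕ j))

-- Resolution of the S-pairs

module Confluence {n : ℕ} {M : Matroid n} {Z : Subset n} {m : ℕ} {B : Fin m → Subset n} (jc : JoinClosed M Z B)
  {Q : Set} {_∙_ : Q → Q → Q} {ε : Q} {neg : Q → Q} (isAG : IsAbelianGroup _≡_ _∙_ ε neg) where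
  open JoinClosed jc
  open Reduction M Z B
  open Values isAG
  open IsAbelianGroup isAG using (identityˡ; identityʳ; isCommutativeMonoid)
  open Summation isCommutativeMonoid
  open Rank M using (r; r-mono; submodular)

  ⊊-intro : ∀ {i j} → B i ⊆ B j → j ≢ i → B i ⊊ B j
  ⊊-intro i⊆j j≢i = i⊆j , λ j⊆i → j≢i (injective j⊆i i⊆j)

  Σ↑-head : ∀ b t → Σ↑ b t ≡ (t b ∙ ⅀ (allFin m) (λ j → when ε (B b ⊊? B j) (t j)))
  Σ↑-head b t = begin
    Σ↑ b t
      ≡⟨ ⅀-cong (allFin m) pointwise ⟩
    ⅀ (allFin m) (λ j → when ε (j Fin.≟ b) (t j) ∙ when ε (B b ⊊? B j) (t j))
      ≡⟨ ⅀-distrib (allFin m) _ _ ⟩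
    (⅀ (allFin m) (λ j → when ε (j Fin.≟ b) (t j)) ∙ rest)
      ≡⟨ cong (_∙ rest) (trans
           (⅀-single _ (Uniqueₚ.allFin⁺ m) (∈ₚ.∈-allFin b) (λ j → when-no (j Fin.≟ b)))
           (when-yes (b Fin.≟ b) refl)) ⟩
    (t b ∙ rest) ∎
    where
    open ≡-Reasoning
    rest : Q
    rest = ⅀ (allFin m) (λ j → when ε (B b ⊊? B j) (t j))
    pointwise : ∀ j → when ε (B b ⊆? B j) (t j) ≡ (when ε (j Fin.≟ b) (t j) ∙ when ε (B b ⊊? B j) (t j))
    pointwise j with j Fin.≟ b
    ... | yes refl = trans (when-yes (B b ⊆? B b) ⊆-refl)
      (sym (trans (cong (t b ∙_) (when-no (B b ⊊? B b) (λ b⊊b → proj₂ b⊊b ⊆-refl))) (identityʳ _)))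
    ... | no j≢b = trans (when-⇔ (B b ⊆? B j) (B b ⊊? B j) (λ b⊆j → ⊊-intro b⊆j j≢b) proj₁) (sym (identityˡ _))

  Σ↑-split : ∀ {b c t} → B b ⊊ B c →
             (∀ j → B b ⊆ B j → j ≢ b → ¬ (B c ⊆ B j) → t j ≡ ε) → Σ↑ b t ≡ (t b ∙ Σ↑ c t)
  Σ↑-split {b} {c} {t} b⊊c h = trans (Σ↑-head b t) (cong (t b ∙_) (⅀-cong (allFin m) pointwise))
    where
    pointwise : ∀ j → when ε (B b ⊊? B j) (t j) ≡ when ε (B c ⊆? B j) (t j)
    pointwise j with B c ⊆? B j
    ... | yes c⊆j = when-yes (B b ⊊? B j) (⊊-⊆-trans b⊊c c⊆j)
    ... | no  c⊈j = when-ε (B b ⊊? B j) (λ b⊊j → h j (proj₁ b⊊j) (λ { refl → proj₂ b⊊j ⊆-refl }) c⊈j)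

  -- Every ideal element below is compared only with ideal elements of smaller leading weight, on which φ vanishes.
  module Below (φ : Mono m → Q) (w : ℕ)
    (hyp : ∀ ν b k → Member ν b k → meas ν + k * wt b < w → Y φ b k ν ≡ ε) where

    shift-≤ : ∀ σ {c j} l e → B c ⊆ B j → meas (σ ⊕ j) + (l * wt c + e) ≤ meas σ + (suc l * wt c + e)
    shift-≤ σ {c} {j} l e c⊆j =
      subst₂ _≤_ (+-assoc (meas (σ ⊕ j)) _ e) (+-assoc (meas σ) _ e) (+-monoˡ-≤ e (meas-⊕-≤ l σ c⊆j))

    shift-< : ∀ σ {c j} l e → B c ⊊ B j → meas (σ ⊕ j) + (l * wt c + e) < meas σ + (suc l * wt c + e)
    shift-< σ {c} {j} l e c⊊j =
      subst₂ _<_ (+-assoc (meas (σ ⊕ j)) _ e) (+-assoc (meas σ) _ e) (+-monoˡ-< e (meas-⊕-< l σ c⊊j))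

    -- `P` is an invariant that survives multiplication by variables and `e` is the weight already
    -- carried by `ψ`. Expanding `y_c^l` never raises the total weight, so every term stays below
    -- `w`.
    vanish : ∀ {ψ c e} (P : Mono m → Set) → (∀ {σ} j → P σ → P (σ ⊕ j)) →
             (∀ σ → P σ → meas σ + e < w → ψ σ ≡ ε) →
             ∀ l σ → P σ → meas σ + (l * wt c + e) < w → Y ψ c l σ ≡ ε
    vanish P step base zero    σ p lt = base σ p lt
    vanish {c = c} {e} P step base (suc l) σ p lt = Σ↑-zero c λ j c⊆j →
      vanish P step base l (σ ⊕ j) (step j p) (≤-<-trans (shift-≤ σ l e c⊆j) lt)

    vanish-member : ∀ {b k c} l σ → Member σ b k → meas σ + (l * wt c + k * wt b) < w → Y (Y φ b k) c l σ ≡ ε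
    vanish-member {b} {k} = vanish (λ σ → Member σ b k) (λ {σ} j → Member-mono (⊕-≥ σ j)) (λ σ → hyp σ b k)

    vanish-dead : ∀ {b c} l σ → Member σ b 0 → meas σ + l * wt c < w → Y φ c l σ ≡ ε
    vanish-dead {b} {c} l σ mem lt =
      vanish-member {b} {0} l σ mem (subst (λ z → meas σ + z < w) (sym (+-identityʳ _)) lt)

    -- Each term of `y_c^l` other than `x_c^l` contains a strictly larger flat and is therefore a
    -- relation of weight below `w`. This is why the weight may equal `w` here.
    leading : ∀ {b k c} l σ → Member σ b k → meas σ + (l * wt c + k * wt b) ≤ w →
              Y (Y φ b k) c l σ ≡ Y φ b k (pow σ c l)
    leading {b} {k} {c} zero    σ mem le = cong (Y φ b k) (sym (Vecₚ.updateAt-id c σ))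
    leading {b} {k} {c} (suc l) σ mem le = begin
      Σ↑ c (λ j → Y (Y φ b k) c l (σ ⊕ j))
        ≡⟨ Σ↑-single c (λ j c⊆j j≢c → vanish-member l (σ ⊕ j) (Member-mono (⊕-≥ σ j) mem)
             (<-≤-trans (shift-< σ l _ (⊊-intro c⊆j j≢c)) le)) ⟩
      Y (Y φ b k) c l (σ ⊕ c)
        ≡⟨ leading l (σ ⊕ c) (Member-mono (⊕-≥ σ c) mem) (≤-trans (shift-≤ σ l _ ⊆-refl) le) ⟩
      Y φ b k (pow (σ ⊕ c) c l)
        ≡⟨ cong (Y φ b k) (pow-⊕ σ c l) ⟩
      Y φ b k (pow σ c (suc l)) ∎
      where open ≡-Reasoning

    -- If x_h divides σ and h, c are incomparable but both above b, then modulo monomials that vanish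
    -- σ y_c^k = σ y_C^k, where C is the join of h and c.
    module Incomparable {b c h} (b⊊c : B b ⊊ B c) (b⊆h : B b ⊆ B h) (c⊈h : ¬ (B c ⊆ B h)) (h⊈c : ¬ (B h ⊆ B c)) where

      private
        C   = proj₁ (join h c b b⊆h (proj₁ b⊊c))
        h⊆C = proj₁ (proj₂ (join h c b b⊆h (proj₁ b⊊c)))
        c⊆C = proj₁ (proj₂ (proj₂ (join h c b b⊆h (proj₁ b⊊c))))
        rC  = proj₁ (proj₂ (proj₂ (proj₂ (join h c b b⊆h (proj₁ b⊊c)))))
        lub = proj₂ (proj₂ (proj₂ (proj₂ (join h c b b⊆h (proj₁ b⊊c)))))
        h⊊C : B h ⊊ B C
        h⊊C = h⊆C , λ C⊆h → c⊈h (⊆-trans c⊆C C⊆h)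

      -- Submodularity of `U σ C` and `B c`. Both contain `U σ c ∪ B b`, because `x_h` brings `B h`,
      -- and with it `B b`, into `U σ C`. The assumption is membership at `c` as it would be if
      -- `x_b` also divided `σ`.
      member-join : ∀ {σ k} → 1 ≤ lookup σ h → r (B c) ≤ k + r (U σ c ∪ B b) → Member σ C k
      member-join {σ} {k} 1≤ le = +-cancelʳ-≤ (r (U σ c ∪ B b)) _ _ (begin
        r (B C) + r (U σ c ∪ B b)      ≤⟨ +-monoˡ-≤ _ rC ⟩
        r (B h ∪ B c) + r (U σ c ∪ B b)
          ≤⟨ submodular (U σ C) (B c) (∪-lub (⊆-trans h⊆U ⊆∪ˡ) ⊆∪ʳ)
               (∪-lub Uc⊆ (⊆-trans b⊆h h⊆U)) (∪-lub (U-least (above-base c) (λ _ _ → proj₁)) (proj₁ b⊊c)) ⟩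
        r (U σ C) + r (B c)            ≡⟨ +-comm (r (U σ C)) _ ⟩
        r (B c) + r (U σ C)            ≤⟨ +-monoˡ-≤ _ le ⟩
        k + r (U σ c ∪ B b) + r (U σ C) ≡⟨ +-assoc k _ _ ⟩
        k + (r (U σ c ∪ B b) + r (U σ C)) ≡⟨ cong (k +_) (+-comm (r (U σ c ∪ B b)) _) ⟩
        k + (r (U σ C) + r (U σ c ∪ B b)) ≡⟨ +-assoc k _ _ ⟨
        k + r (U σ C) + r (U σ c ∪ B b) ∎)
        where
        open ≤-Reasoning
        h⊆U : B h ⊆ U σ C
        h⊆U = ∈U h 1≤ h⊊C
        Uc⊆ : U σ c ⊆ U σ C
        Uc⊆ = U-least Z⊆U λ i p i⊊c → ∈U i p (⊊-⊆-trans i⊊c c⊆C)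

      to-join : ∀ k σ → 1 ≤ lookup σ h → meas σ + k * wt c < w → Y φ c k σ ≡ Y φ C k σ
      to-join zero    σ 1≤ lt = refl
      to-join (suc k) σ 1≤ lt = ⅀-cong (allFin m) pointwise
        where
        lt' : ∀ j → B c ⊆ B j → meas (σ ⊕ j) + k * wt c < w
        lt' j c⊆j = subst (λ z → meas (σ ⊕ j) + z < w) (+-identityʳ _)
          (≤-<-trans (shift-≤ σ k 0 c⊆j) (subst (λ z → meas σ + z < w) (sym (+-identityʳ _)) lt))
        pointwise : ∀ j → when ε (B c ⊆? B j) (Y φ c k (σ ⊕ j)) ≡ when ε (B C ⊆? B j) (Y φ C k (σ ⊕ j))
        pointwise j with B c ⊆? B j | B C ⊆? B j
        ... | yes c⊆j | yes _   = to-join k (σ ⊕ j) (≤-trans 1≤ (⊕-≥ σ j h)) (lt' j c⊆j)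
        ... | no c⊈j  | yes C⊆j = ⊥-elim (c⊈j (⊆-trans c⊆C C⊆j))
        ... | no _    | no _    = refl
        -- Here the monomial alone lies in the ideal: `h` and `j` are both strictly below their join
        -- `e`, and together they span it.
        ... | yes c⊆j | no C⊈j with join h j b b⊆h (⊆-trans (proj₁ b⊊c) c⊆j)
        ...   | e , h⊆e , j⊆e , re , lub-e =
          vanish-dead {e} k (σ ⊕ j)
            (≤-trans re (r-mono (∪-lub (∈U h (≤-trans 1≤ (⊕-≥ σ j h)) (h⊆e , λ e⊆h → c⊈h (⊆-trans c⊆j (⊆-trans j⊆e e⊆h))))
                                       (∈U j (1≤⊕ σ j) (j⊆e , λ e⊆j → C⊈j (lub j (⊆-trans h⊆e e⊆j) c⊆j))))))
            (lt' j c⊆j)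

      vanish-incomparable : ∀ {k} i σ → 1 ≤ lookup σ h → r (B c) ≤ k + r (U σ c ∪ B b) →
                            meas σ + (i * wt b + k * wt c) < w → Y (Y φ c k) b i σ ≡ ε
      vanish-incomparable {k} i σ 1≤ le = vanish P step base i σ (1≤ , le)
        where
        P : Mono m → Set
        P σ = 1 ≤ lookup σ h × r (B c) ≤ k + r (U σ c ∪ B b)
        step : ∀ {σ} j → P σ → P (σ ⊕ j)
        step {σ} j (1≤ , le) = ≤-trans 1≤ (⊕-≥ σ j h) ,
          ≤-trans le (+-monoʳ-≤ k (r-mono (∪-lub (⊆-trans (U-mono (⊕-≥ σ j)) ⊆∪ˡ) ⊆∪ʳ)))
        base : ∀ σ → P σ → meas σ + k * wt c < w → Y φ c k σ ≡ ε
        base σ (1≤ , le) lt = trans (to-join k σ 1≤ lt)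
          (hyp σ C k (member-join 1≤ le) (≤-<-trans (+-monoʳ-≤ (meas σ) (*-monoʳ-≤ k (wt-≤ c⊆C))) lt))

    -- The assumption `member-c` puts `ρ x_b y_c^l` into the ideal: `x_b` adds `B b` to what lies
    -- below `B c`.
    module Chain {b c k l} (b⊊c : B b ⊊ B c) (ρ : Mono m)
      (member-b : Member ρ b k) (member-c : r (B c) ≤ l + r (U ρ c ∪ B b)) where

      b⊆c = proj₁ b⊊c

      -- Submodularity of `U ρ c` and `B b`, both of which contain `U ρ b`: the rank that `B b` adds
      -- to `U ρ c` is at most `k`, so `k` further factors `y_c` make up for a missing `x_b`.
      member-sum : Member ρ c (k + l)
      member-sum = +-cancelʳ-≤ (r (U ρ c ∪ B b) + r (U ρ b)) _ _ (begin
        r (B c) + (r (U ρ c ∪ B b) + r (U ρ b))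
          ≤⟨ +-mono-≤ member-c (submodular (U ρ c) (B b) ⊆-refl
               (U-least Z⊆U (λ i p i⊊b → ∈U i p (⊊-⊆-trans i⊊b b⊆c)))
               (U-least (above-base b) (λ _ _ → proj₁))) ⟩
        l + r (U ρ c ∪ B b) + (r (U ρ c) + r (B b))
          ≤⟨ +-monoʳ-≤ (l + r (U ρ c ∪ B b)) (+-monoʳ-≤ (r (U ρ c)) member-b) ⟩
        l + r (U ρ c ∪ B b) + (r (U ρ c) + (k + r (U ρ b)))
          ≡⟨ solve 5 (λ l x y k z → l :+ x :+ (y :+ (k :+ z)) := k :+ l :+ y :+ (x :+ z)) refl l (r (U ρ c ∪ B b)) (r (U ρ c)) k (r (U ρ b)) ⟩
        k + l + r (U ρ c) + (r (U ρ c ∪ B b) + r (U ρ b)) ∎)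
        where open ≤-Reasoning

      member-fed : ∀ {l'} j → l ≤ l' → B b ⊆ B j → B j ⊊ B c → Member (ρ ⊕ j) c l'
      member-fed {l'} j l≤ b⊆j j⊊c = ≤-trans member-c (+-mono-≤ l≤ (r-mono
        (∪-lub (U-mono (⊕-≥ ρ j)) (⊆-trans b⊆j (∈U j (1≤⊕ ρ j) j⊊c)))))

      -- A flat `j` strictly below `c` brings `B b` into the support below `c` and makes the power
      -- of `y_c` a relation. A flat incomparable to `c` is handled through the join of the two.
      vanish-≱c : ∀ {l'} i j → l ≤ l' → B b ⊆ B j → ¬ (B c ⊆ B j) →
                  meas (ρ ⊕ j) + (i * wt b + l' * wt c) < w → Y (Y φ c l') b i (ρ ⊕ j) ≡ ε
      vanish-≱c {l'} i j l≤ b⊆j c⊈j lt with B j ⊆? B c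
      ... | yes j⊆c = vanish-member i (ρ ⊕ j) (member-fed j l≤ b⊆j (j⊆c , c⊈j)) lt
      ... | no  j⊈c = Incomparable.vanish-incomparable b⊊c b⊆j c⊈j j⊈c i (ρ ⊕ j) (1≤⊕ ρ j)
        (≤-trans member-c (+-mono-≤ l≤ (r-mono (∪-lub (⊆-trans (U-mono (⊕-≥ ρ j)) ⊆∪ˡ) ⊆∪ʳ)))) lt

      collect : ∀ i l' → Σ↑ c (λ j → Y (Y φ c l') b i (ρ ⊕ j)) ≡ Y (Y φ c (suc l')) b i ρ
      collect i l' = Y-shift (Y φ c l') b c i ρ

      drop-< : ∀ i l' → meas ρ + (i * wt b + suc l' * wt c) < meas ρ + (suc i * wt b + l' * wt c)
      drop-< i l' = +-monoʳ-< (meas ρ) (begin-strict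
        i * wt b + (wt c + l' * wt c)  ≡⟨ +-assoc (i * wt b) _ _ ⟨
        i * wt b + wt c + l' * wt c    <⟨ +-monoˡ-< _ (+-monoʳ-< (i * wt b) (wt-< b⊊c)) ⟩
        i * wt b + wt b + l' * wt c    ≡⟨ cong (_+ l' * wt c) (+-comm (i * wt b) _) ⟩
        suc i * wt b + l' * wt c       ∎)
        where open ≤-Reasoning

      -- Factors `y_b` are exchanged for factors `y_c` one at a time, with `i + l'` fixed, until
      -- only `y_c^(k + l)` remains, which is a relation by `member-sum`. Every exchange lowers the
      -- weight.
      vanish-lower : ∀ i l' → l ≤ l' → i + l' ≡ k + l → meas ρ + (i * wt b + l' * wt c) < w →
                     Y (Y φ c l') b i ρ ≡ ε
      vanish-lower zero    l' l≤ refl lt = hyp ρ c l' member-sum lt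
      vanish-lower (suc i) l' l≤ eq   lt = begin
        Σ↑ b (λ j → Y (Y φ c l') b i (ρ ⊕ j))   ≡⟨ Σ↑-restrict b⊆c (λ j b⊆j c⊈j → vanish-≱c i j l≤ b⊆j c⊈j (≤-<-trans (shift-≤ ρ i _ b⊆j) lt)) ⟩
        Σ↑ c (λ j → Y (Y φ c l') b i (ρ ⊕ j))   ≡⟨ collect i l' ⟩
        Y (Y φ c (suc l')) b i ρ                ≡⟨ vanish-lower i (suc l') (m≤n⇒m≤1+n l≤) (trans (+-suc i l') eq) (<-trans (drop-< i l') lt) ⟩
        ε                                       ∎
        where
        open ≡-Reasoning

      -- Up to vanishing terms one factor `y_b` equals `x_b + y_c`. With `x_b` present the power of
      -- `y_c` is a relation, so the remaining factors `y_b` reduce to `x_b`; the part with the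
      -- extra `y_c` vanishes by `vanish-lower`. A positive `k` is required to have such a factor.
      leading-fed : ∀ k' → k ≡ suc k' → meas ρ + (k * wt b + l * wt c) ≤ w →
                    Y (Y φ c l) b k ρ ≡ Y φ c l (pow ρ b k)
      leading-fed k' refl le = begin
        Σ↑ b (λ j → Y (Y φ c l) b k' (ρ ⊕ j))
          ≡⟨ Σ↑-split b⊊c (λ j b⊆j j≢b c⊈j → vanish-≱c k' j ≤-refl b⊆j c⊈j
               (<-≤-trans (shift-< ρ k' _ (⊊-intro b⊆j j≢b)) le)) ⟩
        (Y (Y φ c l) b k' (ρ ⊕ b) ∙ Σ↑ c (λ j → Y (Y φ c l) b k' (ρ ⊕ j)))
          ≡⟨ cong₂ _∙_
               (leading k' (ρ ⊕ b) (member-fed b ≤-refl ⊆-refl b⊊c) (≤-trans (shift-≤ ρ k' _ ⊆-refl) le))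
               (trans (collect k' l) (vanish-lower k' (suc l) (n≤1+n l) (+-suc k' l) (<-≤-trans (drop-< k' l) le))) ⟩
        (Y φ c l (pow (ρ ⊕ b) b k') ∙ ε)
          ≡⟨ identityʳ _ ⟩
        Y φ c l (pow (ρ ⊕ b) b k')
          ≡⟨ cong (Y φ c l) (pow-⊕ ρ b k') ⟩
        Y φ c l (pow ρ b (suc k')) ∎
        where open ≡-Reasoning

    U-pow : ∀ ρ c k b → U (pow ρ c k) b ⊆ (U ρ b ∪ B c)
    U-pow ρ c k b = U-least (⊆-trans Z⊆U ⊆∪ˡ) from
      where
      from : ∀ i → 1 ≤ lookup (pow ρ c k) i → B i ⊊ B b → B i ⊆ (U ρ b ∪ B c)
      from i p i⊊b with i Fin.≟ c
      ... | yes refl = ⊆∪ʳ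
      ... | no  i≢c  = ⊆-trans (∈U i (subst (1 ≤_) (Vecₚ.lookup∘updateAt′ i c i≢c ρ) p) i⊊b) ⊆∪ˡ

    U-unfed : ∀ ρ c k b → ¬ (B c ⊊ B b) → U (pow ρ c k) b ⊆ U ρ b
    U-unfed ρ c k b c⊄b = U-least Z⊆U from
      where
      from : ∀ i → 1 ≤ lookup (pow ρ c k) i → B i ⊊ B b → B i ⊆ U ρ b
      from i p i⊊b with i Fin.≟ c
      ... | yes refl = ⊥-elim (c⊄b i⊊b)
      ... | no  i≢c  = ∈U i (subst (1 ≤_) (Vecₚ.lookup∘updateAt′ i c i≢c ρ) p) i⊊b

    -- If `B c ⊊ B b` and `l` is positive, membership at `b` may depend on `x_c`, and `Chain`
    -- applies with `b` and `c` interchanged. Otherwise it persists when `x_c^l` is removed, and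
    -- `leading` suffices.
    expand : ∀ {b c k l} ρ → Member (pow ρ c l) b k → Member (pow ρ b k) c l →
             meas ρ + (l * wt c + k * wt b) ≤ w → Y (Y φ b k) c l ρ ≡ Y φ b k (pow ρ c l)
    expand {b} {c} {k} {zero}  ρ mb mc le = leading 0 ρ (subst (λ σ → Member σ b k) (Vecₚ.updateAt-id c ρ) mb) le
    expand {b} {c} {k} {suc l} ρ mb mc le with B c ⊊? B b
    ... | no c⊄b = leading (suc l) ρ (≤-trans mb (+-monoʳ-≤ k (r-mono (U-unfed ρ c (suc l) b c⊄b)))) le
    ... | yes c⊊b = Chain.leading-fed c⊊b ρ
      (≤-trans mc (+-monoʳ-≤ (suc l) (r-mono (U-unfed ρ b k c (λ b⊊c → proj₂ b⊊c (proj₁ c⊊b))))))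
      (≤-trans mb (+-monoʳ-≤ k (r-mono (U-pow ρ c (suc l) b)))) l refl le

    -- The S-pair of the leading terms `ρ x_b^k` and `ρ x_c^l`: both sides are the value at
    -- `ρ y_b^k y_c^l`, which is symmetric in `b` and `c`.
    compare : ∀ {b c k l} ρ → Member (pow ρ c l) b k → Member (pow ρ b k) c l →
              meas ρ + (l * wt c + k * wt b) ≤ w → Y φ b k (pow ρ c l) ≡ Y φ c l (pow ρ b k)
    compare {b} {c} {k} {l} ρ mb mc le = begin
      Y φ b k (pow ρ c l)  ≡⟨ expand ρ mb mc le ⟨
      Y (Y φ b k) c l ρ    ≡⟨ Y-comm φ b c k l ρ ⟩
      Y (Y φ c l) b k ρ    ≡⟨ expand ρ mc mb (subst (λ z → meas ρ + z ≤ w) (+-comm (l * wt c) _) le) ⟩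
      Y φ c l (pow ρ b k)  ∎
      where open ≡-Reasoning

-- Functionals defined by rewriting

module NormalForm {n : ℕ} {M : Matroid n} {Z : Subset n} {m : ℕ} {B : Fin m → Subset n} (jc : JoinClosed M Z B)
  {Q : Set} {_∙_ : Q → Q → Q} {ε : Q} {neg : Q → Q} (isAG : IsAbelianGroup _≡_ _∙_ ε neg) (τ : Mono m → Q) where
  open Reduction M Z B
  open Values isAG
  open IsAbelianGroup isAG using (identityˡ; identityʳ; inverseˡ; assoc; isCommutativeMonoid)
  open Summation isCommutativeMonoid
  open Confluence jc isAG using (Σ↑-head; module Below)
  open Rank M using (r; r-mono)

  -- What `ν y_b^k` contributes besides its leading term `ν x_b^k`. It is written as a sum, not as a
  -- difference, so that only monomials of smaller weight occur in it and recursion along the weight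
  -- is possible.
  tail : (Mono m → Q) → Fin m → ℕ → Mono m → Q
  tail ψ b zero    ν = ε
  tail ψ b (suc k) ν = tail ψ b k (ν ⊕ b) ∙ ⅀ (allFin m) (λ j → when ε (B b ⊊? B j) (Y ψ b k (ν ⊕ j)))

  Y-tail : ∀ ψ b k ν → Y ψ b k ν ≡ (ψ (pow ν b k) ∙ tail ψ b k ν)
  Y-tail ψ b zero    ν = trans (cong ψ (sym (Vecₚ.updateAt-id b ν))) (sym (identityʳ _))
  Y-tail ψ b (suc k) ν = begin
    Σ↑ b (λ j → Y ψ b k (ν ⊕ j))
      ≡⟨ Σ↑-head b _ ⟩
    (Y ψ b k (ν ⊕ b) ∙ rest)
      ≡⟨ cong (_∙ rest) (Y-tail ψ b k (ν ⊕ b)) ⟩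
    ((ψ (pow (ν ⊕ b) b k) ∙ tail ψ b k (ν ⊕ b)) ∙ rest)
      ≡⟨ assoc _ _ _ ⟩
    (ψ (pow (ν ⊕ b) b k) ∙ tail ψ b (suc k) ν)
      ≡⟨ cong (λ σ → ψ σ ∙ tail ψ b (suc k) ν) (pow-⊕ ν b k) ⟩
    (ψ (pow ν b (suc k)) ∙ tail ψ b (suc k) ν) ∎
    where
    open ≡-Reasoning
    rest : Q
    rest = ⅀ (allFin m) (λ j → when ε (B b ⊊? B j) (Y ψ b k (ν ⊕ j)))

  module _ {ψ ψ' : Mono m → Q} {w : ℕ} (agree : ∀ μ → meas μ < w → ψ μ ≡ ψ' μ) where

    Y-local : ∀ b k ν → meas ν + k * wt b < w → Y ψ b k ν ≡ Y ψ' b k ν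
    Y-local b zero    ν lt = agree ν (≤-<-trans (m≤m+n _ _) lt)
    Y-local b (suc k) ν lt = Σ↑-cong b (λ j b⊆j → Y-local b k (ν ⊕ j) (≤-<-trans (meas-⊕-≤ k ν b⊆j) lt))

    tail-local : ∀ b k ν → meas ν + k * wt b ≤ w → tail ψ b k ν ≡ tail ψ' b k ν
    tail-local b zero    ν le = refl
    tail-local b (suc k) ν le = cong₂ _∙_
      (tail-local b k (ν ⊕ b) (≤-trans (meas-⊕-≤ k ν ⊆-refl) le))
      (⅀-cong (allFin m) (λ j → when-cong (B b ⊊? B j) (λ b⊊j → Y-local b k (ν ⊕ j) (<-≤-trans (meas-⊕-< k ν b⊊j) le))))

  -- The search fixes one reducing index for each monomial. The relation at that index holds by
  -- definition; the relations at all other indices have to be proved.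
  reduce : (Mono m → Q) → Mono m → Q
  reduce ψ μ with member? μ
  ... | yes (b , _) = neg (tail ψ b (lookup μ b) (clear μ b))
  ... | no  _       = τ μ

  meas-clear : ∀ μ b → meas (clear μ b) + lookup μ b * wt b ≡ meas μ
  meas-clear μ b = trans (sym (weigh-pow wt (clear μ b) b (lookup μ b))) (cong meas (pow-clear μ b))

  reduce-local : ∀ {ψ ψ'} μ → (∀ σ → meas σ < meas μ → ψ σ ≡ ψ' σ) → reduce ψ μ ≡ reduce ψ' μ
  reduce-local μ agree with member? μ
  ... | yes (b , _) = cong neg (tail-local agree b (lookup μ b) (clear μ b) (≤-reflexive (meas-clear μ b)))
  ... | no  _       = refl

  -- φ solves φ μ = reduce φ μ, a recursion along meas, by fuel.
  approx : ℕ → Mono m → Q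
  approx zero    μ = ε
  approx (suc s) μ = reduce (approx s) μ

  stable : ∀ s s' μ → meas μ < s → meas μ < s' → approx s μ ≡ approx s' μ
  stable (suc s) (suc s') μ lt lt' = reduce-local μ λ σ σ< →
    stable s s' σ (<-≤-trans σ< (≤-pred lt)) (<-≤-trans σ< (≤-pred lt'))

  φ : Mono m → Q
  φ μ = approx (suc (meas μ)) μ

  φ-fix : ∀ μ → φ μ ≡ reduce φ μ
  φ-fix μ = reduce-local μ λ σ σ< → stable (meas μ) (suc (meas σ)) σ σ< ≤-refl

  φ-standard : ∀ μ → Standard μ → φ μ ≡ τ μ
  φ-standard μ std = trans (φ-fix μ) go
    where
    go : reduce φ μ ≡ τ μ
    go with member? μ
    ... | yes (b , mem) = contradiction mem (std b)
    ... | no  _         = refl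

  φ-reducible : ∀ μ → ∃ (λ b → Member μ b (lookup μ b)) →
                ∃ λ b → Member μ b (lookup μ b) × Y φ b (lookup μ b) (clear μ b) ≡ ε
  φ-reducible μ ex with member? μ in eq
  ... | no ¬ex        = contradiction ex ¬ex
  ... | yes (b , mem) = b , mem , (begin
    Y φ b (lookup μ b) (clear μ b)
      ≡⟨ Y-tail φ b (lookup μ b) (clear μ b) ⟩
    (φ (pow (clear μ b) b (lookup μ b)) ∙ tail φ b (lookup μ b) (clear μ b))
      ≡⟨ cong (_∙ tail φ b (lookup μ b) (clear μ b)) (trans (cong φ (pow-clear μ b)) (trans (φ-fix μ) reduced)) ⟩
    (neg (tail φ b (lookup μ b) (clear μ b)) ∙ tail φ b (lookup μ b) (clear μ b))
      ≡⟨ inverseˡ _ ⟩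
    ε ∎)
    where
    open ≡-Reasoning
    reduced : reduce φ μ ≡ neg (tail φ b (lookup μ b) (clear μ b))
    reduced rewrite eq = refl

  U-clear : ∀ ν b → U ν b ⊆ U (clear ν b) b
  U-clear ν b = U-least Z⊆U λ c p c⊊b → ∈U c (subst (1 ≤_) (sym (Vecₚ.lookup∘updateAt′ c b (λ { refl → proj₂ c⊊b ⊆-refl }) ν)) p) c⊊b

  Member-clear : ∀ {ν b k} → Member ν b k → Member (clear ν b) b k
  Member-clear {ν} {b} {k} mem = ≤-trans mem (+-monoʳ-≤ k (r-mono (U-clear ν b)))

  -- Induction on the weight. By `leading` the power of `x_b` in `ν` may be replaced by the same
  -- power of `y_b`, so that the relation takes the form treated by `reduce` at the monomial
  -- `ν x_b^k`. It vanishes at the chosen index by construction, and `compare` carries this over to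
  -- `b`.
  kill-below : ∀ s ν b k → Member ν b k → meas ν + k * wt b < s → Y φ b k ν ≡ ε
  kill-below (suc s) ν b k mem lt = begin
    Y φ b k ν                                 ≡⟨ cong (Y φ b k) (pow-clear ν b) ⟨
    Y φ b k (pow (clear ν b) b (lookup ν b))  ≡⟨ leading (lookup ν b) (clear ν b) (Member-clear mem) lead ⟨
    Y (Y φ b k) b (lookup ν b) (clear ν b)    ≡⟨ Y-+ φ b k (lookup ν b) (clear ν b) ⟩
    Y φ b (lookup ν b + k) (clear ν b)        ≡⟨ cong₂ (Y φ b) (trans (+-comm (lookup ν b) k) (sym (Vecₚ.lookup∘updateAt b ν))) (sym (clear-pow ν b k)) ⟩
    Y φ b (lookup μ b) (clear μ b)            ≡⟨ canonical (φ-reducible μ (b , memμ)) ⟩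
    ε                                         ∎
    where
    open ≡-Reasoning
    w : ℕ
    w = meas ν + k * wt b
    open Below φ w (λ ν' b' k' mem' lt' → kill-below s ν' b' k' mem' (<-≤-trans lt' (≤-pred lt)))
    μ : Mono m
    μ = pow ν b k
    meas-μ : meas μ ≡ w
    meas-μ = weigh-pow wt ν b k
    lead : meas (clear ν b) + (lookup ν b * wt b + k * wt b) ≤ w
    lead = ≤-reflexive (trans (sym (+-assoc (meas (clear ν b)) _ _)) (cong (_+ k * wt b) (meas-clear ν b)))
    memμ : Member μ b (lookup μ b)
    memμ = subst (Member μ b) (sym (Vecₚ.lookup∘updateAt b ν)) (Member-≥ (m≤m+n k _) (Member-mono (pow-≥ ν b k) mem))
    canonical : ∃ (λ c → Member μ c (lookup μ c) × Y φ c (lookup μ c) (clear μ c) ≡ ε) →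
                Y φ b (lookup μ b) (clear μ b) ≡ ε
    canonical (c , memc , zero-c) with b Fin.≟ c
    ... | yes refl = zero-c
    ... | no  b≢c  = begin
      Y φ b (lookup μ b) (clear μ b)                ≡⟨ cong (Y φ b (lookup μ b)) (pow-clear₂ μ b c b≢c) ⟨
      Y φ b (lookup μ b) (pow ρ c (lookup μ c))     ≡⟨ compare ρ
                                                         (subst (λ σ → Member σ b (lookup μ b)) (sym (pow-clear₂ μ b c b≢c)) (Member-clear memμ))
                                                         (subst (λ σ → Member σ c (lookup μ c)) (sym ρ-c) (Member-clear memc)) lead-ρ ⟩
      Y φ c (lookup μ c) (pow ρ b (lookup μ b))     ≡⟨ cong (Y φ c (lookup μ c)) ρ-c ⟩
      Y φ c (lookup μ c) (clear μ c)                ≡⟨ zero-c ⟩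
      ε                                             ∎
      where
      ρ : Mono m
      ρ = clear (clear μ b) c
      ρ-c : pow ρ b (lookup μ b) ≡ clear μ c
      ρ-c = trans (cong (λ σ → pow σ b (lookup μ b)) (clear-comm μ b c b≢c)) (pow-clear₂ μ c b (b≢c ∘ sym))
      lead-ρ : meas ρ + (lookup μ c * wt c + lookup μ b * wt b) ≤ w
      lead-ρ = ≤-reflexive (begin
        meas ρ + (lookup μ c * wt c + lookup μ b * wt b)  ≡⟨ +-assoc (meas ρ) _ _ ⟨
        meas ρ + lookup μ c * wt c + lookup μ b * wt b    ≡⟨ cong (_+ lookup μ b * wt b) (weigh-pow wt ρ c (lookup μ c)) ⟨
        meas (pow ρ c (lookup μ c)) + lookup μ b * wt b   ≡⟨ cong (λ σ → meas σ + lookup μ b * wt b) (pow-clear₂ μ b c b≢c) ⟩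
        meas (clear μ b) + lookup μ b * wt b              ≡⟨ meas-clear μ b ⟩
        meas μ                                            ≡⟨ meas-μ ⟩
        w                                                 ∎)

  kill : ∀ ν b k → Member ν b k → Y φ b k ν ≡ ε
  kill ν b k mem = kill-below (suc (meas ν + k * wt b)) ν b k mem ≤-refl

-- Polynomials and ideals

infixl 7 _⊗_
_⊗_ : ∀ {m} → Mono m → Mono m → Mono m
α ⊗ β = Vec.zipWith _+_ α β

module ℚSum = Summation (IsAbelianGroup.isCommutativeMonoid ℚₚ.+-0-isAbelianGroup)

⅀-*ˡ : ∀ {I : Set} c (xs : List I) f → ℚSum.⅀ xs (λ x → c ℚ.* f x) ≡ c ℚ.* ℚSum.⅀ xs f
⅀-*ˡ c []       f = sym (ℚₚ.*-zeroʳ c)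
⅀-*ˡ c (x ∷ xs) f = trans (cong (c ℚ.* f x ℚ.+_) (⅀-*ˡ c xs f)) (sym (ℚₚ.*-distribˡ-+ c (f x) (ℚSum.⅀ xs f)))

⅀-++ : ∀ {I : Set} (xs ys : List I) f → ℚSum.⅀ (xs ++ ys) f ≡ ℚSum.⅀ xs f ℚ.+ ℚSum.⅀ ys f
⅀-++ []       ys f = sym (ℚₚ.+-identityˡ _)
⅀-++ (x ∷ xs) ys f = trans (cong (f x ℚ.+_) (⅀-++ xs ys f)) (sym (ℚₚ.+-assoc (f x) _ _))

⅀-concatMap : ∀ {I J : Set} (h : I → List J) (xs : List I) f → ℚSum.⅀ (concatMap h xs) f ≡ ℚSum.⅀ xs (λ x → ℚSum.⅀ (h x) f)
⅀-concatMap h []       f = refl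
⅀-concatMap h (x ∷ xs) f = trans (⅀-++ (h x) _ f) (cong (ℚSum.⅀ (h x) f ℚ.+_) (⅀-concatMap h xs f))

module _ {m : ℕ} where
  open ℚSum
  open ≡-Reasoning

  -- Identities of polynomials are verified by evaluating an arbitrary functional on both sides, so
  -- that term lists need not be normalised or reordered.
  eval : (Mono m → ℚ) → Poly m → ℚ
  eval φ p = ⅀ p (λ t → proj₁ t ℚ.* φ (proj₂ t))

  eval-++ : ∀ φ p q → eval φ (p ++ q) ≡ eval φ p ℚ.+ eval φ q
  eval-++ φ p q = ⅀-++ p q _

  eval-cong : ∀ {φ ψ} p → (∀ α → φ α ≡ ψ α) → eval φ p ≡ eval ψ p
  eval-cong p e = ⅀-cong p (λ t → cong (proj₁ t ℚ.*_) (e (proj₂ t)))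

  eval-zero : ∀ {φ} p → (∀ α → φ α ≡ 0ℚ) → eval φ p ≡ 0ℚ
  eval-zero p e = trans (⅀-cong p (λ t → trans (cong (proj₁ t ℚ.*_) (e (proj₂ t))) (ℚₚ.*-zeroʳ (proj₁ t)))) (⅀-zero p)

  eval-scale : ∀ φ c p → eval φ (scaleₚ c p) ≡ c ℚ.* eval φ p
  eval-scale φ c p = begin
    eval φ (scaleₚ c p)                                    ≡⟨ ⅀-map _ p _ ⟩
    ⅀ p (λ t → (c ℚ.* proj₁ t) ℚ.* φ (proj₂ t))            ≡⟨ ⅀-cong p (λ t → ℚₚ.*-assoc c (proj₁ t) (φ (proj₂ t))) ⟩
    ⅀ p (λ t → c ℚ.* (proj₁ t ℚ.* φ (proj₂ t)))            ≡⟨ ⅀-*ˡ c p _ ⟩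
    c ℚ.* eval φ p                                         ∎

  eval-- : ∀ φ p q → eval φ (p -ₚ q) ≡ eval φ p ℚ.+ (ℚ.- 1ℚ) ℚ.* eval φ q
  eval-- φ p q = trans (eval-++ φ p _) (cong (eval φ p ℚ.+_) (eval-scale φ (ℚ.- 1ℚ) q))

  eval-* : ∀ φ p q → eval φ (p *ₚ q) ≡ eval (λ α → eval (λ β → φ (α ⊗ β)) q) p
  eval-* φ p q = trans (⅀-concatMap _ p _) (⅀-cong p (λ s → begin
    eval φ (map (λ t → (proj₁ s ℚ.* proj₁ t , proj₂ s ⊗ proj₂ t)) q)
      ≡⟨ ⅀-map _ q _ ⟩
    ⅀ q (λ t → (proj₁ s ℚ.* proj₁ t) ℚ.* φ (proj₂ s ⊗ proj₂ t))
      ≡⟨ ⅀-cong q (λ t → ℚₚ.*-assoc (proj₁ s) (proj₁ t) _) ⟩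
    ⅀ q (λ t → proj₁ s ℚ.* (proj₁ t ℚ.* φ (proj₂ s ⊗ proj₂ t)))
      ≡⟨ ⅀-*ˡ (proj₁ s) q _ ⟩
    proj₁ s ℚ.* eval (λ β → φ (proj₂ s ⊗ β)) q ∎))

  mono : Mono m → Poly m
  mono α = (1ℚ , α) ∷ []

  eval-mono : ∀ φ α → eval φ (mono α) ≡ φ α
  eval-mono φ α = trans (ℚₚ.+-identityʳ _) (ℚₚ.*-identityˡ _)

  _≟ₘ_ : ∀ (α β : Mono m) → Dec (α ≡ β)
  _≟ₘ_ = Vecₚ.≡-dec ℕ._≟_

  δ : Mono m → Mono m → ℚ
  δ α β = when 0ℚ (β ≟ₘ α) 1ℚ

  δ-same : ∀ α → δ α α ≡ 1ℚ
  δ-same α = when-yes (α ≟ₘ α) refl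

  δ-diff : ∀ {α β} → β ≢ α → δ α β ≡ 0ℚ
  δ-diff {α} {β} = when-no (β ≟ₘ α)

  coeff≡eval : ∀ p α → coeff p α ≡ eval (δ α) p
  coeff≡eval []            α = refl
  coeff≡eval ((c , β) ∷ p) α with β ≟ₘ α
  ... | yes _ = cong₂ ℚ._+_ (sym (ℚₚ.*-identityʳ c)) (coeff≡eval p α)
  ... | no  _ = trans (coeff≡eval p α) (sym (trans (cong (ℚ._+ eval (δ α) p) (ℚₚ.*-zeroʳ c)) (ℚₚ.+-identityˡ _)))

  eval-expand : ∀ {L} φ p → Unique L → (∀ {t} → t ∈ₗ p → proj₂ t ∈ₗ L) →
                eval φ p ≡ ⅀ L (λ α → coeff p α ℚ.* φ α)
  eval-expand {L} φ []            u p⊆L = sym (trans (⅀-cong L (λ α → ℚₚ.*-zeroˡ (φ α))) (⅀-zero L))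
  eval-expand {L} φ ((c , β) ∷ p) u p⊆L = begin
    c ℚ.* φ β ℚ.+ eval φ p
      ≡⟨ cong₂ ℚ._+_ (sym (trans (⅀-single _ u (p⊆L (here refl)) (λ α α≢β → when-no (β ≟ₘ α) (α≢β ∘ sym))) (when-yes (β ≟ₘ β) refl)))
           (eval-expand φ p u (p⊆L ∘ there)) ⟩
    ⅀ L (λ α → when 0ℚ (β ≟ₘ α) (c ℚ.* φ α)) ℚ.+ ⅀ L (λ α → coeff p α ℚ.* φ α)
      ≡⟨ ⅀-distrib L _ _ ⟨
    ⅀ L (λ α → when 0ℚ (β ≟ₘ α) (c ℚ.* φ α) ℚ.+ coeff p α ℚ.* φ α)
      ≡⟨ ⅀-cong L pointwise ⟩
    ⅀ L (λ α → coeff ((c , β) ∷ p) α ℚ.* φ α) ∎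
    where
    pointwise : ∀ α → when 0ℚ (β ≟ₘ α) (c ℚ.* φ α) ℚ.+ coeff p α ℚ.* φ α ≡ coeff ((c , β) ∷ p) α ℚ.* φ α
    pointwise α with β ≟ₘ α
    ... | yes _ = sym (ℚₚ.*-distribʳ-+ (φ α) c (coeff p α))
    ... | no  _ = ℚₚ.+-identityˡ _

  -- Collecting like terms over a duplicate-free list of the monomials of both polynomials leaves an
  -- expression in the coefficients alone.
  ≈⇒eval : ∀ p q φ → p ≈ₚ q → eval φ p ≡ eval φ q
  ≈⇒eval p q φ p≈q = begin
    eval φ p                                ≡⟨ eval-expand φ p u (λ t∈ → inL (∈ₚ.∈-++⁺ˡ t∈)) ⟩
    ⅀ L (λ α → coeff p α ℚ.* φ α)           ≡⟨ ⅀-cong L (λ α → cong (ℚ._* φ α) (p≈q α)) ⟩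
    ⅀ L (λ α → coeff q α ℚ.* φ α)           ≡⟨ eval-expand φ q u (λ t∈ → inL (∈ₚ.∈-++⁺ʳ p t∈)) ⟨
    eval φ q                                ∎
    where
    open import Data.List.Relation.Unary.Unique.DecPropositional.Properties _≟ₘ_ using (deduplicate-!)
    L : List (Mono m)
    L = List.deduplicate _≟ₘ_ (map proj₂ (p ++ q))
    u : Unique L
    u = deduplicate-! _
    inL : ∀ {t} → t ∈ₗ (p ++ q) → proj₂ t ∈ₗ L
    inL t∈ = ∈ₚ.∈-deduplicate⁺ _≟ₘ_ (∈ₚ.∈-map⁺ proj₂ t∈)

  eval⇒≈ : ∀ {p q} → (∀ φ → eval φ p ≡ eval φ q) → p ≈ₚ q
  eval⇒≈ {p} {q} e α = trans (coeff≡eval p α) (trans (e (δ α)) (sym (coeff≡eval q α)))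

  module _ {gens : List (Poly m)} where

    private
      combination : List (Poly m × Poly m) → Poly m
      combination = concatMap (λ qg → proj₁ qg *ₚ proj₂ qg)

    ideal-≈ : ∀ {p q} → (∀ φ → eval φ p ≡ eval φ q) → InIdeal gens p → InIdeal gens q
    ideal-≈ {p} {q} e (qs , ∈gens , c≈p) = qs , ∈gens , λ α → trans (c≈p α) (eval⇒≈ {p} {q} e α)

    ideal-0 : InIdeal gens []
    ideal-0 = [] , [] , λ _ → refl

    ideal-++ : ∀ {p q} → InIdeal gens p → InIdeal gens q → InIdeal gens (p ++ q)
    ideal-++ {p} {q} (qs , ∈gens , c≈p) (rs , ∈gens' , d≈q) = qs ++ rs , Allₚ.++⁺ ∈gens ∈gens' ,
      eval⇒≈ {combination (qs ++ rs)} {p ++ q} (λ φ → begin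
        eval φ (combination (qs ++ rs))                         ≡⟨ cong (eval φ) (Listₚ.concatMap-++ _ qs rs) ⟩
        eval φ (combination qs ++ combination rs)               ≡⟨ eval-++ φ (combination qs) _ ⟩
        eval φ (combination qs) ℚ.+ eval φ (combination rs)     ≡⟨ cong₂ ℚ._+_ (≈⇒eval (combination qs) p φ c≈p) (≈⇒eval (combination rs) q φ d≈q) ⟩
        eval φ p ℚ.+ eval φ q                                   ≡⟨ eval-++ φ p q ⟨
        eval φ (p ++ q)                                         ∎)

    ideal-* : ∀ a {p} → InIdeal gens p → InIdeal gens (a *ₚ p)
    ideal-* a {p} (qs , ∈gens , c≈p) = map multiply qs , Allₚ.map⁺ ∈gens ,
      eval⇒≈ {combination (map multiply qs)} {a *ₚ p} (λ φ → begin
        eval φ (combination (map multiply qs))                             ≡⟨ collect φ qs ⟩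
        eval (λ α → eval (λ β → φ (α ⊗ β)) (combination qs)) a              ≡⟨ eval-cong a (λ α → ≈⇒eval (combination qs) p (λ β → φ (α ⊗ β)) c≈p) ⟩
        eval (λ α → eval (λ β → φ (α ⊗ β)) p) a                             ≡⟨ eval-* φ a p ⟨
        eval φ (a *ₚ p)                                                     ∎)
      where
      multiply : Poly m × Poly m → Poly m × Poly m
      multiply (q , g) = a *ₚ q , g
      assoc-⊗ : ∀ {k} (α β γ : Mono k) → α ⊗ β ⊗ γ ≡ α ⊗ (β ⊗ γ)
      assoc-⊗ = Vecₚ.zipWith-assoc +-assoc
      collect : ∀ φ qs → eval φ (combination (map multiply qs)) ≡ eval (λ α → eval (λ β → φ (α ⊗ β)) (combination qs)) a
      collect φ []             = sym (eval-zero a (λ _ → refl))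
      collect φ ((q , g) ∷ qs) = begin
        eval φ (((a *ₚ q) *ₚ g) ++ combination (map multiply qs))
          ≡⟨ eval-++ φ ((a *ₚ q) *ₚ g) _ ⟩
        eval φ ((a *ₚ q) *ₚ g) ℚ.+ eval φ (combination (map multiply qs))
          ≡⟨ cong₂ ℚ._+_ head (collect φ qs) ⟩
        eval (λ α → eval (λ β → φ (α ⊗ β)) (q *ₚ g)) a ℚ.+ eval (λ α → eval (λ β → φ (α ⊗ β)) (combination qs)) a
          ≡⟨ ⅀-distrib a _ _ ⟨
        ⅀ a (λ t → proj₁ t ℚ.* eval (λ β → φ (proj₂ t ⊗ β)) (q *ₚ g) ℚ.+ proj₁ t ℚ.* eval (λ β → φ (proj₂ t ⊗ β)) (combination qs))
          ≡⟨ ⅀-cong a (λ t → trans (cong (proj₁ t ℚ.*_) (eval-++ (λ β → φ (proj₂ t ⊗ β)) (q *ₚ g) (combination qs))) (ℚₚ.*-distribˡ-+ (proj₁ t) (eval (λ β → φ (proj₂ t ⊗ β)) (q *ₚ g)) (eval (λ β → φ (proj₂ t ⊗ β)) (combination qs)))) ⟨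
        eval (λ α → eval (λ β → φ (α ⊗ β)) (combination ((q , g) ∷ qs))) a ∎
        where
        head : eval φ ((a *ₚ q) *ₚ g) ≡ eval (λ α → eval (λ β → φ (α ⊗ β)) (q *ₚ g)) a
        head = begin
          eval φ ((a *ₚ q) *ₚ g)
            ≡⟨ eval-* φ (a *ₚ q) g ⟩
          eval (λ α → eval (λ β → φ (α ⊗ β)) g) (a *ₚ q)
            ≡⟨ eval-* (λ α → eval (λ β → φ (α ⊗ β)) g) a q ⟩
          eval (λ α → eval (λ β → eval (λ γ → φ (α ⊗ β ⊗ γ)) g) q) a
            ≡⟨ eval-cong a (λ α → eval-cong q (λ β → eval-cong g (λ γ → cong φ (assoc-⊗ α β γ)))) ⟩
          eval (λ α → eval (λ β → eval (λ γ → φ (α ⊗ (β ⊗ γ))) g) q) a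
            ≡⟨ eval-cong a (λ α → eval-* (λ β → φ (α ⊗ β)) q g) ⟨
          eval (λ α → eval (λ β → φ (α ⊗ β)) (q *ₚ g)) a ∎

    ideal-gen : ∀ {g} → g ∈ₗ gens → InIdeal gens g
    ideal-gen {g} g∈ = (oneₚ , g) ∷ [] , g∈ ∷ [] , eval⇒≈ {combination ((oneₚ , g) ∷ [])} {g} (λ φ → begin
      eval φ ((oneₚ *ₚ g) ++ [])                             ≡⟨ cong (eval φ) (Listₚ.++-identityʳ (oneₚ *ₚ g)) ⟩
      eval φ (oneₚ *ₚ g)                                     ≡⟨ eval-* φ oneₚ g ⟩
      eval (λ α → eval (λ β → φ (α ⊗ β)) g) oneₚ             ≡⟨ eval-mono (λ α → eval (λ β → φ (α ⊗ β)) g) (Vec.replicate m 0) ⟩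
      eval (λ β → φ (Vec.replicate m 0 ⊗ β)) g               ≡⟨ eval-cong g (λ β → cong φ (Vecₚ.zipWith-identityˡ (λ _ → refl) β)) ⟩
      eval φ g                                               ∎)

    ideal-scale : ∀ c {p} → InIdeal gens p → InIdeal gens (scaleₚ c p)
    ideal-scale c {p} p∈ = ideal-≈ {((c , Vec.replicate m 0) ∷ []) *ₚ p} {scaleₚ c p} (λ φ → begin
      eval φ (((c , Vec.replicate m 0) ∷ []) *ₚ p)                ≡⟨ eval-* φ ((c , Vec.replicate m 0) ∷ []) p ⟩
      c ℚ.* eval (λ β → φ (Vec.replicate m 0 ⊗ β)) p ℚ.+ 0ℚ       ≡⟨ ℚₚ.+-identityʳ _ ⟩
      c ℚ.* eval (λ β → φ (Vec.replicate m 0 ⊗ β)) p              ≡⟨ cong (c ℚ.*_) (eval-cong p (λ β → cong φ (Vecₚ.zipWith-identityˡ (λ _ → refl) β))) ⟩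
      c ℚ.* eval φ p                                              ≡⟨ eval-scale φ c p ⟨
      eval φ (scaleₚ c p)                                         ∎)
      (ideal-* ((c , Vec.replicate m 0) ∷ []) {p} p∈)

    eval-ideal : ∀ φ → (∀ {g} → g ∈ₗ gens → ∀ α → eval (λ β → φ (α ⊗ β)) g ≡ 0ℚ) → ∀ p → InIdeal gens p → eval φ p ≡ 0ℚ
    eval-ideal φ kills p (qs , ∈gens , c≈p) = trans (sym (≈⇒eval (combination qs) p φ c≈p)) (go qs ∈gens)
      where
      go : ∀ qs → All (λ qg → proj₂ qg ∈ₗ gens) qs → eval φ (combination qs) ≡ 0ℚ
      go []             []         = refl
      go ((q , g) ∷ qs) (g∈ ∷ ∈gs) = trans (eval-++ φ (q *ₚ g) _)
        (cong₂ ℚ._+_ (trans (eval-* φ q g) (eval-zero q (kills g∈))) (go qs ∈gs))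

-- Linear dependence over the rationals

open ℚSum using () renaming (⅀ to ∑ℚ)

⅀-allFin-suc : ∀ {c} (f : Fin (suc c) → ℚ) → ∑ℚ (allFin (suc c)) f ≡ f zero ℚ.+ ∑ℚ (allFin c) (f ∘ suc)
⅀-allFin-suc {c} f = cong (f zero ℚ.+_)
  (trans (cong (λ xs → ∑ℚ xs f) (sym (Listₚ.map-tabulate id suc))) (ℚSum.⅀-map suc (allFin c) f))

inverse : ∀ {p} → p ≢ 0ℚ → ∃ λ q → q ℚ.* p ≡ 1ℚ
inverse {p} p≢0 = (ℚ.1/ p) {{ℚ.≢-nonZero p≢0}} , ℚₚ.*-inverseˡ p {{ℚ.≢-nonZero p≢0}}

-- Gaussian elimination of the first vector.
dependent : ∀ {c r} → r < c → (A : Fin c → Fin r → ℚ) →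
            ∃ λ (a : Fin c → ℚ) → (∃ λ k → a k ≢ 0ℚ) × (∀ j → ∑ℚ (allFin c) (λ k → a k ℚ.* A k j) ≡ 0ℚ)
dependent {suc c} {r} r<c A with Finₚ.any? (λ q → ¬? (A zero q ℚ.≟ 0ℚ))
... | no none = unit , (zero , λ ()) , λ j → begin
  ∑ℚ (allFin (suc c)) (λ k → unit k ℚ.* A k j)
    ≡⟨ ⅀-allFin-suc (λ k → unit k ℚ.* A k j) ⟩
  1ℚ ℚ.* A zero j ℚ.+ ∑ℚ (allFin c) (λ k → 0ℚ ℚ.* A (suc k) j)
    ≡⟨ cong₂ ℚ._+_ (trans (ℚₚ.*-identityˡ _) (zero-row j))
         (trans (ℚSum.⅀-cong (allFin c) (λ k → ℚₚ.*-zeroˡ (A (suc k) j))) (ℚSum.⅀-zero (allFin c))) ⟩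
  0ℚ ∎
  where
  open ≡-Reasoning
  unit : Fin (suc c) → ℚ
  unit zero    = 1ℚ
  unit (suc _) = 0ℚ
  zero-row : ∀ j → A zero j ≡ 0ℚ
  zero-row j with A zero j ℚ.≟ 0ℚ
  ... | yes e = e
  ... | no ¬e = ⊥-elim (none (j , ¬e))
dependent {suc c} {suc r} (s≤s r<c) A | yes (q , A₀q≢0) = a , (suc (proj₁ nz) , proj₂ nz) , kernel
  where
  open ≡-Reasoning
  t : Fin c → ℚ
  t k = A (suc k) q ℚ.* proj₁ (inverse A₀q≢0)
  A' : Fin c → Fin (suc r) → ℚ
  A' k j = A (suc k) j ℚ.+ ℚ.- (t k ℚ.* A zero j)
  IH = dependent r<c (λ k j → A' k (Fin.punchIn q j))
  a' : Fin c → ℚ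
  a' = proj₁ IH
  nz : ∃ λ k → a' k ≢ 0ℚ
  nz = proj₁ (proj₂ IH)
  a : Fin (suc c) → ℚ
  a zero    = ∑ℚ (allFin c) (λ k → a' k ℚ.* (ℚ.- t k))
  a (suc k) = a' k
  row : ∀ j k → a' k ℚ.* (ℚ.- t k) ℚ.* A zero j ℚ.+ a' k ℚ.* A (suc k) j ≡ a' k ℚ.* A' k j
  row j k = begin
    a' k ℚ.* (ℚ.- t k) ℚ.* A zero j ℚ.+ a' k ℚ.* A (suc k) j
      ≡⟨ cong (ℚ._+ a' k ℚ.* A (suc k) j) (trans (ℚₚ.*-assoc (a' k) (ℚ.- t k) (A zero j)) (cong (a' k ℚ.*_) (sym (ℚₚ.neg-distribˡ-* (t k) (A zero j))))) ⟩
    a' k ℚ.* (ℚ.- (t k ℚ.* A zero j)) ℚ.+ a' k ℚ.* A (suc k) j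
      ≡⟨ ℚₚ.*-distribˡ-+ (a' k) (ℚ.- (t k ℚ.* A zero j)) (A (suc k) j) ⟨
    a' k ℚ.* (ℚ.- (t k ℚ.* A zero j) ℚ.+ A (suc k) j)
      ≡⟨ cong (a' k ℚ.*_) (ℚₚ.+-comm (ℚ.- (t k ℚ.* A zero j)) (A (suc k) j)) ⟩
    a' k ℚ.* A' k j ∎
  eliminated : ∀ j → ∑ℚ (allFin (suc c)) (λ k → a k ℚ.* A k j) ≡ ∑ℚ (allFin c) (λ k → a' k ℚ.* A' k j)
  eliminated j = begin
    ∑ℚ (allFin (suc c)) (λ k → a k ℚ.* A k j)
      ≡⟨ ⅀-allFin-suc (λ k → a k ℚ.* A k j) ⟩
    a zero ℚ.* A zero j ℚ.+ ∑ℚ (allFin c) (λ k → a' k ℚ.* A (suc k) j)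
      ≡⟨ cong (ℚ._+ ∑ℚ (allFin c) (λ k → a' k ℚ.* A (suc k) j)) (ℚₚ.*-comm (a zero) (A zero j)) ⟩
    A zero j ℚ.* a zero ℚ.+ ∑ℚ (allFin c) (λ k → a' k ℚ.* A (suc k) j)
      ≡⟨ cong (ℚ._+ ∑ℚ (allFin c) (λ k → a' k ℚ.* A (suc k) j)) (⅀-*ˡ (A zero j) (allFin c) (λ k → a' k ℚ.* (ℚ.- t k))) ⟨
    ∑ℚ (allFin c) (λ k → A zero j ℚ.* (a' k ℚ.* (ℚ.- t k))) ℚ.+ ∑ℚ (allFin c) (λ k → a' k ℚ.* A (suc k) j)
      ≡⟨ ℚSum.⅀-distrib (allFin c) _ _ ⟨
    ∑ℚ (allFin c) (λ k → A zero j ℚ.* (a' k ℚ.* (ℚ.- t k)) ℚ.+ a' k ℚ.* A (suc k) j)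
      ≡⟨ ℚSum.⅀-cong (allFin c) (λ k → trans (cong (ℚ._+ a' k ℚ.* A (suc k) j) (ℚₚ.*-comm (A zero j) (a' k ℚ.* (ℚ.- t k)))) (row j k)) ⟩
    ∑ℚ (allFin c) (λ k → a' k ℚ.* A' k j) ∎
  A'-q : ∀ k → A' k q ≡ 0ℚ
  A'-q k = begin
    A (suc k) q ℚ.+ ℚ.- (A (suc k) q ℚ.* proj₁ (inverse A₀q≢0) ℚ.* A zero q)
      ≡⟨ cong (λ z → A (suc k) q ℚ.+ ℚ.- z) (trans (ℚₚ.*-assoc (A (suc k) q) (proj₁ (inverse A₀q≢0)) (A zero q)) (trans (cong (A (suc k) q ℚ.*_) (proj₂ (inverse A₀q≢0))) (ℚₚ.*-identityʳ _))) ⟩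
    A (suc k) q ℚ.+ ℚ.- A (suc k) q
      ≡⟨ ℚₚ.+-inverseʳ (A (suc k) q) ⟩
    0ℚ ∎
  kernel : ∀ j → ∑ℚ (allFin (suc c)) (λ k → a k ℚ.* A k j) ≡ 0ℚ
  kernel j with q Fin.≟ j
  ... | yes refl = trans (eliminated q) (trans
    (ℚSum.⅀-cong (allFin c) (λ k → trans (cong (a' k ℚ.*_) (A'-q k)) (ℚₚ.*-zeroʳ (a' k)))) (ℚSum.⅀-zero (allFin c)))
  ... | no q≢j = trans (eliminated j) (subst (λ i → ∑ℚ (allFin c) (λ k → a' k ℚ.* A' k i) ≡ 0ℚ)
    (Finₚ.punchIn-punchOut q≢j) (proj₂ (proj₂ IH) (Fin.punchOut q≢j)))

-- A monomial basis of the Chow ring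

lookup-ext : ∀ {A : Set} {k} {xs ys : Vec A k} → (∀ i → lookup xs i ≡ lookup ys i) → xs ≡ ys
lookup-ext {xs = xs} {ys} e =
  trans (sym (Vecₚ.tabulate∘lookup xs)) (trans (Vecₚ.tabulate-cong e) (Vecₚ.tabulate∘lookup ys))

All-concatMap : ∀ {A B : Set} {P : B → Set} (f : A → List B) xs → (∀ x → All P (f x)) → All P (concatMap f xs)
All-concatMap f xs h = Allₚ.concat⁺ (Allₚ.map⁺ (All.universal h xs))

unit : ∀ {m} → Fin m → Mono m
unit j = tabulate (λ i → if ⌊ i Fin.≟ j ⌋ then 1 else 0)

⊗-unit : ∀ {m} (α : Mono m) j → α ⊗ unit j ≡ α ⊕ j
⊗-unit α j = lookup-ext λ i → trans (Vecₚ.lookup-zipWith _+_ i α (unit j)) (at i)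
  where
  at : ∀ i → lookup α i + lookup (unit j) i ≡ lookup (α ⊕ j) i
  at i rewrite Vecₚ.lookup∘tabulate (λ i → if ⌊ i Fin.≟ j ⌋ then 1 else 0) i with i Fin.≟ j
  ... | yes refl = trans (+-comm (lookup α i) 1) (sym (Vecₚ.lookup∘updateAt i α))
  ... | no  i≢j  = trans (+-identityʳ _) (sym (Vecₚ.lookup∘updateAt′ i j i≢j α))

⊕-⊗ : ∀ {m} (α γ : Mono m) j → (α ⊕ j) ⊗ γ ≡ (α ⊗ γ) ⊕ j
⊕-⊗ (x ∷ α) (y ∷ γ) zero    = refl
⊕-⊗ (x ∷ α) (y ∷ γ) (suc j) = cong (x + y ∷_) (⊕-⊗ α γ j)

sum-⊕ : ∀ {m} (ν : Mono m) j → Vec.sum (ν ⊕ j) ≡ suc (Vec.sum ν)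
sum-⊕ (x ∷ ν) zero    = refl
sum-⊕ (x ∷ ν) (suc j) = trans (cong (x +_) (sum-⊕ ν j)) (+-suc x _)

indicator : ∀ {m} → Subset m → Mono m
indicator = Vec.map (λ s → if s then 1 else 0)

support : ∀ {m} → Mono m → Subset m
support = Vec.map (λ x → ⌊ 1 ≤? x ⌋)

1≤indicator-support : ∀ {m} (ν : Mono m) c → 1 ≤ lookup ν c → 1 ≤ lookup (indicator (support ν)) c
1≤indicator-support (suc x ∷ ν) zero    p = s≤s z≤n
1≤indicator-support (x ∷ ν)     (suc c) p = 1≤indicator-support ν c p

indicator-∸ : ∀ {m} (ν : Mono m) → Vec.zipWith _∸_ ν (indicator (support ν)) ⊗ indicator (support ν) ≡ ν
indicator-∸ []          = refl
indicator-∸ (zero ∷ ν)  = cong (0 ∷_) (indicator-∸ ν)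
indicator-∸ (suc x ∷ ν) = cong₂ _∷_ (+-comm x 1) (indicator-∸ ν)

indicator-true : ∀ {m} (S : Subset m) c → 1 ≤ lookup (indicator S) c → lookup S c ≡ true
indicator-true (true ∷ S) zero    p = refl
indicator-true (s ∷ S)    (suc c) p = indicator-true S c p

true-indicator : ∀ {m} (S : Subset m) c → lookup S c ≡ true → 1 ≤ lookup (indicator S) c
true-indicator (true ∷ S) zero    p = s≤s z≤n
true-indicator (s ∷ S)    (suc c) p = true-indicator S c p

⊗-≥ʳ : ∀ {m} (α γ : Mono m) c → lookup γ c ≤ lookup (α ⊗ γ) c
⊗-≥ʳ α γ c rewrite Vecₚ.lookup-zipWith _+_ c α γ = m≤n+m _ (lookup α c)

subₛ⁺ : ∀ {n} {A B : Subset n} → A ⊆ B → subₛ A B ≡ true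
subₛ⁺ {A = A} {B} p with A ⊆? B
... | yes _ = refl
... | no ¬p = ⊥-elim (¬p p)

subₛ⁻ : ∀ {n} {A B : Subset n} → subₛ A B ≡ true → A ⊆ B
subₛ⁻ {A = A} {B} e with A ⊆? B
... | yes p = p
subₛ⁻ () | no _

eqₛ⁺ : ∀ {n} {A B : Subset n} → A ≡ B → eqₛ A B ≡ true
eqₛ⁺ {A = A} {B} p with A ≟ₛ B
... | yes _ = refl
... | no ¬p = ⊥-elim (¬p p)

eqₛ⁻ : ∀ {n} {A B : Subset n} → eqₛ A B ≡ true → A ≡ B
eqₛ⁻ {A = A} {B} e with A ≟ₛ B
... | yes p = p
eqₛ⁻ () | no _

∧⁺ : ∀ {a b} → a ≡ true → b ≡ true → a ∧ b ≡ true
∧⁺ refl refl = refl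

∧⁻ : ∀ {a b} → a ∧ b ≡ true → a ≡ true × b ≡ true
∧⁻ {true} {true} refl = refl , refl

not⁺ : ∀ {a} → ¬ (a ≡ true) → not a ≡ true
not⁺ {true}  h = ⊥-elim (h refl)
not⁺ {false} h = refl

not⁻ : ∀ {a} → not a ≡ true → ¬ (a ≡ true)
not⁻ {true}  () _
not⁻ {false} _  ()

module ChowIdeal {n : ℕ} (M : Matroid n) (Z : Subset n) (β : SetOfSubsets n)
  (jc : JoinClosed M Z (Chow.B[_] M Z β)) where
  open Chow M Z β
  open Reduction M Z B[_]
  open Values ℚₚ.+-0-isAbelianGroup
  open Rank M
  open ℚSum

  -- This and the next three definitions repeat the local ones of `gen`, so that `gen S b` unfolds
  -- to `mono (indicator S) *ₚ power b (gap S b)`.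
  strictly-below : Subset m → Fin m → Fin m → Bool
  strictly-below S b j = lookup S j ∧ subₛ B[ j ] B[ b ] ∧ not (eqₛ B[ j ] B[ b ])

  joinBelow : Subset m → Fin m → List (Fin m) → Subset n
  joinBelow S b = List.foldr (λ j acc → if strictly-below S b j then _∨ₗ_ M B[ j ] acc else acc) Z

  power : Fin m → ℕ → Poly m
  power b k = concatMap (λ j → if subₛ B[ b ] B[ j ] then varₚ j else []) (allFin m) ^ₚ k

  gap : Subset m → Fin m → ℕ
  gap S b = rkN B[ b ] ∸ rkN (joinBelow S b (allFin m))

  Z⊆joinBelow : ∀ S b js → Z ⊆ joinBelow S b js
  Z⊆joinBelow S b []       = ⊆-refl
  Z⊆joinBelow S b (j ∷ js) with strictly-below S b j
  ... | true  = ⊆-trans (Z⊆joinBelow S b js) (⊆-trans ⊆∪ʳ ⊆cl)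
  ... | false = Z⊆joinBelow S b js

  ⊆joinBelow : ∀ S b js {j} → j ∈ₗ js → strictly-below S b j ≡ true → B[ j ] ⊆ joinBelow S b js
  ⊆joinBelow S b (j ∷ js) (here refl) e rewrite e = ⊆-trans ⊆∪ˡ ⊆cl
  ⊆joinBelow S b (i ∷ js) (there j∈) e with strictly-below S b i
  ... | true  = ⊆-trans (⊆joinBelow S b js j∈ e) (⊆-trans ⊆∪ʳ ⊆cl)
  ... | false = ⊆joinBelow S b js j∈ e

  joinBelow⊆ : ∀ S b js → joinBelow S b js ⊆ cl M (U (indicator S) b)
  joinBelow⊆ S b []       = ⊆-trans Z⊆U ⊆cl
  joinBelow⊆ S b (j ∷ js) with strictly-below S b j in e
  ... | false = joinBelow⊆ S b js
  ... | true  = cl-least (∪-lub (⊆-trans contributes ⊆cl) (joinBelow⊆ S b js)) (cl-flat _)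
    where
    contributes : B[ j ] ⊆ U (indicator S) b
    contributes with ∧⁻ e
    ... | p , q with ∧⁻ {subₛ B[ j ] B[ b ]} q
    ...   | q₁ , q₂ = ∈U j (true-indicator S j p) (⊆∧≢⇒⊊ (subₛ⁻ q₁) (λ e → not⁻ q₂ (eqₛ⁺ e)))

  -- The iterated join contains the union and is contained in its closure.
  rank-joinBelow : ∀ S b → r (joinBelow S b (allFin m)) ≡ r (U (indicator S) b)
  rank-joinBelow S b = ≤-antisym
    (≤-trans (r-mono (joinBelow⊆ S b (allFin m))) (r-cl _))
    (r-mono (U-least (Z⊆joinBelow S b (allFin m)) λ c p c⊊b → ⊆joinBelow S b (allFin m) (∈ₚ.∈-allFin c)
      (∧⁺ (indicator-true S c p) (∧⁺ (subₛ⁺ (proj₁ c⊊b)) (not⁺ (λ e → ⊊⇒≢ c⊊b (eqₛ⁻ e)))))))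

  -- The rank of `Z` cancels despite the truncated subtractions, because `Z` is contained in the
  -- join.
  gap≡ : ∀ S b → gap S b ≡ r B[ b ] ∸ r (U (indicator S) b)
  gap≡ S b = begin
    (r B[ b ] ∸ r Z) ∸ (r J ∸ r Z)  ≡⟨ ∸-+-assoc (r B[ b ]) (r Z) _ ⟩
    r B[ b ] ∸ (r Z + (r J ∸ r Z))  ≡⟨ cong (r B[ b ] ∸_) (m+[n∸m]≡n (r-mono (Z⊆joinBelow S b (allFin m)))) ⟩
    r B[ b ] ∸ r J                  ≡⟨ cong (r B[ b ] ∸_) (rank-joinBelow S b) ⟩
    r B[ b ] ∸ r (U (indicator S) b) ∎
    where
    open ≡-Reasoning
    J : Subset n
    J = joinBelow S b (allFin m)

  Member-gap : ∀ S b → Member (indicator S) b (gap S b)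
  Member-gap S b rewrite gap≡ S b = ≤-trans (m≤n+m∸n (r B[ b ]) (r (U (indicator S) b))) (≤-reflexive (+-comm (r (U (indicator S) b)) _))

  eval-power : ∀ φ b k α → eval (λ γ → φ (α ⊗ γ)) (power b k) ≡ Y φ b k α
  eval-power φ b zero    α = trans (eval-mono (λ γ → φ (α ⊗ γ)) (Vec.replicate m 0)) (cong φ (Vecₚ.zipWith-identityʳ +-identityʳ α))
  eval-power φ b (suc k) α = begin
    eval (λ γ → φ (α ⊗ γ)) (above *ₚ power b k)
      ≡⟨ eval-* (λ γ → φ (α ⊗ γ)) above (power b k) ⟩
    eval (λ γ → eval (λ κ → φ (α ⊗ (γ ⊗ κ))) (power b k)) above
      ≡⟨ eval-cong above (λ γ → eval-cong (power b k) (λ κ → cong φ (sym (Vecₚ.zipWith-assoc +-assoc α γ κ)))) ⟩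
    eval (λ γ → eval (λ κ → φ (α ⊗ γ ⊗ κ)) (power b k)) above
      ≡⟨ eval-cong above (λ γ → eval-power φ b k (α ⊗ γ)) ⟩
    eval (λ γ → Y φ b k (α ⊗ γ)) above
      ≡⟨ ⅀-concatMap (λ j → if subₛ B[ b ] B[ j ] then varₚ j else []) (allFin m) (λ t → proj₁ t ℚ.* Y φ b k (α ⊗ proj₂ t)) ⟩
    ⅀ (allFin m) (λ j → eval (λ γ → Y φ b k (α ⊗ γ)) (if subₛ B[ b ] B[ j ] then varₚ j else []))
      ≡⟨ ⅀-cong (allFin m) term ⟩
    Y φ b (suc k) α ∎
    where
    open ≡-Reasoning
    above : Poly m
    above = concatMap (λ j → if subₛ B[ b ] B[ j ] then varₚ j else []) (allFin m)
    term : ∀ j → eval (λ γ → Y φ b k (α ⊗ γ)) (if subₛ B[ b ] B[ j ] then varₚ j else [])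
               ≡ when 0ℚ (B[ b ] ⊆? B[ j ]) (Y φ b k (α ⊕ j))
    term j with B[ b ] ⊆? B[ j ]
    ... | no  _ = refl
    ... | yes _ = trans (eval-mono (λ γ → Y φ b k (α ⊗ γ)) (unit j)) (cong (Y φ b k) (⊗-unit α j))

  eval-mono-power : ∀ φ ν b k → eval φ (mono ν *ₚ power b k) ≡ Y φ b k ν
  eval-mono-power φ ν b k = begin
    eval φ (mono ν *ₚ power b k)                                  ≡⟨ eval-* φ (mono ν) (power b k) ⟩
    eval (λ α → eval (λ γ → φ (α ⊗ γ)) (power b k)) (mono ν)      ≡⟨ eval-mono (λ α → eval (λ γ → φ (α ⊗ γ)) (power b k)) ν ⟩
    eval (λ γ → φ (ν ⊗ γ)) (power b k)                            ≡⟨ eval-power φ b k ν ⟩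
    Y φ b k ν                                                     ∎
    where open ≡-Reasoning

  Y-⊗ : ∀ χ b k κ γ → Y (λ α → χ (α ⊗ γ)) b k κ ≡ Y χ b k (κ ⊗ γ)
  Y-⊗ χ b zero    κ γ = refl
  Y-⊗ χ b (suc k) κ γ = Σ↑-cong b (λ j _ → trans (Y-⊗ χ b k (κ ⊕ j) γ) (cong (Y χ b k) (⊕-⊗ κ γ j)))

  eval-gen : ∀ φ S b α → eval (λ γ → φ (α ⊗ γ)) (gen S b) ≡ Y φ b (gap S b) (α ⊗ indicator S)
  eval-gen φ S b α = begin
    eval (λ γ → φ (α ⊗ γ)) (mono (indicator S) *ₚ power b (gap S b))
      ≡⟨ eval-* (λ γ → φ (α ⊗ γ)) (mono (indicator S)) (power b (gap S b)) ⟩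
    eval (λ γ → eval (λ κ → φ (α ⊗ (γ ⊗ κ))) (power b (gap S b))) (mono (indicator S))
      ≡⟨ eval-mono (λ γ → eval (λ κ → φ (α ⊗ (γ ⊗ κ))) (power b (gap S b))) (indicator S) ⟩
    eval (λ κ → φ (α ⊗ (indicator S ⊗ κ))) (power b (gap S b))
      ≡⟨ eval-cong (power b (gap S b)) (λ κ → cong φ (sym (Vecₚ.zipWith-assoc +-assoc α (indicator S) κ))) ⟩
    eval (λ κ → φ (α ⊗ indicator S ⊗ κ)) (power b (gap S b))
      ≡⟨ eval-power φ b (gap S b) (α ⊗ indicator S) ⟩
    Y φ b (gap S b) (α ⊗ indicator S) ∎
    where open ≡-Reasoning

  gen∈gens : ∀ S b → gen S b ∈ₗ gens
  gen∈gens S b = ∈ₚ.∈-concatMap⁺ _ (Any.map (λ { refl → ∈ₚ.∈-map⁺ (gen S) (∈ₚ.∈-allFin b) }) (allSubsets-complete S))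

  gens-gen : ∀ {g} → g ∈ₗ gens → ∃ λ S → ∃ λ b → g ≡ gen S b
  gens-gen g∈ with Any.satisfied (∈ₚ.∈-concatMap⁻ (λ S → map (gen S) (allFin m)) {xs = allSubsets m} g∈)
  ... | S , g∈S with ∈ₚ.∈-map⁻ (gen S) g∈S
  ...   | b , _ , e = S , b , e

  -- The generator for the support of `ν` has an exponent `e` that is at most `k`. The cofactor is
  -- `κ y_b^(k ∸ e)`, where `κ` lowers every positive exponent of `ν` by one.
  member-in-ideal : ∀ ν b k → Member ν b k → InIdeal gens (mono ν *ₚ power b k)
  member-in-ideal ν b k mem = ideal-≈ {p = a *ₚ gen S b} {mono ν *ₚ power b k} same (ideal-* a (ideal-gen (gen∈gens S b)))
    where
    open ≡-Reasoning
    S : Subset m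
    S = support ν
    κ : Mono m
    κ = Vec.zipWith _∸_ ν (indicator S)
    e : ℕ
    e = gap S b
    e≤k : e ≤ k
    e≤k rewrite gap≡ S b = m≤n+o⇒m∸n≤o (r B[ b ]) (r (U (indicator S) b)) (≤-trans mem
      (≤-trans (+-monoʳ-≤ k (r-mono (U-least Z⊆U (λ c p c⊊b → ∈U c (1≤indicator-support ν c p) c⊊b)))) (≤-reflexive (+-comm k _))))
    a : Poly m
    a = mono κ *ₚ power b (k ∸ e)
    same : ∀ φ → eval φ (a *ₚ gen S b) ≡ eval φ (mono ν *ₚ power b k)
    same φ = begin
      eval φ (a *ₚ gen S b)                                      ≡⟨ eval-* φ a (gen S b) ⟩
      eval (λ α → eval (λ γ → φ (α ⊗ γ)) (gen S b)) a            ≡⟨ eval-cong a (eval-gen φ S b) ⟩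
      eval (λ α → Y φ b e (α ⊗ indicator S)) a                   ≡⟨ eval-mono-power (λ α → Y φ b e (α ⊗ indicator S)) κ b (k ∸ e) ⟩
      Y (λ α → Y φ b e (α ⊗ indicator S)) b (k ∸ e) κ            ≡⟨ Y-⊗ (Y φ b e) b (k ∸ e) κ (indicator S) ⟩
      Y (Y φ b e) b (k ∸ e) (κ ⊗ indicator S)                    ≡⟨ cong (Y (Y φ b e) b (k ∸ e)) (indicator-∸ ν) ⟩
      Y (Y φ b e) b (k ∸ e) ν                                    ≡⟨ Y-+ φ b e (k ∸ e) ν ⟩
      Y φ b (k ∸ e + e) ν                                        ≡⟨ cong (λ l → Y φ b l ν) (m∸n+n≡m e≤k) ⟩
      Y φ b k ν                                                  ≡⟨ eval-mono-power φ ν b k ⟨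
      eval φ (mono ν *ₚ power b k)                               ∎

  module Form (τ : Mono m → ℚ) where
    open NormalForm jc ℚₚ.+-0-isAbelianGroup τ

    eval-φ-ideal : ∀ p → InIdeal gens p → eval φ p ≡ 0ℚ
    eval-φ-ideal = eval-ideal φ kills
      where
      kills : ∀ {g} → g ∈ₗ gens → ∀ α → eval (λ γ → φ (α ⊗ γ)) g ≡ 0ℚ
      kills g∈ α with gens-gen g∈
      ... | S , b , refl = trans (eval-gen φ S b α) (kill (α ⊗ indicator S) b (gap S b) (Member-mono (⊗-≥ʳ α (indicator S)) (Member-gap S b)))

-1*≡- : ∀ x → (ℚ.- 1ℚ) ℚ.* x ≡ ℚ.- x
-1*≡- x = trans (sym (ℚₚ.neg-distribˡ-* 1ℚ x)) (cong ℚ.-_ (ℚₚ.*-identityˡ x))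

module ChowBasis {n : ℕ} (M : Matroid n) (Z : Subset n) (β : SetOfSubsets n)
  (jc : JoinClosed M Z (Chow.B[_] M Z β)) where
  open Chow M Z β
  open Reduction M Z B[_]
  open Values ℚₚ.+-0-isAbelianGroup
  open ChowIdeal M Z β jc
  open NormalForm jc ℚₚ.+-0-isAbelianGroup using (tail; Y-tail; meas-clear)
  open ℚSum using (⅀-cong)
  open ≡-Reasoning

  StandardOfDegree : ℕ → Mono m → Set
  StandardOfDegree i α = Standard α × Vec.sum α ≡ i

  Reduces : ℕ → Poly m → Set
  Reduces i p = ∃ λ q → All (λ t → StandardOfDegree i (proj₂ t)) q × InIdeal gens (p -ₚ q)

  reduces-≈ : ∀ {i} p p' → (∀ φ → eval φ p ≡ eval φ p') → Reduces i p → Reduces i p'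
  reduces-≈ p p' e (q , std , p-q) = q , std , ideal-≈ {p = p -ₚ q} {p' -ₚ q} (λ φ → begin
    eval φ (p -ₚ q)                           ≡⟨ eval-- φ p q ⟩
    eval φ p ℚ.+ (ℚ.- 1ℚ) ℚ.* eval φ q        ≡⟨ cong (ℚ._+ (ℚ.- 1ℚ) ℚ.* eval φ q) (e φ) ⟩
    eval φ p' ℚ.+ (ℚ.- 1ℚ) ℚ.* eval φ q       ≡⟨ eval-- φ p' q ⟨
    eval φ (p' -ₚ q)                          ∎) p-q

  reduces-++ : ∀ {i} p p' → Reduces i p → Reduces i p' → Reduces i (p ++ p')
  reduces-++ p p' (q , std , p-q) (q' , std' , p'-q') = q ++ q' , Allₚ.++⁺ std std' ,
    ideal-≈ {p = (p -ₚ q) ++ (p' -ₚ q')} {(p ++ p') -ₚ (q ++ q')} (λ φ → begin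
      eval φ ((p -ₚ q) ++ (p' -ₚ q'))
        ≡⟨ eval-++ φ (p -ₚ q) (p' -ₚ q') ⟩
      eval φ (p -ₚ q) ℚ.+ eval φ (p' -ₚ q')
        ≡⟨ cong₂ ℚ._+_ (eval-- φ p q) (eval-- φ p' q') ⟩
      (eval φ p ℚ.+ (ℚ.- 1ℚ) ℚ.* eval φ q) ℚ.+ (eval φ p' ℚ.+ (ℚ.- 1ℚ) ℚ.* eval φ q')
        ≡⟨ ℚSum.medial (eval φ p) _ (eval φ p') _ ⟩
      (eval φ p ℚ.+ eval φ p') ℚ.+ ((ℚ.- 1ℚ) ℚ.* eval φ q ℚ.+ (ℚ.- 1ℚ) ℚ.* eval φ q')
        ≡⟨ cong ((eval φ p ℚ.+ eval φ p') ℚ.+_) (ℚₚ.*-distribˡ-+ (ℚ.- 1ℚ) (eval φ q) (eval φ q')) ⟨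
      (eval φ p ℚ.+ eval φ p') ℚ.+ (ℚ.- 1ℚ) ℚ.* (eval φ q ℚ.+ eval φ q')
        ≡⟨ cong₂ (λ x y → x ℚ.+ (ℚ.- 1ℚ) ℚ.* y) (eval-++ φ p p') (eval-++ φ q q') ⟨
      eval φ (p ++ p') ℚ.+ (ℚ.- 1ℚ) ℚ.* eval φ (q ++ q')
        ≡⟨ eval-- φ (p ++ p') (q ++ q') ⟨
      eval φ ((p ++ p') -ₚ (q ++ q')) ∎)
    (ideal-++ {p = p -ₚ q} {p' -ₚ q'} p-q p'-q')

  reduces-scale : ∀ {i} c p → Reduces i p → Reduces i (scaleₚ c p)
  reduces-scale c p (q , std , p-q) = scaleₚ c q , Allₚ.map⁺ std ,
    ideal-≈ {p = scaleₚ c (p -ₚ q)} {scaleₚ c p -ₚ scaleₚ c q} (λ φ → begin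
      eval φ (scaleₚ c (p -ₚ q))
        ≡⟨ eval-scale φ c (p -ₚ q) ⟩
      c ℚ.* eval φ (p -ₚ q)
        ≡⟨ cong (c ℚ.*_) (eval-- φ p q) ⟩
      c ℚ.* (eval φ p ℚ.+ (ℚ.- 1ℚ) ℚ.* eval φ q)
        ≡⟨ solveℚ 4 (λ c x y z → c ⊛ (x ⊞ y ⊛ z) ⩵ c ⊛ x ⊞ y ⊛ (c ⊛ z)) refl c (eval φ p) (ℚ.- 1ℚ) (eval φ q) ⟩
      c ℚ.* eval φ p ℚ.+ (ℚ.- 1ℚ) ℚ.* (c ℚ.* eval φ q)
        ≡⟨ cong₂ (λ x y → x ℚ.+ (ℚ.- 1ℚ) ℚ.* y) (eval-scale φ c p) (eval-scale φ c q) ⟨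
      eval φ (scaleₚ c p) ℚ.+ (ℚ.- 1ℚ) ℚ.* eval φ (scaleₚ c q)
        ≡⟨ eval-- φ (scaleₚ c p) (scaleₚ c q) ⟨
      eval φ (scaleₚ c p -ₚ scaleₚ c q) ∎)
    (ideal-scale c {p -ₚ q} p-q)
    where open ℚSolver.+-*-Solver using () renaming (solve to solveℚ; _:*_ to _⊛_; _:+_ to _⊞_; _:=_ to _⩵_)

  reduces-ideal : ∀ {i} p → InIdeal gens p → Reduces i p
  reduces-ideal p p∈ = [] , [] , subst (InIdeal gens) (sym (Listₚ.++-identityʳ p)) p∈

  reduces-poly : ∀ {i} p → All (λ t → Reduces i (mono (proj₂ t))) p → Reduces i p
  reduces-poly []            []       = reduces-ideal [] ideal-0
  reduces-poly ((c , α) ∷ p) (h ∷ hs) = reduces-≈ (scaleₚ c (mono α) ++ p) ((c , α) ∷ p)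
    (λ φ → cong (λ z → z ℚ.* φ α ℚ.+ eval φ p) (ℚₚ.*-identityʳ c))
    (reduces-++ (scaleₚ c (mono α)) p (reduces-scale c (mono α) h) (reduces-poly p hs))

  -- Polynomials on which a functional takes the values `Y` and `tail`. Unlike a product of powers,
  -- they allow the weight and the degree of each single term to be controlled.
  expansion : Fin m → ℕ → Mono m → Poly m
  expansion b zero    ν = mono ν
  expansion b (suc k) ν = concatMap (λ j → when [] (B[ b ] ⊆? B[ j ]) (expansion b k (ν ⊕ j))) (allFin m)

  tailₚ : Fin m → ℕ → Mono m → Poly m
  tailₚ b zero    ν = []
  tailₚ b (suc k) ν = tailₚ b k (ν ⊕ b) ++ concatMap (λ j → when [] (B[ b ] ⊊? B[ j ]) (expansion b k (ν ⊕ j))) (allFin m)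

  eval-when : ∀ φ {P : Set} (d : Dec P) (p : Poly m) → eval φ (when [] d p) ≡ when 0ℚ d (eval φ p)
  eval-when φ (yes _) p = refl
  eval-when φ (no _)  p = refl

  eval-expansion : ∀ φ b k ν → eval φ (expansion b k ν) ≡ Y φ b k ν
  eval-expansion φ b zero    ν = eval-mono φ ν
  eval-expansion φ b (suc k) ν = trans (⅀-concatMap _ (allFin m) (λ t → proj₁ t ℚ.* φ (proj₂ t)))
    (⅀-cong (allFin m) (λ j → trans (eval-when φ (B[ b ] ⊆? B[ j ]) (expansion b k (ν ⊕ j)))
      (cong (when 0ℚ (B[ b ] ⊆? B[ j ])) (eval-expansion φ b k (ν ⊕ j)))))

  eval-tail : ∀ φ b k ν → eval φ (tailₚ b k ν) ≡ tail (λ _ → 0ℚ) φ b k ν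
  eval-tail φ b zero    ν = refl
  eval-tail φ b (suc k) ν = trans (eval-++ φ (tailₚ b k (ν ⊕ b)) _) (cong₂ ℚ._+_ (eval-tail φ b k (ν ⊕ b))
    (trans (⅀-concatMap _ (allFin m) (λ t → proj₁ t ℚ.* φ (proj₂ t)))
      (⅀-cong (allFin m) (λ j → trans (eval-when φ (B[ b ] ⊊? B[ j ]) (expansion b k (ν ⊕ j)))
        (cong (when 0ℚ (B[ b ] ⊊? B[ j ])) (eval-expansion φ b k (ν ⊕ j)))))))

  Lower : ℕ → ℕ → ℚ × Mono m → Set
  Lower w i t = meas (proj₂ t) < w × Vec.sum (proj₂ t) ≡ i

  All-when : ∀ {A : Set} {P : A → Set} {R : Set} (d : Dec R) {xs} → (R → All P xs) → All P (when [] d xs)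
  All-when (yes p) h = h p
  All-when (no _)  h = []

  expansion-lower : ∀ {w} b k ν → meas ν + k * wt b < w → All (Lower w (Vec.sum ν + k)) (expansion b k ν)
  expansion-lower {w} b zero    ν lt = (subst (_< w) (+-identityʳ _) lt , sym (+-identityʳ _)) ∷ []
  expansion-lower {w} b (suc k) ν lt = All-concatMap {P = Lower w (Vec.sum ν + suc k)} _ (allFin m) λ j → All-when {P = Lower w (Vec.sum ν + suc k)} (B[ b ] ⊆? B[ j ]) λ b⊆j →
    subst (λ i → All (Lower w i) (expansion b k (ν ⊕ j))) (trans (cong (_+ k) (sum-⊕ ν j)) (sym (+-suc (Vec.sum ν) k)))
      (expansion-lower b k (ν ⊕ j) (≤-<-trans (meas-⊕-≤ k ν b⊆j) lt))

  tail-lower : ∀ {w} b k ν → meas ν + k * wt b ≤ w → All (Lower w (Vec.sum ν + k)) (tailₚ b k ν)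
  tail-lower b zero    ν le = []
  tail-lower {w} b (suc k) ν le = Allₚ.++⁺
    (subst (λ i → All (Lower w i) (tailₚ b k (ν ⊕ b))) (deg b) (tail-lower b k (ν ⊕ b) (≤-trans (meas-⊕-≤ k ν ⊆-refl) le)))
    (All-concatMap {P = Lower w (Vec.sum ν + suc k)} _ (allFin m) λ j → All-when {P = Lower w (Vec.sum ν + suc k)} (B[ b ] ⊊? B[ j ]) λ b⊊j →
      subst (λ i → All (Lower w i) (expansion b k (ν ⊕ j))) (deg j)
        (expansion-lower b k (ν ⊕ j) (<-≤-trans (meas-⊕-< k ν b⊊j) le)))
    where
    deg : ∀ j → Vec.sum (ν ⊕ j) + k ≡ Vec.sum ν + suc k
    deg j = trans (cong (_+ k) (sum-⊕ ν j)) (sym (+-suc (Vec.sum ν) k))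

  sum-pow : ∀ {l} (ν : Mono l) j k → Vec.sum (pow ν j k) ≡ Vec.sum ν + k
  sum-pow (x ∷ ν) zero    k = solve 3 (λ k x s → k :+ x :+ s := x :+ s :+ k) refl k x (Vec.sum ν)
  sum-pow (x ∷ ν) (suc j) k = trans (cong (x +_) (sum-pow ν j k)) (sym (+-assoc x _ k))

  -- Subtracting the ideal element `ν y_b^k` from `α` leaves minus the tail, whose monomials have
  -- the degree of `α` and smaller weight.
  reduces-mono : ∀ s α → meas α < s → Reduces (Vec.sum α) (mono α)
  reduces-mono (suc s) α lt with member? α
  ... | no none = mono α , ((λ b mem → none (b , mem)) , refl) ∷ [] ,
    ideal-≈ {p = []} {mono α -ₚ mono α} (λ φ → sym (begin
      eval φ (mono α -ₚ mono α)                            ≡⟨ eval-- φ (mono α) (mono α) ⟩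
      eval φ (mono α) ℚ.+ (ℚ.- 1ℚ) ℚ.* eval φ (mono α)     ≡⟨ cong (eval φ (mono α) ℚ.+_) (-1*≡- _) ⟩
      eval φ (mono α) ℚ.+ ℚ.- eval φ (mono α)              ≡⟨ ℚₚ.+-inverseʳ (eval φ (mono α)) ⟩
      0ℚ                                                   ∎)) ideal-0
  ... | yes (b , mem) = reduces-≈ (lead ++ scaleₚ (ℚ.- 1ℚ) rest) (mono α) (λ φ → begin
      eval φ (lead ++ scaleₚ (ℚ.- 1ℚ) rest)
        ≡⟨ eval-++ φ lead _ ⟩
      eval φ lead ℚ.+ eval φ (scaleₚ (ℚ.- 1ℚ) rest)
        ≡⟨ cong₂ ℚ._+_ (trans (eval-mono-power φ ν b k) (Y-tail (λ _ → 0ℚ) φ b k ν)) (trans (eval-scale φ (ℚ.- 1ℚ) rest) (trans (-1*≡- _) (cong ℚ.-_ (eval-tail φ b k ν)))) ⟩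
      φ (pow ν b k) ℚ.+ t φ ℚ.+ ℚ.- t φ
        ≡⟨ trans (ℚₚ.+-assoc (φ (pow ν b k)) (t φ) _) (trans (cong (φ (pow ν b k) ℚ.+_) (ℚₚ.+-inverseʳ (t φ))) (ℚₚ.+-identityʳ _)) ⟩
      φ (pow ν b k)
        ≡⟨ cong φ (pow-clear α b) ⟩
      φ α
        ≡⟨ eval-mono φ α ⟨
      eval φ (mono α) ∎)
      (reduces-++ lead (scaleₚ (ℚ.- 1ℚ) rest)
        (reduces-ideal lead (member-in-ideal ν b k (NormalForm.Member-clear jc ℚₚ.+-0-isAbelianGroup (λ _ → 0ℚ) mem)))
        (reduces-scale (ℚ.- 1ℚ) rest (reduces-poly rest (All.map (λ {t} → below {t})
          (tail-lower b k ν (≤-reflexive (meas-clear (λ _ → 0ℚ) α b)))))))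
    where
    ν : Mono m
    ν = clear α b
    k : ℕ
    k = lookup α b
    lead rest : Poly m
    lead = mono ν *ₚ power b k
    rest = tailₚ b k ν
    t : (Mono m → ℚ) → ℚ
    t φ = tail (λ _ → 0ℚ) φ b k ν
    below : ∀ {t} → Lower (meas α) (Vec.sum ν + k) t → Reduces (Vec.sum α) (mono (proj₂ t))
    below {_ , σ} (σ< , e) = subst (λ i → Reduces i (mono σ))
      (trans e (trans (sym (sum-pow ν b k)) (cong Vec.sum (pow-clear α b))))
      (reduces-mono s σ (<-≤-trans σ< (≤-pred lt)))

  reduces-homogeneous : ∀ i p → Homogeneous i p → Reduces i p
  reduces-homogeneous i p hom = reduces-poly p (All.map (λ {t} e → subst (λ i → Reduces i (mono (proj₂ t))) e (reduces-mono (suc (meas (proj₂ t))) (proj₂ t) ≤-refl)) hom)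

-- Dimensions of the graded pieces

box : ∀ m → ℕ → List (Mono m)
box zero    i = [] ∷ []
box (suc m) i = concatMap (λ x → map (x ∷_) (box m i)) (List.upTo (suc i))

∈box : ∀ {m} i (α : Mono m) → Vec.sum α ≤ i → α ∈ₗ box m i
∈box i []      le = here refl
∈box i (x ∷ α) le = ∈ₚ.∈-concatMap⁺ _ (Any.map (λ { refl → ∈ₚ.∈-map⁺ (x ∷_) (∈box i α (m+n≤o⇒n≤o x le)) })
  (∈ₚ.∈-upTo⁺ (s≤s (m+n≤o⇒m≤o x le))))

lookup-unique : ∀ {A : Set} {xs : List A} → Unique xs → ∀ i j → List.lookup xs i ≡ List.lookup xs j → i ≡ j
lookup-unique (x∉ ∷ u) zero    zero    e = refl
lookup-unique (x∉ ∷ u) zero    (suc j) e = ⊥-elim (All.lookup x∉ (∈ₚ.∈-lookup j) e)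
lookup-unique (x∉ ∷ u) (suc i) zero    e = ⊥-elim (All.lookup x∉ (∈ₚ.∈-lookup i) (sym e))
lookup-unique (x∉ ∷ u) (suc i) (suc j) e = cong suc (lookup-unique u i j e)

module ChowDimension {n : ℕ} (M : Matroid n) (Z : Subset n) (β : SetOfSubsets n)
  (jc : JoinClosed M Z (Chow.B[_] M Z β)) where
  open Chow M Z β
  open Reduction M Z B[_]
  open ChowBasis M Z β jc using (StandardOfDegree; Reduces; reduces-homogeneous)
  open ChowIdeal M Z β jc using (module Form)
  open ≡-Reasoning
  open import Data.List.Relation.Unary.Unique.DecPropositional.Properties (_≟ₘ_ {m}) using (deduplicate-!)

  standardOfDegree? : ∀ i α → Dec (StandardOfDegree i α)
  standardOfDegree? i α = map′ (λ none b mem → none (b , mem)) (λ std (b , mem) → std b mem) (¬? (member? α)) ×-dec (Vec.sum α ℕ.≟ i)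

  standards : ℕ → List (Mono m)
  standards i = List.deduplicate _≟ₘ_ (filter (standardOfDegree? i) (box m i))

  standards-unique : ∀ i → Unique (standards i)
  standards-unique i = deduplicate-! _

  standards-sound : ∀ {i α} → α ∈ₗ standards i → StandardOfDegree i α
  standards-sound {i} α∈ = proj₂ (∈ₚ.∈-filter⁻ (standardOfDegree? i) {xs = box m i} (∈ₚ.∈-deduplicate⁻ _≟ₘ_ (filter (standardOfDegree? i) (box m i)) α∈))

  standards-complete : ∀ {i α} → StandardOfDegree i α → α ∈ₗ standards i
  standards-complete {i} {α} std = ∈ₚ.∈-deduplicate⁺ _≟ₘ_ (∈ₚ.∈-filter⁺ (standardOfDegree? i) (∈box i α (≤-reflexive (proj₂ std))) std)

  eval-linComb : ∀ φ {d} (cs : Vec ℚ d) (vs : Vec (Poly m) d) →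
                 eval φ (linComb cs vs) ≡ ∑ℚ (allFin d) (λ j → lookup cs j ℚ.* eval φ (lookup vs j))
  eval-linComb φ []       []       = refl
  eval-linComb φ (c ∷ cs) (v ∷ vs) = begin
    eval φ (scaleₚ c v ++ linComb cs vs)
      ≡⟨ eval-++ φ (scaleₚ c v) (linComb cs vs) ⟩
    eval φ (scaleₚ c v) ℚ.+ eval φ (linComb cs vs)
      ≡⟨ cong₂ ℚ._+_ (eval-scale φ c v) (eval-linComb φ cs vs) ⟩
    c ℚ.* eval φ v ℚ.+ ∑ℚ (allFin _) (λ j → lookup cs j ℚ.* eval φ (lookup vs j))
      ≡⟨ ⅀-allFin-suc (λ j → lookup (c ∷ cs) j ℚ.* eval φ (lookup (v ∷ vs) j)) ⟨
    ∑ℚ (allFin _) (λ j → lookup (c ∷ cs) j ℚ.* eval φ (lookup (v ∷ vs) j)) ∎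

  homogeneous-linComb : ∀ {i d} (cs : Vec ℚ d) (vs : Vec (Poly m) d) → (∀ j → Homogeneous i (lookup vs j)) → Homogeneous i (linComb cs vs)
  homogeneous-linComb []       []       h = []
  homogeneous-linComb (c ∷ cs) (v ∷ vs) h = Allₚ.++⁺ (Allₚ.map⁺ (h zero)) (homogeneous-linComb cs vs (h ∘ suc))

  module _ (i : ℕ) where

    s : ℕ
    s = length (standards i)

    u : Fin s → Mono m
    u = List.lookup (standards i)

    u-standard : ∀ k → StandardOfDegree i (u k)
    u-standard k = standards-sound (∈ₚ.∈-lookup {xs = standards i} k)

    -- The coordinate functional of the standard monomial `u k`, extended to all monomials so that
    -- it vanishes on the ideal.
    dual : Fin s → Mono m → ℚ
    dual k = NormalForm.φ jc ℚₚ.+-0-isAbelianGroup (δ (u k))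

    dual-ideal : ∀ k p → InIdeal gens p → eval (dual k) p ≡ 0ℚ
    dual-ideal k = Form.eval-φ-ideal (δ (u k))

    dual-standard : ∀ k q → All (λ t → StandardOfDegree i (proj₂ t)) q → eval (dual k) q ≡ eval (δ (u k)) q
    dual-standard k []            []          = refl
    dual-standard k ((c , α) ∷ q) (std ∷ stds) = cong₂ (λ x y → c ℚ.* x ℚ.+ y)
      (NormalForm.φ-standard jc ℚₚ.+-0-isAbelianGroup (δ (u k)) α (proj₁ std)) (dual-standard k q stds)

    dual-cong : ∀ k p q → InIdeal gens (p -ₚ q) → eval (dual k) p ≡ eval (dual k) q
    dual-cong k p q p-q = begin
      x                          ≡⟨ ℚₚ.+-identityʳ x ⟨
      x ℚ.+ 0ℚ                   ≡⟨ cong (x ℚ.+_) (ℚₚ.+-inverseˡ y) ⟨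
      x ℚ.+ (ℚ.- y ℚ.+ y)        ≡⟨ ℚₚ.+-assoc x _ y ⟨
      x ℚ.+ ℚ.- y ℚ.+ y          ≡⟨ cong (ℚ._+ y) (trans (cong (x ℚ.+_) (sym (-1*≡- y))) (trans (sym (eval-- (dual k) p q)) (dual-ideal k (p -ₚ q) p-q))) ⟩
      0ℚ ℚ.+ y                   ≡⟨ ℚₚ.+-identityˡ y ⟩
      y                          ∎
      where
      x y : ℚ
      x = eval (dual k) p
      y = eval (dual k) q

    absent : ∀ α q → ¬ (α ∈ₗ standards i) → All (λ t → StandardOfDegree i (proj₂ t)) q → coeff q α ≡ 0ℚ
    absent α q α∉ stds = trans (coeff≡eval q α) (go q stds)
      where
      go : ∀ q → All (λ t → StandardOfDegree i (proj₂ t)) q → eval (δ α) q ≡ 0ℚ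
      go []            []           = refl
      go ((c , γ) ∷ q) (std ∷ stds) = cong₂ ℚ._+_
        (trans (cong (c ℚ.*_) (δ-diff {α = α} (λ { refl → α∉ (standards-complete std) }))) (ℚₚ.*-zeroʳ c)) (go q stds)

    -- Modulo the ideal `p` is a combination of standard monomials, and the dual functionals read
    -- off its coefficients.
    in-ideal : ∀ p → Homogeneous i p → (∀ k → eval (dual k) p ≡ 0ℚ) → InIdeal gens p
    in-ideal p hom zeros with reduces-homogeneous i p hom
    ... | q , stds , p-q = ideal-≈ {p = p -ₚ q} {p} (λ φ → begin
        eval φ (p -ₚ q)                              ≡⟨ eval-- φ p q ⟩
        eval φ p ℚ.+ (ℚ.- 1ℚ) ℚ.* eval φ q           ≡⟨ cong (λ z → eval φ p ℚ.+ (ℚ.- 1ℚ) ℚ.* z) (≈⇒eval q [] φ q≈0) ⟩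
        eval φ p ℚ.+ (ℚ.- 1ℚ) ℚ.* 0ℚ                 ≡⟨ trans (cong (eval φ p ℚ.+_) (ℚₚ.*-zeroʳ (ℚ.- 1ℚ))) (ℚₚ.+-identityʳ _) ⟩
        eval φ p                                     ∎) p-q
      where
      q≈0 : q ≈ₚ []
      q≈0 α with Any.any? (α ≟ₘ_) (standards i)
      ... | no  α∉ = absent α q α∉ stds
      ... | yes α∈ = subst (λ α → coeff q α ≡ 0ℚ) (sym (Anyₚ.lookup-index α∈)) (begin
        coeff q (u k)            ≡⟨ coeff≡eval q (u k) ⟩
        eval (δ (u k)) q         ≡⟨ dual-standard k q stds ⟨
        eval (dual k) q          ≡⟨ dual-cong k p q p-q ⟨
        eval (dual k) p          ≡⟨ zeros k ⟩
        0ℚ                       ∎)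
        where
        k : Fin s
        k = Any.index α∈

    -- If `d > s`, some nontrivial combination of the basis is annihilated by all `s` dual
    -- functionals and so lies in the ideal.
    dimension-≤ : ∀ {d} → HasDim i d → d ≤ s
    dimension-≤ {d} (vs , hom , indep , _) with d ≤? s
    ... | yes d≤s = d≤s
    ... | no  d≰s with dependent (≰⇒> d≰s) (λ j k → eval (dual k) (lookup vs j))
    ...   | a , (j , aj≢0) , kernel = ⊥-elim (aj≢0 (trans (sym (Vecₚ.lookup∘tabulate a j)) (indep (tabulate a)
      (in-ideal (linComb (tabulate a) vs) (homogeneous-linComb (tabulate a) vs hom) λ k → begin
        eval (dual k) (linComb (tabulate a) vs)
          ≡⟨ eval-linComb (dual k) (tabulate a) vs ⟩
        ∑ℚ (allFin d) (λ j → lookup (tabulate a) j ℚ.* eval (dual k) (lookup vs j))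
          ≡⟨ ℚSum.⅀-cong (allFin d) (λ j → cong (ℚ._* eval (dual k) (lookup vs j)) (Vecₚ.lookup∘tabulate a j)) ⟩
        ∑ℚ (allFin d) (λ j → a j ℚ.* eval (dual k) (lookup vs j))
          ≡⟨ kernel k ⟩
        0ℚ ∎) j)))

    -- If `s > d`, the coordinate vectors of the `u k` are linearly dependent. The same dependence
    -- then holds between the classes of the `u k`, and the dual functionals show its coefficients
    -- to be zero.
    dimension-≥ : ∀ {d} → HasDim i d → s ≤ d
    dimension-≥ {d} (vs , hom , _ , spans) with s ≤? d
    ... | yes s≤d = s≤d
    ... | no  s≰d = ⊥-elim (independent (dependent (≰⇒> s≰d) (λ k j → lookup (proj₁ (span k)) j)))
      where
      span : ∀ k → ∃ λ (cs : Vec ℚ d) → InIdeal gens (mono (u k) -ₚ linComb cs vs)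
      span k = spans (mono (u k)) (proj₂ (u-standard k) ∷ [])
      C : Fin s → Fin d → ℚ
      C k j = lookup (proj₁ (span k)) j
      dual-u : ∀ l k → δ (u l) (u k) ≡ ∑ℚ (allFin d) (λ j → C k j ℚ.* eval (dual l) (lookup vs j))
      dual-u l k = begin
        δ (u l) (u k)                                    ≡⟨ NormalForm.φ-standard jc ℚₚ.+-0-isAbelianGroup (δ (u l)) (u k) (proj₁ (u-standard k)) ⟨
        dual l (u k)                                     ≡⟨ eval-mono (dual l) (u k) ⟨
        eval (dual l) (mono (u k))                       ≡⟨ dual-cong l (mono (u k)) (linComb (proj₁ (span k)) vs) (proj₂ (span k)) ⟩
        eval (dual l) (linComb (proj₁ (span k)) vs)      ≡⟨ eval-linComb (dual l) (proj₁ (span k)) vs ⟩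
        ∑ℚ (allFin d) (λ j → C k j ℚ.* eval (dual l) (lookup vs j)) ∎
      independent : ¬ (∃ λ (a : Fin s → ℚ) → (∃ λ k → a k ≢ 0ℚ) × (∀ j → ∑ℚ (allFin s) (λ k → a k ℚ.* C k j) ≡ 0ℚ))
      independent (a , (l , al≢0) , kernel) = al≢0 (begin
        a l
          ≡⟨ trans (ℚSum.⅀-single (λ k → a k ℚ.* δ (u l) (u k)) (Uniqueₚ.allFin⁺ s) (∈ₚ.∈-allFin l)
               (λ k k≢l → trans (cong (a k ℚ.*_) (δ-diff (λ e → k≢l (lookup-unique (standards-unique i) k l e)))) (ℚₚ.*-zeroʳ (a k))))
               (trans (cong (a l ℚ.*_) (δ-same (u l))) (ℚₚ.*-identityʳ (a l))) ⟨
        ∑ℚ (allFin s) (λ k → a k ℚ.* δ (u l) (u k))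
          ≡⟨ ℚSum.⅀-cong (allFin s) (λ k → trans (cong (a k ℚ.*_) (dual-u l k)) (sym (⅀-*ˡ (a k) (allFin d) _))) ⟩
        ∑ℚ (allFin s) (λ k → ∑ℚ (allFin d) (λ j → a k ℚ.* (C k j ℚ.* D j)))
          ≡⟨ ℚSum.⅀-swap (allFin s) (allFin d) (λ k j → a k ℚ.* (C k j ℚ.* D j)) ⟩
        ∑ℚ (allFin d) (λ j → ∑ℚ (allFin s) (λ k → a k ℚ.* (C k j ℚ.* D j)))
          ≡⟨ ℚSum.⅀-cong (allFin d) (λ j → begin
               ∑ℚ (allFin s) (λ k → a k ℚ.* (C k j ℚ.* D j))  ≡⟨ ℚSum.⅀-cong (allFin s) (λ k → trans (sym (ℚₚ.*-assoc (a k) (C k j) (D j))) (ℚₚ.*-comm _ (D j))) ⟩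
               ∑ℚ (allFin s) (λ k → D j ℚ.* (a k ℚ.* C k j))  ≡⟨ ⅀-*ˡ (D j) (allFin s) (λ k → a k ℚ.* C k j) ⟩
               D j ℚ.* ∑ℚ (allFin s) (λ k → a k ℚ.* C k j)    ≡⟨ cong (D j ℚ.*_) (kernel j) ⟩
               D j ℚ.* 0ℚ                                     ≡⟨ ℚₚ.*-zeroʳ (D j) ⟩
               0ℚ                                             ∎) ⟩
        ∑ℚ (allFin d) (λ _ → 0ℚ)
          ≡⟨ ℚSum.⅀-zero (allFin d) ⟩
        0ℚ ∎)
        where
        D : Fin d → ℚ
        D j = eval (dual l) (lookup vs j)

    dimension : ∀ {d} → HasDim i d → d ≡ s
    dimension hd = ≤-antisym (dimension-≤ hd) (dimension-≥ hd)

-- Building sets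

T⇒≡ : ∀ {b} → T b → b ≡ true
T⇒≡ {true} _ = refl

≡⇒T : ∀ {b} → b ≡ true → T b
≡⇒T refl = tt

anyᵇ⁻ : ∀ {A : Set} (p : A → Bool) xs → anyᵇ p xs ≡ true → ∃ λ x → x ∈ₗ xs × p x ≡ true
anyᵇ⁻ p (x ∷ xs) e with p x in px
... | true  = x , here refl , px
... | false with anyᵇ⁻ p xs e
...   | y , y∈ , py = y , there y∈ , py

anyᵇ⁺ : ∀ {A : Set} (p : A → Bool) {xs x} → x ∈ₗ xs → p x ≡ true → anyᵇ p xs ≡ true
anyᵇ⁺ p {x ∷ xs} (here refl) e rewrite e = refl
anyᵇ⁺ p {x ∷ xs} (there x∈)  e with p x
... | true  = refl
... | false = anyᵇ⁺ p x∈ e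

∈filterᵇ⁺ : ∀ {A : Set} (p : A → Bool) {xs x} → x ∈ₗ xs → p x ≡ true → x ∈ₗ filterᵇ p xs
∈filterᵇ⁺ p x∈ e = ∈ₚ.∈-filter⁺ (λ x → T? (p x)) x∈ (≡⇒T e)

∈filterᵇ⁻ : ∀ {A : Set} (p : A → Bool) xs {x} → x ∈ₗ filterᵇ p xs → x ∈ₗ xs × p x ≡ true
∈filterᵇ⁻ p xs x∈ = proj₁ (∈ₚ.∈-filter⁻ (λ x → T? (p x)) {xs = xs} x∈) , T⇒≡ (proj₂ (∈ₚ.∈-filter⁻ (λ x → T? (p x)) {xs = xs} x∈))

module _ {n : ℕ} (β : SetOfSubsets n) (F : Subset n) where

  larger : Subset n → Subset n → Bool
  larger H H' = β H' ∧ subₛ H' F ∧ subₛ H H' ∧ not (eqₛ H H')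

  maximal : Subset n → Bool
  maximal H = β H ∧ subₛ H F ∧ not (anyᵇ (larger H) (allSubsets n))

  ∈maxBelow⁻ : ∀ {H} → H ∈ₗ maxBelow β F →
               β H ≡ true × H ⊆ F × (∀ {H'} → β H' ≡ true → H' ⊆ F → H ⊆ H' → H ≡ H')
  ∈maxBelow⁻ {H} H∈ with ∧⁻ {β H} (proj₂ (∈filterᵇ⁻ maximal (allSubsets n) H∈))
  ... | βH , rest with ∧⁻ {subₛ H F} rest
  ...   | H⊆F , none = βH , subₛ⁻ H⊆F , λ {H'} βH' H'⊆F H⊆H' → case-≡ (H ≟ₛ H') βH' H'⊆F H⊆H'
    where
    case-≡ : ∀ {H'} → Dec (H ≡ H') → β H' ≡ true → H' ⊆ F → H ⊆ H' → H ≡ H'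
    case-≡ (yes e) _ _ _ = e
    case-≡ {H'} (no H≢H') βH' H'⊆F H⊆H' = ⊥-elim (not⁻ none (anyᵇ⁺ (larger H) (allSubsets-complete H')
      (∧⁺ βH' (∧⁺ (subₛ⁺ H'⊆F) (∧⁺ (subₛ⁺ H⊆H') (not⁺ (λ e → H≢H' (eqₛ⁻ e))))))))

  maxBelow-unique : Unique (maxBelow β F)
  maxBelow-unique = Uniqueₚ.filter⁺ (λ x → T? (maximal x)) (allSubsets-unique n)

  below-maximal : ∀ {A} → β A ≡ true → A ⊆ F → ∃ λ H → H ∈ₗ maxBelow β F × A ⊆ H
  below-maximal {A} = go (suc (n ∸ ∣ A ∣)) A ≤-refl
    where
    go : ∀ s A → n ∸ ∣ A ∣ < s → β A ≡ true → A ⊆ F → ∃ λ H → H ∈ₗ maxBelow β F × A ⊆ H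
    go (suc s) A lt βA A⊆F with anyᵇ (larger A) (allSubsets n) in eq
    ... | false = A , ∈filterᵇ⁺ maximal (allSubsets-complete A) (∧⁺ βA (∧⁺ (subₛ⁺ A⊆F) (cong not eq))) , ⊆-refl
    ... | true with anyᵇ⁻ (larger A) (allSubsets n) eq
    ...   | H , _ , e with ∧⁻ {β H} e
    ...     | βH , e₁ with ∧⁻ {subₛ H F} e₁
    ...       | H⊆F , e₂ with ∧⁻ {subₛ A H} e₂
    ...         | A⊆H , A≢H with go s H (<-≤-trans (∸-monoʳ-< (⊊⇒∣∣< (⊆∧≢⇒⊊ (subₛ⁻ A⊆H) (λ e → not⁻ A≢H (eqₛ⁺ e)))) (∣p∣≤n H)) (≤-pred lt)) βH (subₛ⁻ H⊆F)
    ...           | K , K∈ , H⊆K = K , K∈ , ⊆-trans (subₛ⁻ A⊆H) H⊆K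

extract : ∀ {A : Set} {xs : List A} {x} (f : A → ℕ) → x ∈ₗ xs →
          ∃ λ rest → sumℕ (map f xs) ≡ f x + sumℕ (map f rest) × (∀ {y} → y ∈ₗ xs → y ≢ x → y ∈ₗ rest)
extract {xs = x ∷ xs} f (here refl) = xs , refl , λ { (here refl) y≢x → ⊥-elim (y≢x refl) ; (there y∈) _ → y∈ }
extract {xs = z ∷ xs} {x} f (there x∈) with extract f x∈
... | rest , e , keep = z ∷ rest ,
  trans (cong (f z +_) e) (trans (sym (+-assoc (f z) _ _)) (trans (cong (_+ sumℕ (map f rest)) (+-comm (f z) (f x))) (+-assoc (f x) _ _))) ,
  λ { (here refl) _ → here refl ; (there y∈) y≢x → there (keep y∈ y≢x) }

module Modular {n : ℕ} (M : Matroid n) where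
  open Rank M
  open ≤-Reasoning

  -- The defect `r X + r Y - r (X ∪ Y)` does not grow when a set shrinks; submodularity is used once
  -- for each of the two sets.
  separate : ∀ {X Y X' Y'} → X' ⊆ X → Y' ⊆ Y → r X + r Y ≤ r (X ∪ Y) → r X' + r Y' ≤ r (X' ∪ Y')
  separate {X} {Y} {X'} {Y'} X'⊆X Y'⊆Y h = +-cancelʳ-≤ (r X + r Y) _ _ (begin
    r X' + r Y' + (r X + r Y)       ≤⟨ +-monoʳ-≤ (r X' + r Y') h ⟩
    r X' + r Y' + r (X ∪ Y)         ≡⟨ solve 3 (λ a b c → a :+ b :+ c := (c :+ a) :+ b) refl (r X') (r Y') (r (X ∪ Y)) ⟩
    r (X ∪ Y) + r X' + r Y'         ≤⟨ +-monoˡ-≤ (r Y') (submodular (X' ∪ Y) X (∪-lub ⊆∪ʳ (⊆-trans ⊆∪ʳ ⊆∪ˡ)) ⊆∪ˡ X'⊆X) ⟩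
    r (X' ∪ Y) + r X + r Y'         ≡⟨ solve 3 (λ a b c → a :+ b :+ c := (a :+ c) :+ b) refl (r (X' ∪ Y)) (r X) (r Y') ⟩
    r (X' ∪ Y) + r Y' + r X         ≤⟨ +-monoˡ-≤ (r X) (submodular (X' ∪ Y') Y (∪-lub (⊆-trans ⊆∪ˡ ⊆∪ˡ) ⊆∪ʳ) ⊆∪ʳ Y'⊆Y) ⟩
    r (X' ∪ Y') + r Y + r X         ≡⟨ solve 3 (λ a b c → a :+ b :+ c := a :+ (c :+ b)) refl (r (X' ∪ Y')) (r Y) (r X) ⟩
    r (X' ∪ Y') + (r X + r Y)       ∎)

  IsModular : List (Subset n) → Set
  IsModular Hs = sumℕ (map r Hs) ≤ r (⋃ Hs)

  r-⋃ : ∀ Hs → r (⋃ Hs) ≤ sumℕ (map r Hs)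
  r-⋃ []       = ≤-reflexive (rk-∅ M)
  r-⋃ (H ∷ Hs) = ≤-trans (subadditive H (⋃ Hs)) (+-monoʳ-≤ (r H) (r-⋃ Hs))

  modular-head : ∀ {H Hs} → IsModular (H ∷ Hs) → r H + r (⋃ Hs) ≤ r (H ∪ ⋃ Hs)
  modular-head {H} {Hs} mod = ≤-trans (+-monoʳ-≤ (r H) (r-⋃ Hs)) mod

  modular-tail : ∀ {H Hs} → IsModular (H ∷ Hs) → IsModular Hs
  modular-tail {H} {Hs} mod = +-cancelˡ-≤ (r H) _ _ (≤-trans mod (subadditive H (⋃ Hs)))

  modular-⊆ : ∀ (J : Subset n → Subset n) → (∀ H → J H ⊆ H) → ∀ Hs → IsModular Hs → IsModular (map J Hs)
  modular-⊆ J J⊆ []       mod = z≤n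
  modular-⊆ J J⊆ (H ∷ Hs) mod = ≤-trans (+-monoʳ-≤ (r (J H)) (modular-⊆ J J⊆ Hs (modular-tail {H} {Hs} mod)))
    (separate (J⊆ H) (⋃-least (map J Hs) below) (modular-head {H} {Hs} mod))
    where
    below : ∀ {A} → A ∈ₗ map J Hs → A ⊆ ⋃ Hs
    below A∈ with ∈ₚ.∈-map⁻ J A∈
    ... | K , K∈ , refl = ⊆-trans (J⊆ K) (⋃-upper K∈)

  modular-pair : ∀ {Hs H H'} → IsModular Hs → H ∈ₗ Hs → H' ∈ₗ Hs → H ≢ H' → r H + r H' ≤ r (H ∪ H')
  modular-pair {K ∷ Hs} mod (here refl) (here refl) ≢ = ⊥-elim (≢ refl)
  modular-pair {K ∷ Hs} mod (here refl) (there H'∈) ≢ = separate ⊆-refl (⋃-upper H'∈) (modular-head {K} {Hs} mod)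
  modular-pair {K ∷ Hs} {H} {H'} mod (there H∈)  (here refl) ≢ = begin
    r H + r K      ≡⟨ +-comm (r H) (r K) ⟩
    r K + r H      ≤⟨ separate ⊆-refl (⋃-upper H∈) (modular-head {K} {Hs} mod) ⟩
    r (K ∪ H)      ≤⟨ r-mono (∪-lub ⊆∪ʳ ⊆∪ˡ) ⟩
    r (H ∪ K)      ∎
  modular-pair {K ∷ Hs} mod (there H∈)  (there H'∈) ≢ = modular-pair {Hs} (modular-tail {K} {Hs} mod) H∈ H'∈ ≢

-- The source of `JoinClosed`, stated for members in place of indices. The base is `∅ₛ` for `𝒢`,
-- `𝒢'` and the restriction, and `G` for the contraction.
record Closed {n : ℕ} (M : Matroid n) (Z : Subset n) (β : SetOfSubsets n) : Set where
  field
    flat  : ∀ {A} → β A ≡ true → IsFlat M A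
    base  : ∀ {A} → β A ≡ true → Z ⊆ A
    joins : ∀ {A B C} → β A ≡ true → β B ≡ true → β C ≡ true → C ⊆ A → C ⊆ B → β (cl M (A ∪ B)) ≡ true

module BuildingSet {n : ℕ} {M : Matroid n} (loopless : Loopless M) {β : SetOfSubsets n} (bs : IsBuildingSet M β) where
  open IsBuildingSet bs
  open Rank M
  open Modular M
  open ≤-Reasoning

  rank-positive : ∀ {C} → β C ≡ true → 1 ≤ r C
  rank-positive {C} βC with 1 ≤? r C
  ... | yes p = p
  ... | no ¬p = ⊥-elim (proj₂ (flats C βC) (⊆-antisym (flat-absorbs loopless (begin
    r (∅ₛ ∪ C)  ≤⟨ r-mono (∪-lub ∅⊆ ⊆-refl) ⟩
    r C         ≤⟨ ≤-pred (≰⇒> ¬p) ⟩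
    0           ≤⟨ z≤n ⟩
    r ∅ₛ        ∎)) ∅⊆))

  joinTuple⊆ : ∀ {k X} → IsFlat M X → (t : Vec (Subset n) k) → (∀ j → lookup t j ⊆ X) → joinTuple M β t ⊆ X
  joinTuple⊆ flatX []      h = ∅⊆
  joinTuple⊆ flatX (A ∷ t) h = cl-least (∪-lub (h zero) (joinTuple⊆ flatX t (h ∘ suc))) flatX

  lookup∈ : ∀ (xs : List (Subset n)) j → lookup (Vec.fromList xs) j ∈ₗ xs
  lookup∈ (x ∷ xs) zero    = here refl
  lookup∈ (x ∷ xs) (suc j) = there (lookup∈ xs j)

  -- By surjectivity of the join map, `F` itself is a join of flats below its factors.
  maxBelow-spans : ∀ {F} → IsFlat M F → r F ≤ r (⋃ (maxBelow β F))
  maxBelow-spans {F} flatF with JoinMapIso.surj (iso F flatF) F flatF ⊆-refl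
  ... | t , valid , e = ≤-trans (r-mono (subst (_⊆ cl M (⋃ (maxBelow β F))) e
    (joinTuple⊆ (cl-flat (⋃ (maxBelow β F))) t λ j →
      ⊆-trans (proj₂ (valid j)) (⊆-trans (⋃-upper (lookup∈ (maxBelow β F) j)) ⊆cl)))) (r-cl _)

  maxBelow-modular : ∀ {F} → IsFlat M F → IsModular (maxBelow β F)
  maxBelow-modular {F} flatF = ≤-trans (≤-reflexive (sym (rank-sum F flatF))) (maxBelow-spans flatF)

  cl∪⊆ : ∀ {A B F} → IsFlat M F → A ⊆ F → B ⊆ F → cl M (A ∪ B) ⊆ F
  cl∪⊆ flatF A⊆F B⊆F = cl-least (∪-lub A⊆F B⊆F) flatF

  -- `A` and `B` lie below factors of their join. Distinct factors have additive ranks, which is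
  -- impossible when both contain `C`, of positive rank. Hence the factor is the same, and it is the
  -- whole join.
  join-closed : ∀ {A B C} → β A ≡ true → β B ≡ true → β C ≡ true → C ⊆ A → C ⊆ B → β (cl M (A ∪ B)) ≡ true
  join-closed {A} {B} {C} βA βB βC C⊆A C⊆B
    with below-maximal β (cl M (A ∪ B)) βA (⊆-trans ⊆∪ˡ ⊆cl) | below-maximal β (cl M (A ∪ B)) βB (⊆-trans ⊆∪ʳ ⊆cl)
  ... | H , H∈ , A⊆H | H' , H'∈ , B⊆H' with H ≟ₛ H' | ∈maxBelow⁻ β (cl M (A ∪ B)) H∈
  ...   | yes refl | βH , H⊆ , _ = subst (λ K → β K ≡ true) (⊆-antisym H⊆ (cl∪⊆ (proj₁ (flats H βH)) A⊆H B⊆H')) βH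
  ...   | no H≢H'  | _ = ⊥-elim (<⇒≱ (m<m+n (r C) (rank-positive βC)) (begin
    r C + r C    ≤⟨ separate (⊆-trans C⊆A A⊆H) (⊆-trans C⊆B B⊆H') (modular-pair (maxBelow-modular (cl-flat (A ∪ B))) H∈ H'∈ H≢H') ⟩
    r (C ∪ C)    ≤⟨ r-mono (∪-lub ⊆-refl ⊆-refl) ⟩
    r C          ∎))

  closed : Closed M ∅ₛ β
  closed = record { flat = λ βA → proj₁ (flats _ βA) ; base = λ _ → ∅⊆ ; joins = join-closed }

  -- If `A ∨ G` is not a member, the factors above `A` and above `G` are distinct. Their ranks add
  -- up to at most `r A + r G`, so they are `A` and `G` themselves.
  module Split {A G : Subset n} (βA : β A ≡ true) (βG : β G ≡ true) (¬join : ¬ (β (cl M (A ∪ G)) ≡ true)) where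
    private
      K = cl M (A ∪ G)
      HA = below-maximal β K βA (⊆-trans ⊆∪ˡ ⊆cl)
      HG = below-maximal β K βG (⊆-trans ⊆∪ʳ ⊆cl)
      H H' : Subset n
      H  = proj₁ HA
      H' = proj₁ HG
      H∈ = proj₁ (proj₂ HA)
      H'∈ = proj₁ (proj₂ HG)
      βH = proj₁ (∈maxBelow⁻ β K H∈)
      H⊆K = proj₁ (proj₂ (∈maxBelow⁻ β K H∈))
      H'⊆K = proj₁ (proj₂ (∈maxBelow⁻ β K H'∈))
      H≢H' : H ≢ H'
      H≢H' e = ¬join (subst (λ X → β X ≡ true)
        (⊆-antisym H⊆K (cl∪⊆ (proj₁ (flats _ βH)) (proj₂ (proj₂ HA)) (subst (G ⊆_) (sym e) (proj₂ (proj₂ HG))))) βH)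
      rank-HH' : r H + r H' ≤ r A + r G
      rank-HH' = begin
        r H + r H'   ≤⟨ modular-pair (maxBelow-modular (cl-flat (A ∪ G))) H∈ H'∈ H≢H' ⟩
        r (H ∪ H')   ≤⟨ r-mono (∪-lub H⊆K H'⊆K) ⟩
        r K          ≤⟨ r-cl _ ⟩
        r (A ∪ G)    ≤⟨ subadditive A G ⟩
        r A + r G    ∎
      flat-eq : ∀ {X Y} → IsFlat M X → X ⊆ Y → r Y ≤ r X → X ≡ Y
      flat-eq flatX X⊆Y le = ⊆-antisym X⊆Y (flat-absorbs flatX (≤-trans (r-mono (∪-lub X⊆Y ⊆-refl)) le))
      A≡H : A ≡ H
      A≡H = flat-eq (proj₁ (flats A βA)) (proj₂ (proj₂ HA)) (+-cancelʳ-≤ (r G) _ _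
        (≤-trans (+-monoʳ-≤ (r H) (r-mono (proj₂ (proj₂ HG)))) rank-HH'))
      G≡H' : G ≡ H'
      G≡H' = flat-eq (proj₁ (flats G βG)) (proj₂ (proj₂ HG)) (+-cancelˡ-≤ (r A) _ _
        (≤-trans (+-monoˡ-≤ (r H') (r-mono (proj₂ (proj₂ HA)))) rank-HH'))

    rank-split : r A + r G ≤ r (A ∪ G)
    rank-split = begin
      r A + r G    ≤⟨ +-mono-≤ (r-mono (proj₂ (proj₂ HA))) (r-mono (proj₂ (proj₂ HG))) ⟩
      r H + r H'   ≤⟨ modular-pair (maxBelow-modular (cl-flat (A ∪ G))) H∈ H'∈ H≢H' ⟩
      r (H ∪ H')   ≤⟨ r-mono (∪-lub H⊆K H'⊆K) ⟩
      r K          ≤⟨ r-cl _ ⟩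
      r (A ∪ G)    ∎

    -- A third factor would add a positive rank to a sum that has already reached `r A + r G`.
    below-split : ∀ {B} → β B ≡ true → B ⊆ K → B ⊆ A ⊎ B ⊆ G
    below-split {B} βB B⊆K with below-maximal β K βB B⊆K
    ... | H'' , H''∈ , B⊆H'' with H'' ≟ₛ H | H'' ≟ₛ H'
    ...   | yes refl | _        = inj₁ (subst (B ⊆_) (sym A≡H) B⊆H'')
    ...   | no _     | yes refl = inj₂ (subst (B ⊆_) (sym G≡H') B⊆H'')
    ...   | no H''≢H | no H''≢H' with extract r H∈
    ...     | rest , e , keep with extract r (keep H'∈ (H≢H' ∘ sym))
    ...       | rest' , e' , keep' with extract r (keep' (keep H''∈ H''≢H) H''≢H')
    ...         | rest'' , e'' , _ = ⊥-elim (<⇒≱ (rank-positive (proj₁ (∈maxBelow⁻ β K H''∈)))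
      (+-cancelˡ-≤ (r A + r G) _ _ (begin
        r A + r G + r H''                                   ≤⟨ +-monoˡ-≤ (r H'') (+-mono-≤ (r-mono (proj₂ (proj₂ HA))) (r-mono (proj₂ (proj₂ HG)))) ⟩
        r H + r H' + r H''                                  ≡⟨ +-assoc (r H) (r H') (r H'') ⟩
        r H + (r H' + r H'')                                ≤⟨ +-monoʳ-≤ (r H) (+-monoʳ-≤ (r H') (m≤m+n (r H'') (sumℕ (map r rest'')))) ⟩
        r H + (r H' + (r H'' + sumℕ (map r rest'')))        ≡⟨ cong (λ z → r H + (r H' + z)) e'' ⟨
        r H + (r H' + sumℕ (map r rest'))                   ≡⟨ cong (r H +_) e' ⟨
        r H + sumℕ (map r rest)                             ≡⟨ e ⟨
        sumℕ (map r (maxBelow β K))                         ≡⟨ rank-sum K (cl-flat (A ∪ G)) ⟨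
        r K                                                 ≤⟨ r-cl _ ⟩
        r (A ∪ G)                                           ≤⟨ subadditive A G ⟩
        r A + r G                                           ≡⟨ +-identityʳ _ ⟨
        r A + r G + 0                                       ∎)))

-- Counting in graded sets

-- A setoid, because exponent functions are compared pointwise. Validity is kept apart from the
-- carrier, so that comparing two points involves no proofs.
record GradedSet : Set₁ where
  field
    Car      : Set
    _≈_      : Car → Car → Set
    ≈-refl   : ∀ {x} → x ≈ x
    ≈-sym    : ∀ {x y} → x ≈ y → y ≈ x
    ≈-trans  : ∀ {x y z} → x ≈ y → y ≈ z → x ≈ z
    Valid    : Car → Set
    deg      : Car → ℕ
    deg-cong : ∀ {x y} → x ≈ y → deg x ≡ deg y

open GradedSet using (Car; Valid; deg; deg-cong)

record _≅_ (X Y : GradedSet) : Set where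
  open GradedSet X using () renaming (_≈_ to _≈₁_)
  open GradedSet Y using () renaming (_≈_ to _≈₂_)
  field
    to         : Car X → Car Y
    from       : Car Y → Car X
    to-valid   : ∀ {x} → Valid X x → Valid Y (to x)
    from-valid : ∀ {y} → Valid Y y → Valid X (from y)
    to-cong    : ∀ {x x'} → x ≈₁ x' → to x ≈₂ to x'
    from-cong  : ∀ {y y'} → y ≈₂ y' → from y ≈₁ from y'
    to-from    : ∀ {y} → Valid Y y → to (from y) ≈₂ y
    from-to    : ∀ {x} → Valid X x → from (to x) ≈₁ x
    to-deg     : ∀ {x} → Valid X x → deg Y (to x) ≡ deg X x

open _≅_

≅-sym : ∀ {X Y} → X ≅ Y → Y ≅ X
≅-sym {X} {Y} i = record
  { to = from i ; from = to i ; to-valid = from-valid i ; from-valid = to-valid i ; to-cong = from-cong i ; from-cong = to-cong i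
  ; to-from = from-to i ; from-to = to-from i
  ; to-deg = λ v → trans (sym (to-deg i (from-valid i v))) (deg-cong Y (to-from i v)) }

≅-trans : ∀ {X Y Z} → X ≅ Y → Y ≅ Z → X ≅ Z
≅-trans {X} {Y} {Z} i j = record
  { to = to j ∘ to i ; from = from i ∘ from j ; to-valid = to-valid j ∘ to-valid i ; from-valid = from-valid i ∘ from-valid j
  ; to-cong = to-cong j ∘ to-cong i ; from-cong = from-cong i ∘ from-cong j
  ; to-from = λ v → GradedSet.≈-trans Z (to-cong j (to-from i (from-valid j v))) (to-from j v)
  ; from-to = λ v → GradedSet.≈-trans X (from-cong i (from-to j (to-valid i v))) (from-to i v)
  ; to-deg = λ v → trans (to-deg j (to-valid i v)) (to-deg i v) }

infixr 1 _⊞_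
_⊞_ : GradedSet → GradedSet → GradedSet
X ⊞ Y = record
  { Car = Car X ⊎ Car Y ; _≈_ = Pointwise X._≈_ Y._≈_ ; ≈-refl = ⊎-refl X.≈-refl Y.≈-refl ; ≈-sym = ⊎-symmetric X.≈-sym Y.≈-sym
  ; ≈-trans = ⊎-transitive X.≈-trans Y.≈-trans ; Valid = [ Valid X , Valid Y ]′ ; deg = [ deg X , deg Y ]′
  ; deg-cong = λ { (inj₁ e) → X.deg-cong e ; (inj₂ e) → Y.deg-cong e } }
  where
  module X = GradedSet X
  module Y = GradedSet Y

infixr 2 _⊠_
_⊠_ : GradedSet → GradedSet → GradedSet
X ⊠ Y = record
  { Car = Car X × Car Y ; _≈_ = λ (x , y) (x' , y') → x X.≈ x' × y Y.≈ y'
  ; ≈-refl = X.≈-refl , Y.≈-refl ; ≈-sym = λ (p , q) → X.≈-sym p , Y.≈-sym q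
  ; ≈-trans = λ (p , q) (p' , q') → X.≈-trans p p' , Y.≈-trans q q'
  ; Valid = λ (x , y) → Valid X x × Valid Y y ; deg = λ (x , y) → deg X x + deg Y y
  ; deg-cong = λ (p , q) → cong₂ _+_ (X.deg-cong p) (Y.deg-cong q) }
  where
  module X = GradedSet X
  module Y = GradedSet Y

infix 3 _∣_
_∣_ : (X : GradedSet) → (Car X → Set) → GradedSet
X ∣ P = record
  { Car = Car X ; _≈_ = X._≈_ ; ≈-refl = X.≈-refl ; ≈-sym = X.≈-sym ; ≈-trans = X.≈-trans
  ; Valid = λ x → Valid X x × P x ; deg = deg X ; deg-cong = X.deg-cong }
  where module X = GradedSet X

∣-cong : ∀ {X Y P Q} (i : X ≅ Y) → (∀ {x} → Valid X x → P x → Q (to i x)) → (∀ {y} → Valid Y y → Q y → P (from i y)) →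
         (X ∣ P) ≅ (Y ∣ Q)
∣-cong i f g = record
  { to = to i ; from = from i ; to-valid = λ (v , p) → to-valid i v , f v p ; from-valid = λ (v , q) → from-valid i v , g v q
  ; to-cong = to-cong i ; from-cong = from-cong i ; to-from = to-from i ∘ proj₁ ; from-to = from-to i ∘ proj₁ ; to-deg = to-deg i ∘ proj₁ }

∣-⇔ : ∀ {X} {P Q : Car X → Set} → (∀ {x} → Valid X x → P x → Q x) → (∀ {x} → Valid X x → Q x → P x) → (X ∣ P) ≅ (X ∣ Q)
∣-⇔ {X} f g = record
  { to = id ; from = id ; to-valid = λ (v , p) → v , f v p ; from-valid = λ (v , q) → v , g v q ; to-cong = id ; from-cong = id
  ; to-from = λ _ → GradedSet.≈-refl X ; from-to = λ _ → GradedSet.≈-refl X ; to-deg = λ _ → refl }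

∣∣-⇔ : ∀ {X} {P P' Q : Car X → Set} → (∀ {x} → Valid X x → P x → P' x → Q x) → (∀ {x} → Valid X x → Q x → P x × P' x) →
       ((X ∣ P) ∣ P') ≅ (X ∣ Q)
∣∣-⇔ {X} f g = record
  { to = id ; from = id ; to-valid = λ ((v , p) , p') → v , f v p p'
  ; from-valid = λ (v , q) → (v , proj₁ (g v q)) , proj₂ (g v q) ; to-cong = id ; from-cong = id
  ; to-from = λ _ → GradedSet.≈-refl X ; from-to = λ _ → GradedSet.≈-refl X ; to-deg = λ _ → refl }

split : ∀ X {P : Car X → Set} (P? : ∀ x → Dec (P x)) → (∀ {x y} → GradedSet._≈_ X x y → P x → P y) →
        X ≅ ((X ∣ P) ⊞ (X ∣ (¬_ ∘ P)))
split X {P} P? resp = record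
  { to = t ; from = [ id , id ]′ ; to-valid = λ {x} → tv x ; from-valid = λ {y} → fv y ; to-cong = λ {x} {y} → tc x y
  ; from-cong = λ { (inj₁ e) → e ; (inj₂ e) → e } ; to-from = λ {y} → tf y ; from-to = λ {x} _ → ft x ; to-deg = λ {x} _ → td x }
  where
  module X = GradedSet X
  Y = (X ∣ P) ⊞ (X ∣ (¬_ ∘ P))
  module Y = GradedSet Y
  t : Car X → Car X ⊎ Car X
  t x with P? x
  ... | yes _ = inj₁ x
  ... | no  _ = inj₂ x
  tv : ∀ x → Valid X x → Valid Y (t x)
  tv x v with P? x
  ... | yes p = v , p
  ... | no ¬p = v , ¬p
  fv : ∀ y → Valid Y y → Valid X ([ id , id ]′ y)
  fv (inj₁ x) (v , _) = v
  fv (inj₂ x) (v , _) = v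
  tc : ∀ x y → x X.≈ y → t x Y.≈ t y
  tc x y e with P? x | P? y
  ... | yes _ | yes _ = inj₁ e
  ... | yes p | no ¬q = ⊥-elim (¬q (resp e p))
  ... | no ¬p | yes q = ⊥-elim (¬p (resp (X.≈-sym e) q))
  ... | no _  | no _  = inj₂ e
  tf : ∀ y → Valid Y y → t ([ id , id ]′ y) Y.≈ y
  tf (inj₁ x) (_ , p) with P? x
  ... | yes _ = inj₁ X.≈-refl
  ... | no ¬p = ⊥-elim (¬p p)
  tf (inj₂ x) (_ , ¬p) with P? x
  ... | yes p = ⊥-elim (¬p p)
  ... | no _  = inj₂ X.≈-refl
  ft : ∀ x → [ id , id ]′ (t x) X.≈ x
  ft x with P? x
  ... | yes _ = X.≈-refl
  ... | no  _ = X.≈-refl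
  td : ∀ x → deg Y (t x) ≡ deg X x
  td x with P? x
  ... | yes _ = refl
  ... | no  _ = refl

⊞-cong : ∀ {X X' Y Y'} → X ≅ X' → Y ≅ Y' → (X ⊞ Y) ≅ (X' ⊞ Y')
⊞-cong {X} {X'} {Y} {Y'} i j = record
  { to = λ { (inj₁ x) → inj₁ (to i x) ; (inj₂ y) → inj₂ (to j y) }
  ; from = λ { (inj₁ x) → inj₁ (from i x) ; (inj₂ y) → inj₂ (from j y) }
  ; to-valid = λ { {inj₁ x} v → to-valid i v ; {inj₂ y} v → to-valid j v }
  ; from-valid = λ { {inj₁ x} v → from-valid i v ; {inj₂ y} v → from-valid j v }
  ; to-cong = λ { (inj₁ e) → inj₁ (to-cong i e) ; (inj₂ e) → inj₂ (to-cong j e) }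
  ; from-cong = λ { (inj₁ e) → inj₁ (from-cong i e) ; (inj₂ e) → inj₂ (from-cong j e) }
  ; to-from = λ { {inj₁ x} v → inj₁ (to-from i v) ; {inj₂ y} v → inj₂ (to-from j v) }
  ; from-to = λ { {inj₁ x} v → inj₁ (from-to i v) ; {inj₂ y} v → inj₂ (from-to j v) }
  ; to-deg = λ { {inj₁ x} v → to-deg i v ; {inj₂ y} v → to-deg j v } }

⊞-assoc : ∀ {X Y Z} → (X ⊞ (Y ⊞ Z)) ≅ ((X ⊞ Y) ⊞ Z)
⊞-assoc {X} {Y} {Z} = record
  { to = λ { (inj₁ x) → inj₁ (inj₁ x) ; (inj₂ (inj₁ y)) → inj₁ (inj₂ y) ; (inj₂ (inj₂ z)) → inj₂ z }
  ; from = λ { (inj₁ (inj₁ x)) → inj₁ x ; (inj₁ (inj₂ y)) → inj₂ (inj₁ y) ; (inj₂ z) → inj₂ (inj₂ z) }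
  ; to-valid = λ { {inj₁ x} v → v ; {inj₂ (inj₁ y)} v → v ; {inj₂ (inj₂ z)} v → v }
  ; from-valid = λ { {inj₁ (inj₁ x)} v → v ; {inj₁ (inj₂ y)} v → v ; {inj₂ z} v → v }
  ; to-cong = λ { (inj₁ e) → inj₁ (inj₁ e) ; (inj₂ (inj₁ e)) → inj₁ (inj₂ e) ; (inj₂ (inj₂ e)) → inj₂ e }
  ; from-cong = λ { (inj₁ (inj₁ e)) → inj₁ e ; (inj₁ (inj₂ e)) → inj₂ (inj₁ e) ; (inj₂ e) → inj₂ (inj₂ e) }
  ; to-from = λ { {inj₁ (inj₁ x)} _ → L.≈-refl ; {inj₁ (inj₂ y)} _ → L.≈-refl ; {inj₂ z} _ → L.≈-refl }
  ; from-to = λ { {inj₁ x} _ → R.≈-refl ; {inj₂ (inj₁ y)} _ → R.≈-refl ; {inj₂ (inj₂ z)} _ → R.≈-refl }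
  ; to-deg = λ { {inj₁ x} v → refl ; {inj₂ (inj₁ y)} v → refl ; {inj₂ (inj₂ z)} v → refl } }
  where
  module L = GradedSet ((X ⊞ Y) ⊞ Z)
  module R = GradedSet (X ⊞ (Y ⊞ Z))

record Enum {A : Set} (_≈_ : A → A → Set) (P : A → Set) (d : ℕ) : Set where
  field
    enum     : Fin d → A
    sound    : ∀ k → P (enum k)
    distinct : ∀ k l → enum k ≈ enum l → k ≡ l
    complete : ∀ {x} → P x → ∃ λ k → x ≈ enum k

open Enum

Counts : GradedSet → ℕ → ℕ → Set
Counts X i d = Enum (GradedSet._≈_ X) (λ x → Valid X x × deg X x ≡ i) d

counts-≤ : ∀ {X i d e} → Counts X i d → Counts X i e → d ≤ e
counts-≤ {X} {i} {d} {e} E F = Finₚ.injective⇒≤ {f = λ k → proj₁ (complete F (sound E k))} λ {k} {l} eq →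
  distinct E k l (X.≈-trans (proj₂ (complete F (sound E k)))
    (subst (λ z → enum F z X.≈ enum E l) (sym eq) (X.≈-sym (proj₂ (complete F (sound E l))))))
  where module X = GradedSet X

counts-unique : ∀ {X i d e} → Counts X i d → Counts X i e → d ≡ e
counts-unique {X} E F = ≤-antisym (counts-≤ {X} E F) (counts-≤ {X} F E)

enum-⇔ : ∀ {A : Set} {_≈_ : A → A → Set} {P Q : A → Set} {d} → (∀ {x} → P x → Q x) → (∀ {x} → Q x → P x) → Enum _≈_ P d → Enum _≈_ Q d
enum-⇔ f g E = record { enum = enum E ; sound = f ∘ sound E ; distinct = distinct E ; complete = complete E ∘ g }

counts-≅ : ∀ {X Y i d} → X ≅ Y → Counts X i d → Counts Y i d
counts-≅ {X} {Y} {i} {d} iso E = record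
  { enum = to iso ∘ enum E
  ; sound = λ k → to-valid iso (proj₁ (sound E k)) , trans (to-deg iso (proj₁ (sound E k))) (proj₂ (sound E k))
  ; distinct = λ k l e → distinct E k l (X.≈-trans (X.≈-sym (from-to iso (proj₁ (sound E k))))
      (X.≈-trans (from-cong iso e) (from-to iso (proj₁ (sound E l)))))
  ; complete = λ {y} (v , dy) →
      let (k , e) = complete E (from-valid iso v , trans (to-deg (≅-sym iso) v) dy)
      in k , Y.≈-trans (Y.≈-sym (to-from iso v)) (to-cong iso e) }
  where
  module X = GradedSet X
  module Y = GradedSet Y

enum-∪ : ∀ {A : Set} {_≈_ : A → A → Set} {P Q : A → Set} {d e} → Enum _≈_ P d → Enum _≈_ Q e →
         (∀ {x y} → P x → Q y → x ≈ y → ⊥) → (∀ {x y} → P x → Q y → y ≈ x → ⊥) → Enum _≈_ (λ x → P x ⊎ Q x) (d + e)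
enum-∪ {A} {_≈_} {P} {Q} {d} {e} E F dis dis' = record
  { enum = [ enum E , enum F ]′ ∘ Fin.splitAt d
  ; sound = λ k → snd (Fin.splitAt d k)
  ; distinct = λ k l eq → trans (sym (Finₚ.join-splitAt d e k)) (trans (cong (Fin.join d e) (inj (Fin.splitAt d k) (Fin.splitAt d l) eq)) (Finₚ.join-splitAt d e l))
  ; complete = λ { (inj₁ p) → let (k , q) = complete E p in
                     Fin.join d e (inj₁ k) , subst (λ z → _ ≈ [ enum E , enum F ]′ z) (sym (Finₚ.splitAt-join d e (inj₁ k))) q
                 ; (inj₂ p) → let (k , q) = complete F p in
                     Fin.join d e (inj₂ k) , subst (λ z → _ ≈ [ enum E , enum F ]′ z) (sym (Finₚ.splitAt-join d e (inj₂ k))) q } }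
  where
  snd : ∀ s → P ([ enum E , enum F ]′ s) ⊎ Q ([ enum E , enum F ]′ s)
  snd (inj₁ k) = inj₁ (sound E k)
  snd (inj₂ k) = inj₂ (sound F k)
  inj : ∀ s t → [ enum E , enum F ]′ s ≈ [ enum E , enum F ]′ t → s ≡ t
  inj (inj₁ k) (inj₁ l) eq = cong inj₁ (distinct E k l eq)
  inj (inj₁ k) (inj₂ l) eq = ⊥-elim (dis (sound E k) (sound F l) eq)
  inj (inj₂ k) (inj₁ l) eq = ⊥-elim (dis' (sound E l) (sound F k) eq)
  inj (inj₂ k) (inj₂ l) eq = cong inj₂ (distinct F k l eq)

counts-⊞ : ∀ {X Y i d e} → Counts X i d → Counts Y i e → Counts (X ⊞ Y) i (d + e)
counts-⊞ {X} {Y} {i} {d} {e} E F = enum-⇔ (λ {x} → join {x}) (λ {x} → unjoin {x})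
  (enum-∪ left right (λ { _ () (inj₁ _) ; () _ (inj₂ _) }) (λ { _ () (inj₁ _) ; () _ (inj₂ _) }))
  where
  module XY = GradedSet (X ⊞ Y)
  P Q : Car X ⊎ Car Y → Set
  P = [ (λ x → Valid X x × deg X x ≡ i) , (λ _ → ⊥) ]′
  Q = [ (λ _ → ⊥) , (λ y → Valid Y y × deg Y y ≡ i) ]′
  left : Enum XY._≈_ P d
  left = record { enum = inj₁ ∘ enum E ; sound = sound E ; distinct = λ { k l (inj₁ e) → distinct E k l e }
    ; complete = λ { {inj₁ x} p → let (k , e) = complete E p in k , inj₁ e } }
  right : Enum XY._≈_ Q e
  right = record { enum = inj₂ ∘ enum F ; sound = sound F ; distinct = λ { k l (inj₂ e) → distinct F k l e }
    ; complete = λ { {inj₂ y} q → let (k , e) = complete F q in k , inj₂ e } }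
  join : ∀ {x} → P x ⊎ Q x → Valid (X ⊞ Y) x × deg (X ⊞ Y) x ≡ i
  join {inj₁ x} (inj₁ p) = p
  join {inj₂ y} (inj₂ q) = q
  unjoin : ∀ {x} → Valid (X ⊞ Y) x × deg (X ⊞ Y) x ≡ i → P x ⊎ Q x
  unjoin {inj₁ x} p = inj₁ p
  unjoin {inj₂ y} q = inj₂ q

counts-⊠ : ∀ {X Y p q} → (∀ i → Counts X i (p i)) → (∀ i → Counts Y i (q i)) → ∀ i → Counts (X ⊠ Y) i (conv p q i)
counts-⊠ {X} {Y} {p} {q} E F i = enum-⇔ assemble disassemble (upTo i)
  where
  module X = GradedSet X
  module Y = GradedSet Y
  module XY = GradedSet (X ⊠ Y)
  At : ℕ → Car X × Car Y → Set
  At a (x , y) = (Valid X x × deg X x ≡ a) × (Valid Y y × deg Y y ≡ i ∸ a)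
  UpTo : ℕ → Car X × Car Y → Set
  UpTo a (x , y) = (Valid X x × deg X x ≤ a) × (Valid Y y × deg Y y ≡ i ∸ deg X x)
  at : ∀ a → Enum XY._≈_ (At a) (p a * q (i ∸ a))
  at a = record
    { enum = λ k → enum (E a) (proj₁ (rq k)) , enum (F (i ∸ a)) (proj₂ (rq k))
    ; sound = λ k → sound (E a) (proj₁ (rq k)) , sound (F (i ∸ a)) (proj₂ (rq k))
    ; distinct = λ k l (e , e') → trans (sym (Finₚ.combine-remQuot {p a} (q (i ∸ a)) k)) (trans
        (cong₂ Fin.combine (distinct (E a) _ _ e) (distinct (F (i ∸ a)) _ _ e')) (Finₚ.combine-remQuot {p a} (q (i ∸ a)) l))
    ; complete = λ {(x , y)} (vx , vy) → let (k , e) = complete (E a) vx ; (l , e') = complete (F (i ∸ a)) vy in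
        Fin.combine k l ,
        subst (λ z → x X.≈ enum (E a) (proj₁ z) × y Y.≈ enum (F (i ∸ a)) (proj₂ z)) (sym (Finₚ.remQuot-combine k l)) (e , e') }
    where
    rq : Fin (p a * q (i ∸ a)) → Fin (p a) × Fin (q (i ∸ a))
    rq = Fin.remQuot {p a} (q (i ∸ a))
  upTo : ∀ a → Enum XY._≈_ (UpTo a) (sumTo (λ a → p a * q (i ∸ a)) a)
  upTo zero = enum-⇔ (λ ((vx , dx) , (vy , dy)) → (vx , ≤-reflexive dx) , (vy , trans dy (cong (i ∸_) (sym dx))))
                     (λ ((vx , dx) , (vy , dy)) → (vx , n≤0⇒n≡0 dx) , (vy , trans dy (cong (i ∸_) (n≤0⇒n≡0 dx)))) (at 0)
  upTo (suc a) = enum-⇔ f g (enum-∪ (upTo a) (at (suc a))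
      (λ ((_ , le) , _) ((_ , eq) , _) (e , _) → <⇒≱ ≤-refl (subst (_≤ a) (trans (X.deg-cong e) eq) le))
      (λ ((_ , le) , _) ((_ , eq) , _) (e , _) → <⇒≱ ≤-refl (subst (_≤ a) (trans (sym (X.deg-cong e)) eq) le)))
    where
    f : ∀ {xy} → UpTo a xy ⊎ At (suc a) xy → UpTo (suc a) xy
    f (inj₁ ((vx , dx) , y)) = (vx , m≤n⇒m≤1+n dx) , y
    f (inj₂ ((vx , dx) , (vy , dy))) = (vx , ≤-reflexive dx) , (vy , trans dy (cong (i ∸_) (sym dx)))
    g : ∀ {xy} → UpTo (suc a) xy → UpTo a xy ⊎ At (suc a) xy
    g {x , y} ((vx , dx) , (vy , dy)) with deg X x ℕ.≟ suc a
    ... | yes e = inj₂ ((vx , e) , (vy , trans dy (cong (i ∸_) e)))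
    ... | no ¬e = inj₁ ((vx , ≤-pred (≤∧≢⇒< dx ¬e)) , (vy , dy))
  assemble : ∀ {xy} → UpTo i xy → Valid (X ⊠ Y) xy × deg (X ⊠ Y) xy ≡ i
  assemble {x , y} ((vx , dx) , (vy , dy)) = (vx , vy) , trans (cong (deg X x +_) dy) (m+[n∸m]≡n dx)
  disassemble : ∀ {xy} → Valid (X ⊠ Y) xy × deg (X ⊠ Y) xy ≡ i → UpTo i xy
  disassemble {x , y} ((vx , vy) , e) = (vx , subst (deg X x ≤_) e (m≤m+n _ _)) ,
    (vy , trans (sym (m+n∸m≡n (deg X x) (deg Y y))) (cong (_∸ deg X x) e))

-- The exponents occurring in x + x² + ⋯ + x^{k-1}.
Exponents : ℕ → GradedSet
Exponents k = record
  { Car = ℕ ; _≈_ = _≡_ ; ≈-refl = refl ; ≈-sym = sym ; ≈-trans = trans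
  ; Valid = λ j → 1 ≤ j × j < k ; deg = id ; deg-cong = id }

counts-Exponents : ∀ k i → Counts (Exponents k) i (geomCoeff k i)
counts-Exponents k i with 1 ≤? i | suc i ≤? k
... | yes 1≤i | yes i<k = record { enum = λ _ → i ; sound = λ _ → (1≤i , i<k) , refl ; distinct = λ { zero zero _ → refl } ; complete = λ (_ , e) → zero , e }
... | yes _   | no i≮k  = record { enum = λ () ; sound = λ () ; distinct = λ () ; complete = λ { ((_ , lt) , refl) → contradiction lt i≮k } }
... | no 1≰i  | _       = record { enum = λ () ; sound = λ () ; distinct = λ () ; complete = λ { ((le , _) , refl) → contradiction le 1≰i } }

-- Standard monomials as functions on subsets

module ℕSum = Summation +-0-isCommutativeMonoid
open ℕSum using () renaming (⅀ to ∑ℕ)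

module _ {n : ℕ} where

  private
    supported-below? : ∀ (f : Subset n → ℕ) b c → Dec (1 ≤ f c × c ⊊ b)
    supported-below? f b c = (1 ≤? f c) ×-dec (c ⊊? b)

  abstract
    -- The counterpart of `U` for functions on all subsets. The four rings have variables indexed by
    -- different finite sets, so their monomials are compared as functions on subsets, extended by
    -- 0.
    V : Subset n → (Subset n → ℕ) → Subset n → Subset n
    V Z f b = unionOver Z id (allSubsets n) (supported-below? f b)

    ∈V : ∀ {Z f b} c → 1 ≤ f c → c ⊊ b → c ⊆ V Z f b
    ∈V {Z} {f} {b} c p q = ⊆unionOver (supported-below? f b) {Z = Z} {B = id} {xs = allSubsets n} (allSubsets-complete c) (p , q)

    V-least : ∀ {Z f b C} → Z ⊆ C → (∀ c → 1 ≤ f c → c ⊊ b → c ⊆ C) → V Z f b ⊆ C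
    V-least {Z} {f} {b} Z⊆ h = unionOver⊆ (supported-below? f b) {B = id} {xs = allSubsets n} Z⊆ (λ c _ (p , q) → h c p q)

    Z⊆V : ∀ {Z f b} → Z ⊆ V Z f b
    Z⊆V {Z} {f} {b} = base⊆unionOver (supported-below? f b) {B = id} {xs = allSubsets n}

  V-mono : ∀ {Z f g b} → (∀ c → c ⊊ b → 1 ≤ f c → 1 ≤ g c) → V Z f b ⊆ V Z g b
  V-mono h = V-least Z⊆V (λ c p q → ∈V c (h c q p) q)

  V-cong : ∀ {Z f g b} → (∀ c → c ⊊ b → f c ≡ g c) → V Z f b ≡ V Z g b
  V-cong h = ⊆-antisym (V-mono (λ c q → subst (1 ≤_) (h c q))) (V-mono (λ c q → subst (1 ≤_) (sym (h c q))))

  V⊆ : ∀ {Z f b} → Z ⊆ b → V Z f b ⊆ b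
  V⊆ Z⊆b = V-least Z⊆b (λ _ _ → proj₁)

Functions : ∀ {n} → ((Subset n → ℕ) → Set) → GradedSet
Functions {n} P = record
  { Car = Subset n → ℕ ; _≈_ = _≗_ ; ≈-refl = λ _ → refl ; ≈-sym = λ e A → sym (e A) ; ≈-trans = λ e e' A → trans (e A) (e' A)
  ; Valid = P ; deg = ∑ℕ (allSubsets n) ; deg-cong = ℕSum.⅀-cong (allSubsets n) }

-- The exponent functions of the standard monomials.
StandardFunctions : ∀ {n} → Matroid n → Subset n → SetOfSubsets n → GradedSet
StandardFunctions M Z β = Functions λ f →
  (∀ A → ¬ (β A ≡ true) → f A ≡ 0) × (∀ A → β A ≡ true → f A + rk M (V Z f A) < rk M A)

sum≡∑ : ∀ {m} (α : Mono m) → Vec.sum α ≡ ∑ℕ (allFin m) (lookup α)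
sum≡∑ []            = refl
sum≡∑ {suc m} (x ∷ α) = cong (x +_) (trans (sum≡∑ α) (trans (sym (ℕSum.⅀-map suc (allFin m) (lookup (x ∷ α))))
  (cong (λ xs → ∑ℕ xs (lookup (x ∷ α))) (Listₚ.map-tabulate id suc))))

lookup-fromList : ∀ {A : Set} (xs : List A) j → lookup (Vec.fromList xs) j ≡ List.lookup xs j
lookup-fromList (x ∷ xs) zero    = refl
lookup-fromList (x ∷ xs) (suc j) = lookup-fromList xs j

module _ {n : ℕ} {M : Matroid n} {Z : Subset n} {β : SetOfSubsets n} (closed : Closed M Z β) where
  open Closed closed
  open Chow M Z β
  open Reduction M Z B[_]
  open Rank M

  B-β : ∀ j → β B[ j ] ≡ true
  B-β j = proj₂ (∈filterᵇ⁻ β (allSubsets n) (subst (_∈ₗ elemList) (sym (lookup-fromList elemList j)) (∈ₚ.∈-lookup {xs = elemList} j)))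

  B-injective : ∀ {i j} → B[ i ] ≡ B[ j ] → i ≡ j
  B-injective {i} {j} e = lookup-unique (Uniqueₚ.filter⁺ (λ x → T? (β x)) (allSubsets-unique n)) i j
    (trans (sym (lookup-fromList elemList i)) (trans e (lookup-fromList elemList j)))

  B-surjective : ∀ {A} → β A ≡ true → ∃ λ j → B[ j ] ≡ A
  B-surjective {A} βA = Any.index A∈ , trans (lookup-fromList elemList _) (sym (Anyₚ.lookup-index A∈))
    where
    A∈ : A ∈ₗ elemList
    A∈ = ∈filterᵇ⁺ β (allSubsets-complete A) βA

  joinClosed : JoinClosed M Z B[_]
  joinClosed = record
    { above-base = λ i → base (B-β i)
    ; injective  = λ i⊆j j⊆i → B-injective (⊆-antisym i⊆j j⊆i)
    ; join = λ a b c c⊆a c⊆b → let (e , eq) = B-surjective (joins (B-β a) (B-β b) (B-β c) c⊆a c⊆b) in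
        e , subst (B[ a ] ⊆_) (sym eq) (⊆-trans ⊆∪ˡ ⊆cl) , subst (B[ b ] ⊆_) (sym eq) (⊆-trans ⊆∪ʳ ⊆cl)
          , ≤-trans (≤-reflexive (cong r eq)) (r-cl _)
          , λ x a⊆x b⊆x → subst (_⊆ B[ x ]) (sym eq) (cl-least (∪-lub a⊆x b⊆x) (flat (B-β x))) }

  open ChowDimension M Z β joinClosed
  open ChowBasis M Z β joinClosed using (StandardOfDegree)

  exponents : Mono m → Subset n → ℕ
  exponents α A = ∑ℕ (allFin m) (λ j → when 0 (B[ j ] ≟ₛ A) (lookup α j))

  exponents-B : ∀ α j → exponents α B[ j ] ≡ lookup α j
  exponents-B α j = trans
    (ℕSum.⅀-single (λ i → when 0 (B[ i ] ≟ₛ B[ j ]) (lookup α i)) (Uniqueₚ.allFin⁺ m) (∈ₚ.∈-allFin j)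
      (λ i i≢j → when-no (B[ i ] ≟ₛ B[ j ]) (λ e → i≢j (B-injective e))))
    (when-yes (B[ j ] ≟ₛ B[ j ]) refl)

  exponents-off : ∀ α A → ¬ (β A ≡ true) → exponents α A ≡ 0
  exponents-off α A ¬βA = trans (ℕSum.⅀-cong (allFin m) (λ j → when-no (B[ j ] ≟ₛ A) (λ e → ¬βA (subst (λ X → β X ≡ true) e (B-β j)))))
    (ℕSum.⅀-zero (allFin m))

  deg-exponents : ∀ α → ∑ℕ (allSubsets n) (exponents α) ≡ Vec.sum α
  deg-exponents α = begin
    ∑ℕ (allSubsets n) (λ A → ∑ℕ (allFin m) (λ j → when 0 (B[ j ] ≟ₛ A) (lookup α j)))
      ≡⟨ ℕSum.⅀-swap (allSubsets n) (allFin m) (λ A j → when 0 (B[ j ] ≟ₛ A) (lookup α j)) ⟩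
    ∑ℕ (allFin m) (λ j → ∑ℕ (allSubsets n) (λ A → when 0 (B[ j ] ≟ₛ A) (lookup α j)))
      ≡⟨ ℕSum.⅀-cong (allFin m) (λ j → trans
           (ℕSum.⅀-single (λ A → when 0 (B[ j ] ≟ₛ A) (lookup α j)) (allSubsets-unique n) (allSubsets-complete B[ j ])
             (λ A A≢ → when-no (B[ j ] ≟ₛ A) (A≢ ∘ sym)))
           (when-yes (B[ j ] ≟ₛ B[ j ]) refl)) ⟩
    ∑ℕ (allFin m) (lookup α)
      ≡⟨ sum≡∑ α ⟨
    Vec.sum α ∎
    where open ≡-Reasoning

  rank-U≡V : ∀ α j → r (U α j) ≡ r (V Z (exponents α) B[ j ])
  rank-U≡V α j = cong r (⊆-antisym
    (U-least Z⊆V (λ c p q → ∈V B[ c ] (subst (1 ≤_) (sym (exponents-B α c)) p) q))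
    (V-least Z⊆U covered))
    where
    covered : ∀ c → 1 ≤ exponents α c → c ⊊ B[ j ] → c ⊆ U α j
    covered c p q with β c in eq
    ... | false = contradiction (subst (1 ≤_) (exponents-off α c (λ e → contradiction (trans (sym e) eq) λ ())) p) λ ()
    ... | true with B-surjective eq
    ...   | i , refl = ∈U i (subst (1 ≤_) (exponents-B α i) p) q

  standard⇔ : ∀ α j → (¬ Member α j (lookup α j) → exponents α B[ j ] + r (V Z (exponents α) B[ j ]) < r B[ j ])
                    × (exponents α B[ j ] + r (V Z (exponents α) B[ j ]) < r B[ j ] → ¬ Member α j (lookup α j))
  standard⇔ α j rewrite exponents-B α j | sym (rank-U≡V α j) = ≰⇒> , <⇒≱

  Standard⇒Valid : ∀ {α} → Standard α → Valid (StandardFunctions M Z β) (exponents α)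
  Standard⇒Valid {α} std = exponents-off α , bound
    where
    bound : ∀ A → β A ≡ true → exponents α A + r (V Z (exponents α) A) < r A
    bound A βA with B-surjective βA
    ... | j , refl = proj₁ (standard⇔ α j) (std j)

  restriction : (Subset n → ℕ) → Mono m
  restriction f = tabulate (λ j → f B[ j ])

  exponents-restriction : ∀ {f} → (∀ A → ¬ (β A ≡ true) → f A ≡ 0) → exponents (restriction f) ≗ f
  exponents-restriction {f} off A with β A in eq
  ... | false = trans (exponents-off (restriction f) A ¬β) (sym (off A ¬β))
    where
    ¬β : ¬ (β A ≡ true)
    ¬β e = contradiction (trans (sym e) eq) λ ()
  ... | true with B-surjective eq
  ...   | j , refl = trans (exponents-B (restriction f) j) (Vecₚ.lookup∘tabulate (λ j → f B[ j ]) j)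

  Valid⇒Standard : ∀ {f} → Valid (StandardFunctions M Z β) f → Standard (restriction f)
  Valid⇒Standard {f} (off , bound) j = proj₂ (standard⇔ (restriction f) j)
    (subst₂ (λ x W → x + r W < r B[ j ]) (sym (e B[ j ])) (V-cong (λ c _ → sym (e c))) (bound B[ j ] (B-β j)))
    where
    e : exponents (restriction f) ≗ f
    e = exponents-restriction off

  counts-standards : ∀ i → Counts (StandardFunctions M Z β) i (length (standards i))
  counts-standards i = record
    { enum     = λ k → exponents (u i k)
    ; sound    = λ k → Standard⇒Valid (proj₁ (u-standard i k)) , trans (deg-exponents (u i k)) (proj₂ (u-standard i k))
    ; distinct = λ k l e → lookup-unique (standards-unique i) k l (lookup-ext (λ j →
        trans (sym (exponents-B (u i k) j)) (trans (e B[ j ]) (exponents-B (u i l) j))))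
    ; complete = λ {f} (v , d) → let e = exponents-restriction (proj₁ v) ; α∈ = standards-complete (Valid⇒Standard v , degree f v d) in
        Any.index α∈ , λ A → trans (sym (e A)) (cong (λ α → exponents α A) (Anyₚ.lookup-index α∈)) }
    where
    degree : ∀ f → Valid (StandardFunctions M Z β) f → ∑ℕ (allSubsets n) f ≡ i → Vec.sum (restriction f) ≡ i
    degree f v d = trans (sym (deg-exponents (restriction f)))
      (trans (ℕSum.⅀-cong (allSubsets n) (exponents-restriction (proj₁ v))) d)

  counts-HasDim : ∀ {i d} → HasDim i d → Counts (StandardFunctions M Z β) i d
  counts-HasDim {i} hd = subst (Counts (StandardFunctions M Z β) i) (sym (dimension i hd)) (counts-standards i)

-- Removing G from the building set

∑-positive : ∀ {I : Set} (xs : List I) f → 1 ≤ ∑ℕ xs f → ∃ λ x → 1 ≤ f x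
∑-positive (x ∷ xs) f p with 1 ≤? f x
... | yes q = x , q
... | no ¬q = ∑-positive xs f (subst (λ z → 1 ≤ z + ∑ℕ xs f) (n≤0⇒n≡0 (≤-pred (≰⇒> ¬q))) p)

when-positive : ∀ {P : Set} (d : Dec P) {a} → 1 ≤ when 0 d a → P × 1 ≤ a
when-positive (yes p) q = p , q

zero-or-positive : ∀ a → a ≡ 0 ⊎ 1 ≤ a
zero-or-positive zero    = inj₁ refl
zero-or-positive (suc a) = inj₂ (s≤s z≤n)

Naturals : GradedSet
Naturals = record
  { Car = ℕ ; _≈_ = _≡_ ; ≈-refl = refl ; ≈-sym = sym ; ≈-trans = trans ; Valid = λ _ → ⊤ ; deg = id ; deg-cong = id }

module Deletion {n : ℕ} {M : Matroid n} (loopless : Loopless M) {𝒢 : SetOfSubsets n} (bs : IsBuildingSet M 𝒢)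
  {G : Subset n} (𝒢G : 𝒢 G ≡ true) (bs' : IsBuildingSet M (removeB 𝒢 G)) where
  open Rank M
  open Modular M using (separate)
  open BuildingSet loopless bs using (module Split)

  𝒢' ℛ 𝒞 : SetOfSubsets n
  𝒢' = removeB 𝒢 G
  ℛ = restrictB 𝒢' G
  𝒞 = contractB M 𝒢' G

  closed𝒢 : Closed M ∅ₛ 𝒢
  closed𝒢 = BuildingSet.closed loopless bs

  closed𝒢' : Closed M ∅ₛ 𝒢'
  closed𝒢' = BuildingSet.closed loopless bs'

  open Closed closed𝒢 using (flat; joins)

  𝒢'⁺ : ∀ {A} → 𝒢 A ≡ true → A ≢ G → 𝒢' A ≡ true
  𝒢'⁺ 𝒢A A≢G = ∧⁺ 𝒢A (not⁺ (A≢G ∘ eqₛ⁻))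

  𝒢'⁻ : ∀ {A} → 𝒢' A ≡ true → 𝒢 A ≡ true × A ≢ G
  𝒢'⁻ {A} e = proj₁ (∧⁻ e) , λ A≡G → not⁻ (proj₂ (∧⁻ {𝒢 A} e)) (eqₛ⁺ A≡G)

  ℛ⁺ : ∀ {A} → 𝒢' A ≡ true → A ⊆ G → ℛ A ≡ true
  ℛ⁺ 𝒢'A A⊆G = ∧⁺ 𝒢'A (subₛ⁺ A⊆G)

  ℛ⁻ : ∀ {A} → ℛ A ≡ true → 𝒢' A ≡ true × A ⊆ G
  ℛ⁻ {A} e = proj₁ (∧⁻ e) , subₛ⁻ (proj₂ (∧⁻ {𝒢' A} e))

  _∨G : Subset n → Subset n
  A ∨G = cl M (A ∪ G)

  𝒞⁺ : ∀ {H} → 𝒢' H ≡ true → ¬ (H ⊆ G) → 𝒞 (H ∨G) ≡ true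
  𝒞⁺ {H} 𝒢'H H⊈G = anyᵇ⁺ (λ H' → 𝒢' H' ∧ not (subₛ H' G) ∧ eqₛ (H ∨G) (H' ∨G)) (allSubsets-complete H)
    (∧⁺ 𝒢'H (∧⁺ (not⁺ (λ e → H⊈G (subₛ⁻ e))) (eqₛ⁺ refl)))

  𝒞⁻ : ∀ {K} → 𝒞 K ≡ true → ∃ λ H → 𝒢' H ≡ true × ¬ (H ⊆ G) × K ≡ H ∨G
  𝒞⁻ {K} e with anyᵇ⁻ (λ H' → 𝒢' H' ∧ not (subₛ H' G) ∧ eqₛ K (H' ∨G)) (allSubsets n) e
  ... | H , _ , p with ∧⁻ {𝒢' H} p
  ...   | 𝒢'H , q with ∧⁻ {not (subₛ H G)} q
  ...     | H⊈G , K≡ = H , 𝒢'H , (λ H⊆G → not⁻ H⊈G (subₛ⁺ H⊆G)) , eqₛ⁻ K≡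

  G⊆∨G : ∀ {A} → G ⊆ A ∨G
  G⊆∨G = ⊆-trans ⊆∪ʳ ⊆cl

  ⊆∨G : ∀ {A} → A ⊆ A ∨G
  ⊆∨G = ⊆-trans ⊆∪ˡ ⊆cl

  ∨G-flat : ∀ {A} → IsFlat M (A ∨G)
  ∨G-flat {A} = cl-flat (A ∪ G)

  ∨G-least : ∀ {A F} → A ⊆ F → G ⊆ F → IsFlat M F → A ∨G ⊆ F
  ∨G-least A⊆F G⊆F = cl-least (∪-lub A⊆F G⊆F)

  ∨G-absorb : ∀ {A} → IsFlat M A → G ⊆ A → A ∨G ≡ A
  ∨G-absorb flatA G⊆A = ⊆-antisym (∨G-least ⊆-refl G⊆A flatA) ⊆∨G

  closedℛ : Closed M ∅ₛ ℛ
  closedℛ = record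
    { flat  = λ e → flat (proj₁ (𝒢'⁻ (proj₁ (ℛ⁻ e))))
    ; base  = λ _ → ∅⊆
    ; joins = λ a b c c⊆a c⊆b → ℛ⁺ (Closed.joins closed𝒢' (proj₁ (ℛ⁻ a)) (proj₁ (ℛ⁻ b)) (proj₁ (ℛ⁻ c)) c⊆a c⊆b)
        (cl-least (∪-lub (proj₂ (ℛ⁻ a)) (proj₂ (ℛ⁻ b))) (flat 𝒢G)) }

  closed𝒞 : Closed M G 𝒞
  closed𝒞 = record { flat = flat𝒞 ; base = base𝒞 ; joins = joins𝒞 }
    where
    flat𝒞 : ∀ {A} → 𝒞 A ≡ true → IsFlat M A
    flat𝒞 e with 𝒞⁻ e
    ... | _ , _ , _ , refl = ∨G-flat
    base𝒞 : ∀ {A} → 𝒞 A ≡ true → G ⊆ A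
    base𝒞 e with 𝒞⁻ e
    ... | _ , _ , _ , refl = G⊆∨G
    -- A representative of `A` modulo `G` that also contains `H`: if `A` is a member of `𝒢`, it is
    -- `A` itself. Otherwise any generator will do, since `H` lies below it or below `G`, and the
    -- latter is excluded.
    generator : ∀ {A H} → 𝒞 A ≡ true → 𝒢 H ≡ true → ¬ (H ⊆ G) → H ⊆ A →
                ∃ λ P → 𝒢 P ≡ true × P ⊆ A × A ⊆ P ∨G × H ⊆ P
    generator {A} {H} 𝒞A 𝒢H H⊈G H⊆A with 𝒢 A in eq | 𝒞⁻ 𝒞A
    ... | true  | _ = A , eq , ⊆-refl , ⊆∨G , H⊆A
    ... | false | P , 𝒢'P , P⊈G , refl
      with Split.below-split (proj₁ (𝒢'⁻ 𝒢'P)) 𝒢G (λ e → contradiction (trans (sym e) eq) λ ()) 𝒢H H⊆A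
    ...   | inj₁ H⊆P = P , proj₁ (𝒢'⁻ 𝒢'P) , ⊆∨G , ⊆-refl , H⊆P
    ...   | inj₂ H⊆G = ⊥-elim (H⊈G H⊆G)
    -- The chosen representatives of `A` and `B` both contain the generator `H` of `C`, so their
    -- join is in `𝒢`; modulo `G` it becomes the join of `A` and `B`.
    joins𝒞 : ∀ {A B C} → 𝒞 A ≡ true → 𝒞 B ≡ true → 𝒞 C ≡ true → C ⊆ A → C ⊆ B → 𝒞 (cl M (A ∪ B)) ≡ true
    joins𝒞 {A} {B} 𝒞A 𝒞B 𝒞C C⊆A C⊆B with 𝒞⁻ 𝒞C
    ... | H , 𝒢'H , H⊈G , refl
      with generator 𝒞A (proj₁ (𝒢'⁻ 𝒢'H)) H⊈G (⊆-trans ⊆∨G C⊆A) | generator 𝒞B (proj₁ (𝒢'⁻ 𝒢'H)) H⊈G (⊆-trans ⊆∨G C⊆B)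
    ...   | P , 𝒢P , P⊆A , A⊆P∨G , H⊆P | Q , 𝒢Q , Q⊆B , B⊆Q∨G , H⊆Q = subst (λ K → 𝒞 K ≡ true) same
      (𝒞⁺ (𝒢'⁺ (joins 𝒢P 𝒢Q (proj₁ (𝒢'⁻ 𝒢'H)) H⊆P H⊆Q) (λ e → X⊈G (subst (_⊆ G) (sym e) ⊆-refl))) X⊈G)
      where
      X : Subset n
      X = cl M (P ∪ Q)
      X⊈G : ¬ (X ⊆ G)
      X⊈G X⊆G = H⊈G (⊆-trans H⊆P (⊆-trans ⊆∪ˡ (⊆-trans ⊆cl X⊆G)))
      same : X ∨G ≡ cl M (A ∪ B)
      same = ⊆-antisym
        (∨G-least (cl-least (∪-lub (⊆-trans P⊆A (⊆-trans ⊆∪ˡ ⊆cl)) (⊆-trans Q⊆B (⊆-trans ⊆∪ʳ ⊆cl))) (cl-flat (A ∪ B)))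
          (⊆-trans (base𝒞 𝒞A) (⊆-trans ⊆∪ˡ ⊆cl)) (cl-flat (A ∪ B)))
        (cl-least (∪-lub (⊆-trans A⊆P∨G (∨G-least (⊆-trans ⊆∪ˡ (⊆-trans ⊆cl ⊆∨G)) G⊆∨G ∨G-flat))
                         (⊆-trans B⊆Q∨G (∨G-least (⊆-trans ⊆∪ʳ (⊆-trans ⊆cl ⊆∨G)) G⊆∨G ∨G-flat))) ∨G-flat)

  -- The elements not below G that form a nested set together with G; A ↦ A ∨ G identifies them with 𝒢'/G.
  Compatible : Subset n → Set
  Compatible A = 𝒢 A ≡ true × ¬ (A ⊆ G) × (G ⊆ A ⊎ ¬ (𝒢 (A ∨G) ≡ true))

  compatible? : ∀ A → Dec (Compatible A)
  compatible? A = (𝒢 A BoolP.≟ true) ×-dec ¬? (A ⊆? G) ×-dec ((G ⊆? A) ⊎-dec ¬? (𝒢 (A ∨G) BoolP.≟ true))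

  compatible-⊆ : ∀ {A B} → Compatible A → Compatible B → A ∨G ≡ B ∨G → B ⊆ A
  compatible-⊆ {A} {B} (𝒢A , A⊈G , inj₁ G⊆A) _ e = ⊆-trans ⊆∨G (subst (B ∨G ⊆_) (trans (sym e) (∨G-absorb (flat 𝒢A) G⊆A)) ⊆-refl)
  compatible-⊆ {A} {B} (𝒢A , A⊈G , inj₂ ¬𝒢) (𝒢B , B⊈G , _) e
    with Split.below-split 𝒢A 𝒢G ¬𝒢 𝒢B (subst (B ⊆_) (sym e) ⊆∨G)
  ... | inj₁ B⊆A = B⊆A
  ... | inj₂ B⊆G = ⊥-elim (B⊈G B⊆G)

  compatible-unique : ∀ {A B} → Compatible A → Compatible B → A ∨G ≡ B ∨G → A ≡ B
  compatible-unique cA cB e = ⊆-antisym (compatible-⊆ cB cA (sym e)) (compatible-⊆ cA cB e)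

  -- If `K` belongs to `𝒢`, it represents itself as a flat above `G`. If not, any generator is
  -- compatible by the second alternative.
  compatible-exists : ∀ {K} → 𝒞 K ≡ true → ∃ λ A → Compatible A × A ∨G ≡ K
  compatible-exists {K} 𝒞K with 𝒢 K in eq | 𝒞⁻ 𝒞K
  ... | true  | H , 𝒢'H , H⊈G , refl = K , (eq , (λ K⊆G → H⊈G (⊆-trans ⊆∨G K⊆G)) , inj₁ G⊆∨G) , ∨G-absorb ∨G-flat G⊆∨G
  ... | false | H , 𝒢'H , H⊈G , refl = H , (proj₁ (𝒢'⁻ 𝒢'H) , H⊈G , inj₂ (λ e → contradiction (trans (sym e) eq) λ ())) , refl

  compatible-𝒢' : ∀ {A} → Compatible A → 𝒢' A ≡ true
  compatible-𝒢' (𝒢A , A⊈G , _) = 𝒢'⁺ 𝒢A (λ { refl → A⊈G ⊆-refl })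

  compatible-𝒞 : ∀ {A} → Compatible A → 𝒞 (A ∨G) ≡ true
  compatible-𝒞 c = 𝒞⁺ (compatible-𝒢' c) (proj₁ (proj₂ c))

  ℛ? : ∀ A → Dec (ℛ A ≡ true)
  ℛ? A = ℛ A BoolP.≟ true

  data Position (A : Subset n) : Set where
    at-G       : A ≡ G → Position A
    below-G    : ℛ A ≡ true → Position A
    compatible : Compatible A → Position A
    elsewhere  : A ≢ G → ¬ (ℛ A ≡ true) → ¬ Compatible A → Position A

  position : ∀ A → Position A
  position A = decide (A ≟ₛ G) (ℛ? A) (compatible? A)
    where
    decide : Dec (A ≡ G) → Dec (ℛ A ≡ true) → Dec (Compatible A) → Position A
    decide (yes e) _       _       = at-G e
    decide (no _)  (yes e) _       = below-G e
    decide (no _)  (no _)  (yes c) = compatible c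
    decide (no ¬e) (no ¬r) (no ¬c) = elsewhere ¬e ¬r ¬c

  ¬compatible-⊆G : ∀ {A} → A ⊆ G → ¬ Compatible A
  ¬compatible-⊆G A⊆G (_ , A⊈G , _) = A⊈G A⊆G

  ¬ℛG : ¬ (ℛ G ≡ true)
  ¬ℛG e = proj₂ (𝒢'⁻ (proj₁ (ℛ⁻ e))) refl

  -- At most one of the three conditions holds. The sum form, in place of a case distinction, makes
  -- degrees split by distributivity.
  pieces : ℕ → ℕ → ℕ → Subset n → ℕ
  pieces x y z A = when 0 (A ≟ₛ G) x + (when 0 (ℛ? A) y + when 0 (compatible? A) z)

  pieces-G : ∀ {x y z} → pieces x y z G ≡ x
  pieces-G {x} = trans (cong₂ _+_ (when-yes (G ≟ₛ G) refl)
    (cong₂ _+_ (when-no (ℛ? G) ¬ℛG) (when-no (compatible? G) (¬compatible-⊆G ⊆-refl)))) (+-identityʳ x)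

  pieces-ℛ : ∀ {x y z A} → ℛ A ≡ true → pieces x y z A ≡ y
  pieces-ℛ {y = y} {A = A} e = trans (cong₂ _+_ (when-no (A ≟ₛ G) (λ { refl → ¬ℛG e }))
    (cong₂ _+_ (when-yes (ℛ? A) e) (when-no (compatible? A) (¬compatible-⊆G (proj₂ (ℛ⁻ e)))))) (+-identityʳ y)

  pieces-compatible : ∀ {x y z A} → Compatible A → pieces x y z A ≡ z
  pieces-compatible {A = A} c = cong₂ _+_ (when-no (A ≟ₛ G) (λ { refl → ¬compatible-⊆G ⊆-refl c }))
    (cong₂ _+_ (when-no (ℛ? A) (λ e → ¬compatible-⊆G (proj₂ (ℛ⁻ e)) c)) (when-yes (compatible? A) c))

  pieces-elsewhere : ∀ {x y z A} → A ≢ G → ¬ (ℛ A ≡ true) → ¬ Compatible A → pieces x y z A ≡ 0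
  pieces-elsewhere {A = A} ≢G ¬r ¬c = cong₂ _+_ (when-no (A ≟ₛ G) ≢G) (cong₂ _+_ (when-no (ℛ? A) ¬r) (when-no (compatible? A) ¬c))

-- Splitting an exponent function at `G`

module Decomposition {n : ℕ} {M : Matroid n} (loopless : Loopless M) {𝒢 : SetOfSubsets n} (bs : IsBuildingSet M 𝒢)
  {G : Subset n} (𝒢G : 𝒢 G ≡ true) (bs' : IsBuildingSet M (removeB 𝒢 G)) where
  open Rank M
  open Modular M using (separate)
  open Deletion loopless bs 𝒢G bs'
  open BuildingSet loopless bs using (module Split)
  open Closed closed𝒢 using (flat)

  Spanning : (Subset n → ℕ) → Set
  Spanning f = r G ≤ r (V ∅ₛ f G)

  -- F G > 0 or the support of F below G has join G; the bound on F G is left open.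
  Around : GradedSet
  Around = Functions λ F →
    (∀ A → ¬ (𝒢 A ≡ true) → F A ≡ 0) × (∀ A → 𝒢' A ≡ true → F A + r (V ∅ₛ F A) < r A) × (1 ≤ F G ⊎ Spanning F)

  StdR StdC Triples : GradedSet
  StdR = StandardFunctions M ∅ₛ ℛ
  StdC = StandardFunctions M G 𝒞
  Triples = Naturals ⊠ StdR ⊠ StdC

  module _ (F : Subset n → ℕ) where

    lower : Subset n → ℕ
    lower A = when 0 (ℛ? A) (F A)

    fibre? : ∀ K A → Dec (Compatible A × A ∨G ≡ K)
    fibre? K A = compatible? A ×-dec ((A ∨G) ≟ₛ K)

    -- Transport along `A ↦ A ∨ G`. By `compatible-unique` at most one compatible `A` contributes to
    -- each `K`.
    upper : Subset n → ℕ
    upper K = ∑ℕ (allSubsets n) (λ A → when 0 (fibre? K A) (F A))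

    upper-∨G : ∀ {A} → Compatible A → upper (A ∨G) ≡ F A
    upper-∨G {A} c = trans
      (ℕSum.⅀-single (λ B → when 0 (fibre? (A ∨G) B) (F B)) (allSubsets-unique n) (allSubsets-complete A)
        (λ B B≢A → when-no (fibre? (A ∨G) B) (λ (cB , e) → B≢A (compatible-unique cB c e))))
      (when-yes (fibre? (A ∨G) A) (c , refl))

    upper-off : ∀ K → ¬ (𝒞 K ≡ true) → upper K ≡ 0
    upper-off K ¬𝒞K = trans
      (ℕSum.⅀-cong (allSubsets n) (λ B → when-no (fibre? K B) (λ (cB , e) → ¬𝒞K (subst (λ X → 𝒞 X ≡ true) e (compatible-𝒞 cB)))))
      (ℕSum.⅀-zero (allSubsets n))

    upper-positive : ∀ {K} → 1 ≤ upper K → ∃ λ A → Compatible A × A ∨G ≡ K × 1 ≤ F A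
    upper-positive {K} p with ∑-positive (allSubsets n) (λ B → when 0 (fibre? K B) (F B)) p
    ... | A , q with when-positive (fibre? K A) q
    ...   | (c , e) , FA = A , c , e , FA

    deg-upper : ∑ℕ (allSubsets n) upper ≡ ∑ℕ (allSubsets n) (λ A → when 0 (compatible? A) (F A))
    deg-upper = trans (ℕSum.⅀-swap (allSubsets n) (allSubsets n) (λ K A → when 0 (fibre? K A) (F A)))
      (ℕSum.⅀-cong (allSubsets n) (λ A → trans
        (ℕSum.⅀-single (λ K → when 0 (fibre? K A) (F A)) (allSubsets-unique n) (allSubsets-complete (A ∨G))
          (λ K K≢ → when-no (fibre? K A) (λ (_ , e) → K≢ (sym e))))
        (when-⇔ (fibre? (A ∨G) A) (compatible? A) proj₁ (_, refl))))

  assemble : ℕ → (Subset n → ℕ) → (Subset n → ℕ) → Subset n → ℕ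
  assemble j f g A = pieces j (f A) (g (A ∨G)) A

  module Restrict {F : Subset n → ℕ} (valid : Valid Around F) where
    private
      off = proj₁ valid
      bound = proj₁ (proj₂ valid)
      spans = proj₂ (proj₂ valid)

    lower-agrees : ∀ A → A ⊊ G → lower F A ≡ F A
    lower-agrees A (A⊆G , G⊈A) with ℛ? A
    ... | yes _ = refl
    ... | no ¬r = sym (off A (λ 𝒢A → ¬r (ℛ⁺ (𝒢'⁺ 𝒢A (λ { refl → G⊈A ⊆-refl })) A⊆G)))

    V-lower : ∀ {A} → A ⊆ G → V ∅ₛ (lower F) A ≡ V ∅ₛ F A
    V-lower A⊆G = V-cong (λ c c⊊A → lower-agrees c (⊊-⊆-trans c⊊A A⊆G))

    -- The purpose of the last clause of `Around`: seen from any flat above `G`, the support spans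
    -- `G`, whether or not `G` belongs to it.
    G⊆clV : ∀ {A} → G ⊊ A → G ⊆ cl M (V ∅ₛ F A)
    G⊆clV {A} G⊊A with spans
    ... | inj₁ FG = ⊆-trans (∈V G FG G⊊A) ⊆cl
    ... | inj₂ sp = ⊆-trans (⊆cl-rank (V⊆ ∅⊆) sp) (cl-mono (V-least Z⊆V (λ c p c⊊G → ∈V c p (⊊-⊆-trans c⊊G (proj₁ G⊊A)))))

    -- If `A` failed to be compatible, `A ∨ G` would be a member strictly above both `A` and `G`.
    -- The support below it would span both and hence `A ∨ G`, against the bound there.
    positive-compatible : ∀ {A} → 𝒢 A ≡ true → ¬ (A ⊆ G) → 1 ≤ F A → Compatible A
    positive-compatible {A} 𝒢A A⊈G FA with G ⊆? A | 𝒢 (A ∨G) BoolP.≟ true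
    ... | yes G⊆A | _      = 𝒢A , A⊈G , inj₁ G⊆A
    ... | no _    | no ¬𝒢K = 𝒢A , A⊈G , inj₂ ¬𝒢K
    ... | no G⊈A  | yes 𝒢K = ⊥-elim (<⇒≱ (bound (A ∨G) (𝒢'⁺ 𝒢K (λ e → A⊈G (subst (A ⊆_) e ⊆∨G)))) (begin
      r (A ∨G)                                  ≤⟨ r-mono (∨G-least (⊆-trans (∈V A FA (⊆∨G , λ K⊆A → G⊈A (⊆-trans G⊆∨G K⊆A))) ⊆cl)
                                                      (G⊆clV (G⊆∨G , λ K⊆G → A⊈G (⊆-trans ⊆∨G K⊆G))) (cl-flat (V ∅ₛ F (A ∨G)))) ⟩
      r (cl M (V ∅ₛ F (A ∨G)))                  ≤⟨ r-cl _ ⟩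
      r (V ∅ₛ F (A ∨G))                         ≤⟨ m≤n+m _ (F (A ∨G)) ⟩
      F (A ∨G) + r (V ∅ₛ F (A ∨G))              ∎))
      where open ≤-Reasoning

    lower-valid : Valid StdR (lower F)
    lower-valid = (λ A ¬r → when-no (ℛ? A) ¬r) , λ A ℛA →
      subst₂ (λ x W → x + r W < r A) (sym (when-yes (ℛ? A) ℛA)) (sym (V-lower (proj₂ (ℛ⁻ ℛA)))) (bound A (proj₁ (ℛ⁻ ℛA)))

    -- If `G ⊆ A`, then `A ∨ G` is `A`, and passing to closures changes no rank. Otherwise ranks add
    -- over `A` and `G`, and the compatible flats below `A ∨ G` lie below `A`; the bound at `A`,
    -- with `r G` added on both sides, gives the one at `A ∨ G`.
    upper-bound : ∀ {A} → Compatible A → upper F (A ∨G) + r (V G (upper F) (A ∨G)) < r (A ∨G)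
    upper-bound {A} c rewrite upper-∨G F c = bounded c
      where
      open ≤-Reasoning
      bounded : Compatible A → F A + r (V G (upper F) (A ∨G)) < r (A ∨G)
      bounded (𝒢A , A⊈G , inj₁ G⊆A) = begin-strict
        F A + r (V G (upper F) (A ∨G))  ≤⟨ +-monoʳ-≤ (F A) (≤-trans (r-mono V⊆clV) (r-cl _)) ⟩
        F A + r (V ∅ₛ F A)              <⟨ bound A (compatible-𝒢' c) ⟩
        r A                             ≤⟨ r-mono ⊆∨G ⟩
        r (A ∨G)                        ∎
        where
        covered : ∀ K → 1 ≤ upper F K → K ⊊ (A ∨G) → K ⊆ cl M (V ∅ₛ F A)
        covered K p K⊊ with upper-positive F p | subst (K ⊊_) (∨G-absorb (flat 𝒢A) G⊆A) K⊊
        ... | B , cB , refl , FB | B∨G⊊A = ∨G-least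
          (⊆-trans (∈V B FB (⊆-⊊-trans ⊆∨G B∨G⊊A)) ⊆cl) (G⊆clV (G⊆A , A⊈G)) (cl-flat (V ∅ₛ F A))
        V⊆clV : V G (upper F) (A ∨G) ⊆ cl M (V ∅ₛ F A)
        V⊆clV = V-least (G⊆clV (G⊆A , A⊈G)) covered
      bounded (𝒢A , A⊈G , inj₂ ¬𝒢K) = begin-strict
        F A + r (V G (upper F) (A ∨G))  ≤⟨ +-monoʳ-≤ (F A) (≤-trans (r-mono V⊆clV) (r-cl _)) ⟩
        F A + r (V ∅ₛ F A ∪ G)          ≤⟨ +-monoʳ-≤ (F A) (subadditive (V ∅ₛ F A) G) ⟩
        F A + (r (V ∅ₛ F A) + r G)      ≡⟨ +-assoc (F A) _ _ ⟨
        F A + r (V ∅ₛ F A) + r G        <⟨ +-monoˡ-< (r G) (bound A (compatible-𝒢' c)) ⟩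
        r A + r G                       ≤⟨ Split.rank-split 𝒢A 𝒢G ¬𝒢K ⟩
        r (A ∪ G)                       ≤⟨ r-mono ⊆cl ⟩
        r (A ∨G)                        ∎
        where
        covered : ∀ K → 1 ≤ upper F K → K ⊊ (A ∨G) → K ⊆ (V ∅ₛ F A) ∨G
        covered K p K⊊ with upper-positive F p
        ... | B , cB , refl , FB with Split.below-split 𝒢A 𝒢G ¬𝒢K (proj₁ cB) (⊆-trans ⊆∨G (proj₁ K⊊))
        ...   | inj₂ B⊆G = ⊥-elim (proj₁ (proj₂ cB) B⊆G)
        ...   | inj₁ B⊆A = ∨G-least (⊆-trans (∈V B FB (B⊆A , λ A⊆B → proj₂ K⊊ (∨G-least (⊆-trans A⊆B ⊆∨G) G⊆∨G ∨G-flat))) ⊆∨G) G⊆∨G ∨G-flat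
        V⊆clV : V G (upper F) (A ∨G) ⊆ (V ∅ₛ F A) ∨G
        V⊆clV = V-least G⊆∨G covered

    upper-valid : Valid StdC (upper F)
    upper-valid = upper-off F , bounded
      where
      bounded : ∀ K → 𝒞 K ≡ true → upper F K + r (V G (upper F) K) < r K
      bounded K 𝒞K with compatible-exists 𝒞K
      ... | A , c , refl = upper-bound c

    assemble-restrict : assemble (F G) (lower F) (upper F) ≗ F
    assemble-restrict A with position A
    ... | at-G refl   = pieces-G
    ... | below-G e   = trans (pieces-ℛ e) (when-yes (ℛ? A) e)
    ... | compatible c = trans (pieces-compatible c) (upper-∨G F c)
    ... | elsewhere ≢G ¬r ¬c = trans (pieces-elsewhere ≢G ¬r ¬c) (sym vanishes)
      where
      vanishes : F A ≡ 0
      vanishes with zero-or-positive (F A) | 𝒢 A BoolP.≟ true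
      ... | inj₁ e | _      = e
      ... | inj₂ _ | no ¬𝒢A = off A ¬𝒢A
      ... | inj₂ p | yes 𝒢A = ⊥-elim (¬c (positive-compatible 𝒢A (λ A⊆G → ¬r (ℛ⁺ (𝒢'⁺ 𝒢A ≢G) A⊆G)) p))

    deg-restrict : F G + (∑ℕ (allSubsets n) (lower F) + ∑ℕ (allSubsets n) (upper F)) ≡ ∑ℕ (allSubsets n) F
    deg-restrict = begin
      F G + (∑ℕ 𝒮 (lower F) + ∑ℕ 𝒮 (upper F))
        ≡⟨ cong₂ (λ x y → x + (∑ℕ 𝒮 (lower F) + y)) single (sym (deg-upper F)) ⟨
      ∑ℕ 𝒮 (λ A → when 0 (A ≟ₛ G) (F G)) + (∑ℕ 𝒮 (lower F) + ∑ℕ 𝒮 (λ A → when 0 (compatible? A) (F A)))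
        ≡⟨ cong (∑ℕ 𝒮 (λ A → when 0 (A ≟ₛ G) (F G)) +_) (ℕSum.⅀-distrib 𝒮 (lower F) _) ⟨
      ∑ℕ 𝒮 (λ A → when 0 (A ≟ₛ G) (F G)) + ∑ℕ 𝒮 (λ A → lower F A + when 0 (compatible? A) (F A))
        ≡⟨ ℕSum.⅀-distrib 𝒮 _ _ ⟨
      ∑ℕ 𝒮 (pieces-of F)
        ≡⟨ ℕSum.⅀-cong 𝒮 pieces≗ ⟩
      ∑ℕ 𝒮 F ∎
      where
      open ≡-Reasoning
      𝒮 : List (Subset n)
      𝒮 = allSubsets n
      pieces-of : (Subset n → ℕ) → Subset n → ℕ
      pieces-of F A = pieces (F G) (F A) (F A) A
      single : ∑ℕ 𝒮 (λ A → when 0 (A ≟ₛ G) (F G)) ≡ F G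
      single = trans (ℕSum.⅀-single (λ A → when 0 (A ≟ₛ G) (F G)) (allSubsets-unique n) (allSubsets-complete G) (λ A → when-no (A ≟ₛ G)))
        (when-yes (G ≟ₛ G) refl)
      pieces≗ : ∀ A → pieces-of F A ≡ F A
      pieces≗ A = trans (cong₂ (λ y z → when 0 (A ≟ₛ G) (F G) + (y + z))
        (when-cong (ℛ? A) (λ e → sym (when-yes (ℛ? A) e)))
        (when-cong (compatible? A) (λ c → sym (upper-∨G F c)))) (assemble-restrict A)
        where open ℕSum using (when-cong)

  module Assemble {j : ℕ} {f g : Subset n → ℕ} (vf : Valid StdR f) (vg : Valid StdC g) (spans : 1 ≤ j ⊎ Spanning f) where
    private
      F : Subset n → ℕ
      F = assemble j f g

    agrees : ∀ A → A ⊊ G → F A ≡ f A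
    agrees A (A⊆G , G⊈A) with position A
    ... | at-G refl = ⊥-elim (G⊈A ⊆-refl)
    ... | below-G e = pieces-ℛ e
    ... | compatible c = ⊥-elim (¬compatible-⊆G A⊆G c)
    ... | elsewhere ≢G ¬r ¬c = trans (pieces-elsewhere ≢G ¬r ¬c) (sym (proj₁ vf A ¬r))

    V-agrees : ∀ {A} → A ⊆ G → V ∅ₛ F A ≡ V ∅ₛ f A
    V-agrees A⊆G = V-cong (λ c c⊊A → agrees c (⊊-⊆-trans c⊊A A⊆G))

    positive : ∀ {c} → 1 ≤ F c → c ⊆ G ⊎ (Compatible c × 1 ≤ g (c ∨G))
    positive {c} p with position c
    ... | at-G refl = inj₁ ⊆-refl
    ... | below-G e = inj₁ (proj₂ (ℛ⁻ e))
    ... | compatible cc = inj₂ (cc , subst (1 ≤_) (pieces-compatible cc) p)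
    ... | elsewhere ≢G ¬r ¬c = contradiction (subst (1 ≤_) (pieces-elsewhere ≢G ¬r ¬c) p) λ ()

    -- The assumption keeps `c ∨ G` strictly below `A ∨ G`. Otherwise a positive exponent at `c`
    -- would not count in the contraction.
    V⊆V : ∀ {A} → (∀ {c} → Compatible c → c ⊊ A → c ∨G ≢ A ∨G) → V ∅ₛ F A ⊆ V G g (A ∨G)
    V⊆V {A} distinct = V-least ∅⊆ covered
      where
      covered : ∀ c → 1 ≤ F c → c ⊊ A → c ⊆ V G g (A ∨G)
      covered c p c⊊A with positive p
      ... | inj₁ c⊆G = ⊆-trans c⊆G Z⊆V
      ... | inj₂ (cc , gc) = ⊆-trans ⊆∨G (∈V (c ∨G) gc
        (⊆∧≢⇒⊊ (∨G-least (⊆-trans (proj₁ c⊊A) ⊆∨G) G⊆∨G ∨G-flat) (distinct cc c⊊A)))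

    bound-compatible : ∀ {A} → Compatible A → F A + r (V ∅ₛ F A) < r A
    bound-compatible {A} c = subst (λ x → x + r (V ∅ₛ F A) < r A) (sym (pieces-compatible c)) (bounded c)
      where
      open ≤-Reasoning
      V⊆ᴳ : V ∅ₛ F A ⊆ V G g (A ∨G)
      V⊆ᴳ = V⊆V (λ cc c⊊A e → ⊊⇒≢ c⊊A (compatible-unique cc c e))
      bounded : Compatible A → g (A ∨G) + r (V ∅ₛ F A) < r A
      bounded (𝒢A , A⊈G , inj₁ G⊆A) = begin-strict
        g (A ∨G) + r (V ∅ₛ F A)        ≤⟨ +-monoʳ-≤ (g (A ∨G)) (r-mono V⊆ᴳ) ⟩
        g (A ∨G) + r (V G g (A ∨G))    <⟨ proj₂ vg (A ∨G) (compatible-𝒞 c) ⟩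
        r (A ∨G)                       ≡⟨ cong r (∨G-absorb (flat 𝒢A) G⊆A) ⟩
        r A                            ∎
      bounded (𝒢A , A⊈G , inj₂ ¬𝒢K) = +-cancelʳ-< (r G) _ _ (begin-strict
        g (A ∨G) + r (V ∅ₛ F A) + r G    ≡⟨ +-assoc (g (A ∨G)) _ _ ⟩
        g (A ∨G) + (r (V ∅ₛ F A) + r G)  ≤⟨ +-monoʳ-≤ (g (A ∨G)) (separate (V⊆ ∅⊆) ⊆-refl (Split.rank-split 𝒢A 𝒢G ¬𝒢K)) ⟩
        g (A ∨G) + r (V ∅ₛ F A ∪ G)      ≤⟨ +-monoʳ-≤ (g (A ∨G)) (r-mono (∪-lub V⊆ᴳ Z⊆V)) ⟩
        g (A ∨G) + r (V G g (A ∨G))      <⟨ proj₂ vg (A ∨G) (compatible-𝒞 c) ⟩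
        r (A ∨G)                         ≤⟨ r-cl _ ⟩
        r (A ∪ G)                        ≤⟨ subadditive A G ⟩
        r A + r G                        ∎)

    -- Were `A` spanned by the support below it, `A ∨ G` would be spanned in the contraction,
    -- against the bound for `g` there. A compatible `c ⊊ A` with the same join with `G` would make
    -- `A` compatible too, so `V⊆V` applies.
    bound-incompatible : ∀ {A} → 𝒢' A ≡ true → ¬ (A ⊆ G) → ¬ Compatible A → F A ≡ 0 → F A + r (V ∅ₛ F A) < r A
    bound-incompatible {A} 𝒢'A A⊈G ¬c FA≡0 rewrite FA≡0 = ≰⇒> λ rA≤ →
      <⇒≱ (proj₂ vg (A ∨G) (𝒞⁺ 𝒢'A A⊈G)) (begin
        r (A ∨G)                      ≤⟨ r-cl _ ⟩
        r (A ∪ G)                     ≤⟨ r-mono (∪-lub (⊆-trans (⊆cl-rank (V⊆ ∅⊆) rA≤) (cl-mono V⊆ᴳ)) (⊆-trans Z⊆V ⊆cl)) ⟩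
        r (cl M (V G g (A ∨G)))       ≤⟨ r-cl _ ⟩
        r (V G g (A ∨G))              ≤⟨ m≤n+m _ (g (A ∨G)) ⟩
        g (A ∨G) + r (V G g (A ∨G))   ∎)
      where
      open ≤-Reasoning
      𝒢A : 𝒢 A ≡ true
      𝒢A = proj₁ (𝒢'⁻ 𝒢'A)
      V⊆ᴳ : V ∅ₛ F A ⊆ V G g (A ∨G)
      V⊆ᴳ = V⊆V apart
        where
        apart : ∀ {c} → Compatible c → c ⊊ A → c ∨G ≢ A ∨G
        apart (𝒢c , c⊈G , inj₁ G⊆c)  c⊊A e = ¬c (𝒢A , A⊈G , inj₁ (⊆-trans G⊆c (proj₁ c⊊A)))
        apart (𝒢c , c⊈G , inj₂ ¬𝒢K) c⊊A e = ¬c (𝒢A , A⊈G , inj₂ (λ 𝒢K → ¬𝒢K (subst (λ X → 𝒢 X ≡ true) (sym e) 𝒢K)))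

    assemble-valid : Valid Around F
    assemble-valid = off , bound , Data.Sum.map (subst (1 ≤_) (sym pieces-G)) (subst (λ W → r G ≤ r W) (sym (V-agrees ⊆-refl))) spans
      where
      off : ∀ A → ¬ (𝒢 A ≡ true) → F A ≡ 0
      off A ¬𝒢A = pieces-elsewhere (λ { refl → ¬𝒢A 𝒢G }) (λ e → ¬𝒢A (proj₁ (𝒢'⁻ (proj₁ (ℛ⁻ e))))) (λ c → ¬𝒢A (proj₁ c))
      bound : ∀ A → 𝒢' A ≡ true → F A + r (V ∅ₛ F A) < r A
      bound A 𝒢'A with position A
      ... | at-G refl = ⊥-elim (proj₂ (𝒢'⁻ 𝒢'A) refl)
      ... | below-G e = subst₂ (λ x W → x + r W < r A) (sym (pieces-ℛ e)) (sym (V-agrees (proj₂ (ℛ⁻ e)))) (proj₂ vf A e)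
      ... | compatible c = bound-compatible c
      ... | elsewhere ≢G ¬r ¬c = bound-incompatible 𝒢'A (λ A⊆G → ¬r (ℛ⁺ 𝒢'A A⊆G)) ¬c (pieces-elsewhere ≢G ¬r ¬c)

    lower-assemble : lower F ≗ f
    lower-assemble A = trans (ℕSum.when-cong (ℛ? A) pieces-ℛ) (on-ℛ (ℛ? A))
      where
      on-ℛ : (d : Dec (ℛ A ≡ true)) → when 0 d (f A) ≡ f A
      on-ℛ (yes _) = refl
      on-ℛ (no ¬r) = sym (proj₁ vf A ¬r)

    upper-assemble : upper F ≗ g
    upper-assemble K with 𝒞 K BoolP.≟ true
    ... | no ¬𝒞K = trans (upper-off F K ¬𝒞K) (sym (proj₁ vg K ¬𝒞K))
    ... | yes 𝒞K with compatible-exists 𝒞K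
    ...   | A , c , refl = trans (upper-∨G F c) (pieces-compatible c)

  decomposition : Around ≅ (Triples ∣ λ (j , f , _) → 1 ≤ j ⊎ Spanning f)
  decomposition = record
    { to         = λ F → F G , lower F , upper F
    ; from       = λ (j , f , g) → assemble j f g
    ; to-valid   = λ {F} v → let open Restrict v in
        (tt , lower-valid , upper-valid) , Data.Sum.map id (subst (λ W → r G ≤ r W) (sym (V-lower ⊆-refl))) (proj₂ (proj₂ v))
    ; from-valid = λ ((_ , vf , vg) , s) → Assemble.assemble-valid vf vg s
    ; to-cong    = λ e → e G , (λ A → cong (when 0 (ℛ? A)) (e A)) ,
        λ K → ℕSum.⅀-cong (allSubsets n) (λ A → cong (when 0 (compatible? A ×-dec ((A ∨G) ≟ₛ K))) (e A))
    ; from-cong  = λ { {_ , f , g} {_ , f' , g'} (refl , ef , eg) A → cong₂ (λ y z → pieces _ y z A) (ef A) (eg (A ∨G)) }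
    ; to-from    = λ ((_ , vf , vg) , s) → pieces-G , Assemble.lower-assemble vf vg s , Assemble.upper-assemble vf vg s
    ; from-to    = λ v → Restrict.assemble-restrict v
    ; to-deg     = λ v → Restrict.deg-restrict v }

-- Exchanging the exponent at `G` with those at its factors

<∸⇒+< : ∀ {a b} c → a < b ∸ c → a + c < b
<∸⇒+< {a} {b}     zero    lt = subst (_< b) (sym (+-identityʳ a)) lt
<∸⇒+< {a} {suc b} (suc c) lt = subst (_< suc b) (sym (+-suc a c)) (s≤s (<∸⇒+< c lt))

vacant : ℕ → ℕ → ℕ
vacant zero    s = s
vacant (suc _) s = 0

_[_≔_] : ∀ {n} → (Subset n → ℕ) → Subset n → ℕ → Subset n → ℕ
(f [ H ≔ a ]) A = if ⌊ A ≟ₛ H ⌋ then a else f A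

≔-same : ∀ {n} (f : Subset n → ℕ) H a → (f [ H ≔ a ]) H ≡ a
≔-same f H a with H ≟ₛ H
... | yes _ = refl
... | no ¬e = contradiction refl ¬e

≔-other : ∀ {n} (f : Subset n → ℕ) {H a A} → A ≢ H → (f [ H ≔ a ]) A ≡ f A
≔-other f {H} {A = A} A≢H with A ≟ₛ H
... | yes e = contradiction e A≢H
... | no _  = refl

≔-cong : ∀ {n} {f g : Subset n → ℕ} {H a b} → f ≗ g → a ≡ b → (f [ H ≔ a ]) ≗ (g [ H ≔ b ])
≔-cong {H = H} e refl A with A ≟ₛ H
... | yes _ = refl
... | no  _ = e A

≔-revert : ∀ {n} (f : Subset n → ℕ) {H a b} → f H ≡ b → ((f [ H ≔ a ]) [ H ≔ b ]) ≗ f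
≔-revert f {H} {a} {b} e A = decide (A ≟ₛ H)
  where
  decide : Dec (A ≡ H) → ((f [ H ≔ a ]) [ H ≔ b ]) A ≡ f A
  decide (yes refl) = trans (≔-same (f [ H ≔ a ]) H b) (sym e)
  decide (no A≢H)   = trans (≔-other (f [ H ≔ a ]) A≢H) (≔-other f A≢H)

deg-≔ : ∀ {n} (f : Subset n → ℕ) H a → ∑ℕ (allSubsets n) (f [ H ≔ a ]) + f H ≡ ∑ℕ (allSubsets n) f + a
deg-≔ {n} f H a = begin
  ∑ℕ 𝒮 (f [ H ≔ a ]) + f H
    ≡⟨ cong (∑ℕ 𝒮 (f [ H ≔ a ]) +_) (only (f H)) ⟨
  ∑ℕ 𝒮 (f [ H ≔ a ]) + ∑ℕ 𝒮 (λ A → when 0 (A ≟ₛ H) (f H))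
    ≡⟨ ℕSum.⅀-distrib 𝒮 (f [ H ≔ a ]) _ ⟨
  ∑ℕ 𝒮 (λ A → (f [ H ≔ a ]) A + when 0 (A ≟ₛ H) (f H))
    ≡⟨ ℕSum.⅀-cong 𝒮 pointwise ⟩
  ∑ℕ 𝒮 (λ A → f A + when 0 (A ≟ₛ H) a)
    ≡⟨ ℕSum.⅀-distrib 𝒮 f _ ⟩
  ∑ℕ 𝒮 f + ∑ℕ 𝒮 (λ A → when 0 (A ≟ₛ H) a)
    ≡⟨ cong (∑ℕ 𝒮 f +_) (only a) ⟩
  ∑ℕ 𝒮 f + a ∎
  where
  open ≡-Reasoning
  𝒮 : List (Subset n)
  𝒮 = allSubsets n
  only : ∀ x → ∑ℕ 𝒮 (λ A → when 0 (A ≟ₛ H) x) ≡ x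
  only x = trans (ℕSum.⅀-single (λ A → when 0 (A ≟ₛ H) x) (allSubsets-unique n) (allSubsets-complete H) (λ A → when-no (A ≟ₛ H)))
    (when-yes (H ≟ₛ H) refl)
  pointwise : ∀ A → (f [ H ≔ a ]) A + when 0 (A ≟ₛ H) (f H) ≡ f A + when 0 (A ≟ₛ H) a
  pointwise A with A ≟ₛ H
  ... | yes refl = +-comm a (f A)
  ... | no _     = refl

module Exchange {n : ℕ} (M : Matroid n) (β : SetOfSubsets n) (C : GradedSet) where
  open Rank M

  Std Triples : GradedSet
  Std = StandardFunctions M ∅ₛ β
  Triples = Naturals ⊠ Std ⊠ C
  module Triples = GradedSet Triples

  -- The corank in `H` of the span of the support at and below `H`. A positive exponent at `H` puts
  -- `H` itself into the support and leaves corank 0.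
  corank : (Subset n → ℕ) → Subset n → ℕ
  corank f H = vacant (f H) (r H ∸ r (V ∅ₛ f H))

  coranks : List (Subset n) → (Subset n → ℕ) → ℕ
  coranks Hs f = sumℕ (map (corank f) Hs)

  coranks-cong : ∀ Hs {f g} → (∀ {H} → H ∈ₗ Hs → f H ≡ g H × V ∅ₛ f H ≡ V ∅ₛ g H) → coranks Hs f ≡ coranks Hs g
  coranks-cong []       e = refl
  coranks-cong (H ∷ Hs) e = cong₂ _+_ (cong₂ (λ x W → vacant x (r H ∸ r W)) (proj₁ (e (here refl))) (proj₂ (e (here refl))))
    (coranks-cong Hs (e ∘ there))

  Maximal : Subset n → Set
  Maximal H = β H ≡ true × (∀ {A} → β A ≡ true → H ⊆ A → H ≡ A)

  -- A maximal member is strictly below no other member, so changing its exponent affects no bound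
  -- but its own.
  V-≔ : ∀ f {H a A} → Maximal H → β A ≡ true → V ∅ₛ (f [ H ≔ a ]) A ≡ V ∅ₛ f A
  V-≔ f (_ , max) βA = V-cong (λ c c⊊A → ≔-other f (λ { refl → ⊊⇒≢ c⊊A (max βA (proj₁ c⊊A)) }))

  ≔-valid : ∀ {f H a} → Maximal H → Valid Std f → a + r (V ∅ₛ f H) < r H → Valid Std (f [ H ≔ a ])
  ≔-valid {f} {H} {a} max@(βH , _) (off , bound) lt = (λ A ¬βA → trans (≔-other f (λ { refl → ¬βA βH })) (off A ¬βA)) , bounded
    where
    bounded : ∀ A → β A ≡ true → (f [ H ≔ a ]) A + r (V ∅ₛ (f [ H ≔ a ]) A) < r A
    bounded A βA = subst (λ W → (f [ H ≔ a ]) A + r W < r A) (sym (V-≔ f max βA)) (decide (A ≟ₛ H))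
      where
      decide : Dec (A ≡ H) → (f [ H ≔ a ]) A + r (V ∅ₛ f A) < r A
      decide (yes refl) = subst (λ x → x + r (V ∅ₛ f A) < r A) (sym (≔-same f A a)) lt
      decide (no A≢H)   = subst (λ x → x + r (V ∅ₛ f A) < r A) (sym (≔-other f A≢H)) (bound A βA)

  coranks-≔ : ∀ Hs {f H a} → Maximal H → All (H ≢_) Hs → All Maximal Hs → coranks Hs (f [ H ≔ a ]) ≡ coranks Hs f
  coranks-≔ Hs {f} max fresh maxs = coranks-cong Hs (λ K∈ →
    ≔-other f (All.lookup fresh K∈ ∘ sym) , V-≔ f max (proj₁ (All.lookup maxs K∈)))

  -- One factor of the identity [u+s] + ([s]-1)[u] = [s][u+1], where [a] = 1 + x + ⋯ + x^{a-1}: an exponent j ≥ u is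
  -- traded for the exponent j - u of the vacant variable x_H together with the exponent u.
  module Step (t : ℕ) (H : Subset n) (Hs : List (Subset n)) (max : Maximal H) (fresh : All (H ≢_) Hs) (maxs : All Maximal Hs) where

    threshold : (Subset n → ℕ) → ℕ
    threshold f = t + coranks Hs f

    fill : ∀ u → Car Triples → Car Triples
    fill u (j , f , g) with j <? u
    ... | yes _ = j , f , g
    ... | no  _ = u , f [ H ≔ j ∸ u ] , g

    empty : ∀ u → Car Triples → Car Triples
    empty u (j , f , g) with j <? u
    ... | yes _ = j , f , g
    ... | no  _ = u + f H , f [ H ≔ 0 ] , g

    fill-< : ∀ {u j f g} → j < u → fill u (j , f , g) ≡ (j , f , g)
    fill-< {u} {j} lt with j <? u
    ... | yes _ = refl
    ... | no ¬p = contradiction lt ¬p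

    fill-≥ : ∀ {u j f g} → u ≤ j → fill u (j , f , g) ≡ (u , f [ H ≔ j ∸ u ] , g)
    fill-≥ {u} {j} le with j <? u
    ... | yes p = contradiction p (≤⇒≯ le)
    ... | no _  = refl

    empty-< : ∀ {u j f g} → j < u → empty u (j , f , g) ≡ (j , f , g)
    empty-< {u} {j} lt with j <? u
    ... | yes _ = refl
    ... | no ¬p = contradiction lt ¬p

    empty-≥ : ∀ {u j f g} → u ≤ j → empty u (j , f , g) ≡ (u + f H , f [ H ≔ 0 ] , g)
    empty-≥ {u} {j} le with j <? u
    ... | yes p = contradiction p (≤⇒≯ le)
    ... | no _  = refl

    -- The exponent 0 can appear afterwards only for threshold 0, when the whole exponent `j`, which
    -- was positive, has moved to `H`.
    Before After : Car Triples → Set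
    Before (j , f , g) = 1 ≤ j × j < t + coranks (H ∷ Hs) f
    After (j , f , g) = j < suc (threshold f) × (1 ≤ j ⊎ (threshold f ≡ 0 × 1 ≤ f H))

    threshold-≔ : ∀ f a → threshold (f [ H ≔ a ]) ≡ threshold f
    threshold-≔ f a = cong (t +_) (coranks-≔ Hs max fresh maxs)

    threshold-cong : ∀ {f g} → f ≗ g → threshold f ≡ threshold g
    threshold-cong e = cong (t +_) (coranks-cong Hs (λ {K} _ → e K , V-cong (λ c _ → e c)))

    bound-split : ∀ f → t + coranks (H ∷ Hs) f ≡ threshold f + corank f H
    bound-split f = solve 3 (λ t a b → t :+ (a :+ b) := t :+ b :+ a) refl t (corank f H) (coranks Hs f)

    to' from' : Car Triples → Car Triples
    to' x@(_ , f , _) = fill (threshold f) x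
    from' x@(_ , f , _) = empty (threshold f) x

    vacant-positive : ∀ {u j} x s → u ≤ j → j < u + vacant x s → x ≡ 0 × j ∸ u < s
    vacant-positive {u} {j} zero    s le lt = refl , +-cancelˡ-< u _ _ (subst (_< u + s) (sym (m+[n∸m]≡n le)) lt)
    vacant-positive {u} {j} (suc x) s le lt = contradiction (subst (j <_) (+-identityʳ u) lt) (≤⇒≯ le)

    fill-room : ∀ {j} f → threshold f ≤ j → j < t + coranks (H ∷ Hs) f → f H ≡ 0 × j ∸ threshold f + r (V ∅ₛ f H) < r H
    fill-room {j} f le lt with vacant-positive (f H) (r H ∸ r (V ∅ₛ f H)) le (subst (j <_) (bound-split f) lt)
    ... | e , lt' = e , <∸⇒+< (r (V ∅ₛ f H)) lt'

    exchange : (Triples ∣ Before) ≅ (Triples ∣ After)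
    exchange = record
      { to = to' ; from = from' ; to-valid = tv ; from-valid = fv ; to-cong = λ {x} {y} → tc x y ; from-cong = λ {x} {y} → fc x y
      ; to-from = tf ; from-to = ft ; to-deg = td }
      where
      tv : ∀ {x} → Valid (Triples ∣ Before) x → Valid (Triples ∣ After) (to' x)
      tv {j , f , g} ((_ , vf , vg) , 1≤j , lt) with j <? threshold f
      ... | yes j<u = (tt , vf , vg) , m≤n⇒m≤1+n j<u , inj₁ 1≤j
      ... | no  j≮u with fill-room f (≮⇒≥ j≮u) lt
      ...   | _ , room = (tt , ≔-valid max vf room , vg) ,
        subst (λ u → threshold f < suc u) (sym (threshold-≔ f _)) ≤-refl , positive (zero-or-positive (threshold f))
        where
        a : ℕ
        a = j ∸ threshold f
        positive : threshold f ≡ 0 ⊎ 1 ≤ threshold f → 1 ≤ threshold f ⊎ (threshold (f [ H ≔ a ]) ≡ 0 × 1 ≤ (f [ H ≔ a ]) H)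
        positive (inj₂ p) = inj₁ p
        positive (inj₁ e) = inj₂ (trans (threshold-≔ f a) e , subst (1 ≤_) (sym (trans (≔-same f H a) (cong (j ∸_) e))) 1≤j)
      fv : ∀ {x} → Valid (Triples ∣ After) x → Valid (Triples ∣ Before) (from' x)
      fv {j , f , g} ((_ , vf , vg) , lt , pos) with j <? threshold f
      ... | yes j<u = (tt , vf , vg) , positive pos , ≤-trans j<u (≤-trans (m≤m+n _ _) (≤-reflexive (sym (bound-split f))))
        where
        positive : 1 ≤ j ⊎ (threshold f ≡ 0 × 1 ≤ f H) → 1 ≤ j
        positive (inj₁ p)       = p
        positive (inj₂ (e , _)) = contradiction (subst (j <_) e j<u) λ ()
      ... | no j≮u = (tt , ≔-valid max vf (≤-<-trans (m≤n+m _ (f H)) (proj₂ vf H (proj₁ max))) , vg) , positive pos ,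
        subst (threshold f + f H <_) (sym (trans (bound-split (f [ H ≔ 0 ])) (cong₂ _+_ (threshold-≔ f 0) corank-0)))
          (+-monoʳ-< (threshold f) (m+n≤o⇒m≤o∸n (suc (f H)) (proj₂ vf H (proj₁ max))))
        where
        positive : 1 ≤ j ⊎ (threshold f ≡ 0 × 1 ≤ f H) → 1 ≤ threshold f + f H
        positive (inj₁ p)       = ≤-trans p (≤-trans (≤-pred lt) (m≤m+n _ _))
        positive (inj₂ (_ , p)) = ≤-trans p (m≤n+m _ _)
        corank-0 : corank (f [ H ≔ 0 ]) H ≡ r H ∸ r (V ∅ₛ f H)
        corank-0 = cong₂ (λ x W → vacant x (r H ∸ r W)) (≔-same f H 0) (V-≔ f max (proj₁ max))
      fill-cong : ∀ u {x y} → x Triples.≈ y → fill u x Triples.≈ fill u y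
      fill-cong u {j , f , g} {j , f' , g'} (refl , ef , eg) with j <? u
      ... | yes _ = refl , ef , eg
      ... | no  _ = refl , ≔-cong ef refl , eg
      empty-cong : ∀ u {x y} → x Triples.≈ y → empty u x Triples.≈ empty u y
      empty-cong u {j , f , g} {j , f' , g'} (refl , ef , eg) with j <? u
      ... | yes _ = refl , ef , eg
      ... | no  _ = cong (u +_) (ef H) , ≔-cong ef refl , eg
      tc : ∀ x y → x Triples.≈ y → to' x Triples.≈ to' y
      tc x@(_ , f , _) y@(_ , f' , _) e = subst (λ u → to' x Triples.≈ fill u y) (threshold-cong (proj₁ (proj₂ e))) (fill-cong (threshold f) e)
      fc : ∀ x y → x Triples.≈ y → from' x Triples.≈ from' y
      fc x@(_ , f , _) y@(_ , f' , _) e = subst (λ u → from' x Triples.≈ empty u y) (threshold-cong (proj₁ (proj₂ e))) (empty-cong (threshold f) e)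
      tf : ∀ {y} → Valid (Triples ∣ After) y → to' (from' y) Triples.≈ y
      tf {j , f , g} ((_ , vf , vg) , lt , pos) with j <? threshold f
      ... | yes j<u = subst (Triples._≈ (j , f , g)) (sym (fill-< j<u)) Triples.≈-refl
      ... | no  j≮u = subst (Triples._≈ (j , f , g)) (sym (trans (cong (λ u → fill u (threshold f + f H , f [ H ≔ 0 ] , g)) (threshold-≔ f 0)) (fill-≥ (m≤m+n _ _))))
        (≤-antisym (≮⇒≥ j≮u) (≤-pred lt) , ≔-revert f (sym (m+n∸m≡n (threshold f) (f H))) , GradedSet.≈-refl C)
      ft : ∀ {x} → Valid (Triples ∣ Before) x → from' (to' x) Triples.≈ x
      ft {j , f , g} ((_ , vf , vg) , 1≤j , lt) with j <? threshold f
      ... | yes j<u = subst (Triples._≈ (j , f , g)) (sym (empty-< j<u)) Triples.≈-refl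
      ... | no  j≮u = subst (Triples._≈ (j , f , g)) (sym (trans (cong (λ u → empty u (threshold f , f [ H ≔ j ∸ threshold f ] , g)) (threshold-≔ f _)) (empty-≥ ≤-refl)))
        (trans (cong (threshold f +_) (≔-same f H _)) (m+[n∸m]≡n (≮⇒≥ j≮u)) , ≔-revert f (proj₁ (fill-room f (≮⇒≥ j≮u) lt)) , GradedSet.≈-refl C)
      td : ∀ {x} → Valid (Triples ∣ Before) x → deg Triples (to' x) ≡ deg Triples x
      td {j , f , g} ((_ , vf , vg) , 1≤j , lt) with j <? threshold f
      ... | yes j<u = refl
      ... | no  j≮u = begin
        u + (deg Std (f [ H ≔ j ∸ u ]) + deg C g)   ≡⟨ cong (λ z → u + (z + deg C g)) deg-f ⟩
        u + (deg Std f + (j ∸ u) + deg C g)         ≡⟨ solve 4 (λ u d a c → u :+ (d :+ a :+ c) := u :+ a :+ (d :+ c)) refl u (deg Std f) (j ∸ u) (deg C g) ⟩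
        u + (j ∸ u) + (deg Std f + deg C g)         ≡⟨ cong (_+ (deg Std f + deg C g)) (m+[n∸m]≡n (≮⇒≥ j≮u)) ⟩
        j + (deg Std f + deg C g)                   ∎
        where
        open ≡-Reasoning
        u : ℕ
        u = threshold f
        deg-f : deg Std (f [ H ≔ j ∸ u ]) ≡ deg Std f + (j ∸ u)
        deg-f = trans (sym (trans (cong (deg Std (f [ H ≔ j ∸ u ]) +_) (proj₁ (fill-room f (≮⇒≥ j≮u) lt))) (+-identityʳ _))) (deg-≔ f H (j ∸ u))

  -- Each exchange drops one corank from the bound and raises the constant by one, whatever the rank
  -- of the factor; this is how coranks turn into the number of factors. As `t` is positive, no
  -- threshold is 0 and the exponent stays positive.
  chain : ∀ t Hs → 1 ≤ t → Unique Hs → All Maximal Hs →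
          (Triples ∣ λ (j , f , _) → 1 ≤ j × j < t + coranks Hs f) ≅ (Triples ∣ λ (j , _) → 1 ≤ j × j < length Hs + t)
  chain t []       1≤t []          []           = ∣-⇔ {Triples} (λ {x} _ (p , q) → p , subst (proj₁ x <_) (+-identityʳ t) q)
                                                              (λ {x} _ (p , q) → p , subst (proj₁ x <_) (sym (+-identityʳ t)) q)
  chain t (H ∷ Hs) 1≤t (fresh ∷ u) (max ∷ maxs) =
    ≅-trans exchange (≅-trans (∣-⇔ {Triples} (λ {x} _ → simplify {x}) (λ _ (p , q) → q , inj₁ p))
      (≅-trans (chain (suc t) Hs (s≤s z≤n) u maxs)
        (∣-⇔ {Triples} (λ {x} _ (p , q) → p , subst (proj₁ x <_) (+-suc (length Hs) t) q)
                       (λ {x} _ (p , q) → p , subst (proj₁ x <_) (sym (+-suc (length Hs) t)) q))))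
    where
    open Step t H Hs max fresh maxs
    simplify : ∀ {x} → After x → 1 ≤ proj₁ x × proj₁ x < suc t + coranks Hs (proj₁ (proj₂ x))
    simplify (q , inj₁ p)       = p , q
    simplify (q , inj₂ (e , _)) = contradiction (subst (1 ≤_) (m+n≡0⇒m≡0 t e) 1≤t) λ ()

  -- The first exchange may empty the exponent j, which accounts for the second summand.
  exchange-all : ∀ H Hs → Unique (H ∷ Hs) → All Maximal (H ∷ Hs) →
    (Triples ∣ λ (j , f , _) → 1 ≤ j × j < coranks (H ∷ Hs) f) ≅
    ((Triples ∣ λ (j , f , _) → j ≡ 0 × coranks (H ∷ Hs) f ≡ 0) ⊞ (Triples ∣ λ (j , _) → 1 ≤ j × j < length (H ∷ Hs)))
  exchange-all H Hs (fresh ∷ u) (max ∷ maxs) =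
    ≅-trans exchange (≅-trans (split (Triples ∣ After) (λ (j , _) → j ℕ.≟ 0) (λ (e , _) z → trans (sym e) z))
      (⊞-cong (∣∣-⇔ {Triples} (λ {x} → emptied x) (λ {x} → refilled x))
        (≅-trans (∣∣-⇔ {Triples} (λ {x} _ → nonempty {x}) (λ _ (p , q) → (q , inj₁ p) , λ { refl → contradiction p λ () }))
          (≅-trans (chain 1 Hs ≤-refl u maxs)
            (∣-⇔ {Triples} (λ {x} _ (p , q) → p , subst (proj₁ x <_) (+-comm (length Hs) 1) q)
                           (λ {x} _ (p , q) → p , subst (proj₁ x <_) (+-comm 1 (length Hs)) q))))))
    where
    open Step 0 H Hs max fresh maxs
    emptied : ∀ x → Valid Triples x → After x → proj₁ x ≡ 0 → proj₁ x ≡ 0 × coranks (H ∷ Hs) (proj₁ (proj₂ x)) ≡ 0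
    emptied (j , f , _) _ (_ , inj₁ p)       refl = contradiction p λ ()
    emptied (j , f , _) _ (_ , inj₂ (e , p)) refl = refl , trans (cong₂ _+_ (occupied (f H) p) e) refl
      where
      occupied : ∀ x → 1 ≤ x → vacant x (r H ∸ r (V ∅ₛ f H)) ≡ 0
      occupied (suc x) _ = refl
    -- Corank 0 at `H` forces a positive exponent there, because validity keeps the support strictly
    -- below `H` from spanning it.
    refilled : ∀ x → Valid Triples x → proj₁ x ≡ 0 × coranks (H ∷ Hs) (proj₁ (proj₂ x)) ≡ 0 → After x × proj₁ x ≡ 0
    refilled (j , f , _) (_ , vf , _) (refl , e) = (s≤s z≤n , inj₂ (m+n≡0⇒n≡0 (corank f H) e , occupied (f H) (m+n≡0⇒m≡0 (corank f H) e) (proj₂ vf H (proj₁ max)))) , refl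
      where
      occupied : ∀ x → vacant x (r H ∸ r (V ∅ₛ f H)) ≡ 0 → x + r (V ∅ₛ f H) < r H → 1 ≤ x
      occupied zero    e lt = contradiction lt (≤⇒≯ (m∸n≡0⇒m≤n e))
      occupied (suc x) _ _  = s≤s z≤n
    nonempty : ∀ {x} → After x → proj₁ x ≢ 0 → 1 ≤ proj₁ x × proj₁ x < 1 + coranks Hs (proj₁ (proj₂ x))
    nonempty (q , _) ≢0 = n≢0⇒n>0 ≢0 , q

-- The recursion

Functions-⇔ : ∀ {n} {P Q : (Subset n → ℕ) → Set} → (∀ f → P f → Q f) → (∀ f → Q f → P f) → Functions P ≅ Functions Q
Functions-⇔ f g = record
  { to = id ; from = id ; to-valid = f _ ; from-valid = g _ ; to-cong = id ; from-cong = id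
  ; to-from = λ _ _ → refl ; from-to = λ _ _ → refl ; to-deg = λ _ → refl }

module Recursion {n : ℕ} {M : Matroid n} (loopless : Loopless M) {𝒢 : SetOfSubsets n} (bs : IsBuildingSet M 𝒢)
  {G : Subset n} (𝒢G : 𝒢 G ≡ true) (bs' : IsBuildingSet M (removeB 𝒢 G)) where
  open Rank M
  open Modular M
  open Deletion loopless bs 𝒢G bs'
  open Decomposition loopless bs 𝒢G bs'
  open Exchange M ℛ StdC using (corank; coranks; Maximal; exchange-all)
  open Closed closed𝒢 using (flat)

  factors : List (Subset n)
  factors = maxBelow 𝒢' G

  factors-sum : sumℕ (map r factors) ≡ r G
  factors-sum = sym (IsBuildingSet.rank-sum bs' G (flat 𝒢G))

  factors-maximal : All Maximal factors
  factors-maximal = All.tabulate λ H∈ → let (𝒢'H , H⊆G , max) = ∈maxBelow⁻ 𝒢' G H∈ in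
    ℛ⁺ 𝒢'H H⊆G , λ ℛA H⊆A → max (proj₁ (ℛ⁻ ℛA)) (proj₂ (ℛ⁻ ℛA)) H⊆A

  -- `J H` is the part of the support's span that lies in the factor `H`. The union of the `J H` is
  -- `V ∅ₛ f G`, and as the factors are modular, the ranks of these subsets add up.
  coranks-total : ∀ {f} → Valid StdR f → coranks factors f ≡ r G ∸ r (V ∅ₛ f G)
  coranks-total {f} (off , bound) = begin
    coranks factors f                                             ≡⟨ m+n∸n≡m (coranks factors f) (r (V ∅ₛ f G)) ⟨
    coranks factors f + r (V ∅ₛ f G) ∸ r (V ∅ₛ f G)               ≡⟨ cong (λ x → coranks factors f + x ∸ r (V ∅ₛ f G)) rank-V ⟩
    coranks factors f + sumℕ (map (r ∘ J) factors) ∸ r (V ∅ₛ f G) ≡⟨ cong (_∸ r (V ∅ₛ f G)) (trans (add-up factors) factors-sum) ⟩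
    r G ∸ r (V ∅ₛ f G)                                            ∎
    where
    open ≡-Reasoning
    occupied : ℕ → Subset n → Subset n → Subset n
    occupied zero    W H = W
    occupied (suc _) W H = H
    J : Subset n → Subset n
    J H = occupied (f H) (V ∅ₛ f H) H
    J⊆ : ∀ H → J H ⊆ H
    J⊆ H with f H
    ... | zero  = V⊆ ∅⊆
    ... | suc _ = ⊆-refl
    corank-J : ∀ H → corank f H + r (J H) ≡ r H
    corank-J H with f H
    ... | zero  = m∸n+n≡m (r-mono (V⊆ ∅⊆))
    ... | suc _ = refl
    add-up : ∀ Hs → coranks Hs f + sumℕ (map (r ∘ J) Hs) ≡ sumℕ (map r Hs)
    add-up []       = refl
    add-up (H ∷ Hs) = trans (solve 4 (λ a b c d → a :+ b :+ (c :+ d) := a :+ c :+ (b :+ d)) refl (corank f H) (coranks Hs f) (r (J H)) _)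
      (cong₂ _+_ (corank-J H) (add-up Hs))
    V⊆J : ∀ {H} → V ∅ₛ f H ⊆ J H
    V⊆J {H} with f H
    ... | zero  = ⊆-refl
    ... | suc _ = V⊆ ∅⊆
    H⊆J : ∀ {H} → 1 ≤ f H → H ⊆ J H
    H⊆J {H} p with f H
    ... | suc _ = ⊆-refl
    factor⊊G : ∀ {H} → H ∈ₗ factors → H ⊊ G
    factor⊊G H∈ with ∈maxBelow⁻ 𝒢' G H∈
    ... | 𝒢'H , H⊆G , _ = ⊆∧≢⇒⊊ H⊆G (proj₂ (𝒢'⁻ 𝒢'H))
    J⊆V : ∀ {A} → A ∈ₗ map J factors → A ⊆ V ∅ₛ f G
    J⊆V A∈ with ∈ₚ.∈-map⁻ J A∈
    ... | H , H∈ , refl with factor⊊G H∈ | f H in eq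
    ...   | H⊊G | zero  = V-least ∅⊆ λ c p c⊊H → ∈V c p (⊊-⊆-trans c⊊H (proj₁ H⊊G))
    ...   | H⊊G | suc x = ∈V H (subst (1 ≤_) (sym eq) (s≤s z≤n)) H⊊G
    covered : ∀ c → 1 ≤ f c → c ⊊ G → c ⊆ ⋃ (map J factors)
    covered c p (c⊆G , _) with ℛ? c
    ... | no ¬r = contradiction (subst (1 ≤_) (off c ¬r) p) λ ()
    ... | yes ℛc with below-maximal 𝒢' G (proj₁ (ℛ⁻ ℛc)) c⊆G
    ...   | H , H∈ , c⊆H with c ≟ₛ H
    ...     | yes refl = ⊆-trans (H⊆J p) (⋃-upper (∈ₚ.∈-map⁺ J H∈))
    ...     | no c≢H   = ⊆-trans (∈V c p (⊆∧≢⇒⊊ c⊆H c≢H)) (⊆-trans V⊆J (⋃-upper (∈ₚ.∈-map⁺ J H∈)))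
    rank-V : r (V ∅ₛ f G) ≡ sumℕ (map (r ∘ J) factors)
    rank-V = begin
      r (V ∅ₛ f G)                     ≡⟨ cong r (⊆-antisym (V-least ∅⊆ covered) (⋃-least (map J factors) J⊆V)) ⟩
      r (⋃ (map J factors))            ≡⟨ ≤-antisym (r-⋃ (map J factors))
                                           (modular-⊆ J J⊆ factors (BuildingSet.maxBelow-modular loopless bs' (flat 𝒢G))) ⟩
      sumℕ (map r (map J factors))     ≡⟨ cong sumℕ (Listₚ.map-∘ factors) ⟨
      sumℕ (map (r ∘ J) factors)       ∎

  k : ℕ
  k = length factors

  Std Std' : GradedSet
  Std  = StandardFunctions M ∅ₛ 𝒢
  Std' = StandardFunctions M ∅ₛ 𝒢'

  Core Lowered Raised : GradedSet
  Core    = Std ∣ λ F → F G ≡ 0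
  Lowered = Triples ∣ λ (j , f , _) → j ≡ 0 × coranks factors f ≡ 0
  Raised  = Triples ∣ λ (j , _) → 1 ≤ j × j < k

  raising : (Triples ∣ λ (j , f , _) → 1 ≤ j × j < coranks factors f) ≅ (Lowered ⊞ Raised)
  raising = nonempty factors refl
    where
    nonempty : ∀ Hs → factors ≡ Hs → (Triples ∣ λ (j , f , _) → 1 ≤ j × j < coranks factors f) ≅ (Lowered ⊞ Raised)
    -- `G` has positive rank, so it has at least one factor.
    nonempty []       e = contradiction (BuildingSet.rank-positive loopless bs 𝒢G)
      (subst (λ x → ¬ (1 ≤ x)) (trans (cong (sumℕ ∘ map r) (sym e)) factors-sum) λ ())
    nonempty (H ∷ Hs) e = subst
      (λ Hs → (Triples ∣ λ (j , f , _) → 1 ≤ j × j < coranks Hs f) ≅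
              ((Triples ∣ λ (j , f , _) → j ≡ 0 × coranks Hs f ≡ 0) ⊞ (Triples ∣ λ (j , _) → 1 ≤ j × j < length Hs)))
      (sym e) (exchange-all H Hs (subst Unique e (maxBelow-unique 𝒢' G)) (subst (All Maximal) e factors-maximal))

  -- A positive exponent at `G` places `F` in `Around`. The remaining bound, the one at `G`, limits
  -- the exponent by the corank of the support in `G`, and `coranks-total` distributes this corank
  -- over the factors.
  with-G : (Std ∣ λ F → ¬ (F G ≡ 0)) ≅ (Triples ∣ λ (j , f , _) → 1 ≤ j × j < coranks factors f)
  with-G = ≅-trans (Functions-⇔ forget recall) (≅-trans
    (∣-cong {P = λ F → 1 ≤ F G × F G < r G ∸ r (V ∅ₛ F G)} decomposition
      (λ v → subst (λ W → _ × _ < r G ∸ r W) (sym (Restrict.V-lower v ⊆-refl)))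
      (λ { {j , f , g} ((_ , vf , vg) , s) → subst₂ (λ x W → 1 ≤ x × x < r G ∸ r W) (sym pieces-G) (sym (Assemble.V-agrees vf vg s ⊆-refl)) }))
    (∣∣-⇔ {Triples} (λ { {j , _} (_ , vf , _) _ (p , q) → p , subst (j <_) (sym (coranks-total vf)) q })
                    (λ { {j , _} (_ , vf , _) (p , q) → inj₁ p , p , subst (j <_) (coranks-total vf) q })))
    where
    forget : ∀ F → Valid (Std ∣ λ F → ¬ (F G ≡ 0)) F → Valid (Around ∣ λ F → 1 ≤ F G × F G < r G ∸ r (V ∅ₛ F G)) F
    forget F ((off , bound) , ≢0) = (off , (λ A 𝒢'A → bound A (proj₁ (𝒢'⁻ 𝒢'A))) , inj₁ (n≢0⇒n>0 ≢0)) , n≢0⇒n>0 ≢0 ,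
      m+n≤o⇒m≤o∸n (suc (F G)) (bound G 𝒢G)
    recall : ∀ F → Valid (Around ∣ λ F → 1 ≤ F G × F G < r G ∸ r (V ∅ₛ F G)) F → Valid (Std ∣ λ F → ¬ (F G ≡ 0)) F
    recall F ((off , bound , _) , p , q) = (off , bounded) , λ e → contradiction (subst (1 ≤_) e p) λ ()
      where
      bounded : ∀ A → 𝒢 A ≡ true → F A + r (V ∅ₛ F A) < r A
      bounded A 𝒢A with A ≟ₛ G
      ... | yes refl = <∸⇒+< _ q
      ... | no A≢G   = bound A (𝒢'⁺ 𝒢A A≢G)

  off-G : ∀ (F : Subset n → ℕ) → (∀ A → ¬ (𝒢 A ≡ true) → F A ≡ 0) → F G ≡ 0 → ∀ A → ¬ (𝒢' A ≡ true) → F A ≡ 0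
  off-G F off e A ¬𝒢'A = decide (A ≟ₛ G)
    where
    decide : Dec (A ≡ G) → F A ≡ 0
    decide (yes refl) = e
    decide (no A≢G)   = off A (λ 𝒢A → ¬𝒢'A (𝒢'⁺ 𝒢A A≢G))

  -- `G` carries no variable for `𝒢'`, hence `j = 0`; that the support below `G` spans `G` means
  -- that all coranks vanish.
  without-G : (Std' ∣ λ F → ¬ (r (V ∅ₛ F G) < r G)) ≅ Lowered
  without-G = ≅-trans (Functions-⇔ extend retract) (≅-trans
    (∣-cong {P = λ F → F G ≡ 0} {Q = λ (j , _) → j ≡ 0} decomposition (λ _ e → e) (λ _ e → trans pieces-G e))
    (∣∣-⇔ {Triples} (λ { {_ , f , _} (_ , vf , _) s refl → refl , trans (coranks-total vf) (m≤n⇒m∸n≡0 (spanning {f} s)) })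
                    (λ { (_ , vf , _) (refl , e) → inj₂ (m∸n≡0⇒m≤n (trans (sym (coranks-total vf)) e)) , refl })))
    where
    spanning : ∀ {f} → 1 ≤ 0 ⊎ Spanning f → Spanning f
    spanning (inj₂ s) = s
    extend : ∀ F → Valid (Std' ∣ λ F → ¬ (r (V ∅ₛ F G) < r G)) F → Valid (Around ∣ λ F → F G ≡ 0) F
    extend F ((off , bound) , sp) = ((λ A ¬𝒢A → off A (λ e → ¬𝒢A (proj₁ (𝒢'⁻ e)))) , bound , inj₂ (≮⇒≥ sp)) , off G (λ e → proj₂ (𝒢'⁻ e) refl)
    retract : ∀ F → Valid (Around ∣ λ F → F G ≡ 0) F → Valid (Std' ∣ λ F → ¬ (r (V ∅ₛ F G) < r G)) F
    retract F ((off , bound , s) , e) = (off-G F off e , bound) , ≤⇒≯ (spanning {F} (subst (λ x → 1 ≤ x ⊎ Spanning F) e s))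

  -- With exponent 0 at `G`, the additional bound of `𝒢` says just that the support below `G` does
  -- not span `G`.
  core : Core ≅ (Std' ∣ λ F → r (V ∅ₛ F G) < r G)
  core = Functions-⇔ forget recall
    where
    forget : ∀ F → Valid Core F → Valid (Std' ∣ λ F → r (V ∅ₛ F G) < r G) F
    forget F ((off , bound) , e) = (off-G F off e , λ A 𝒢'A → bound A (proj₁ (𝒢'⁻ 𝒢'A))) , subst (λ x → x + r (V ∅ₛ F G) < r G) e (bound G 𝒢G)
    recall : ∀ F → Valid (Std' ∣ λ F → r (V ∅ₛ F G) < r G) F → Valid Core F
    recall F ((off , bound) , lt) = ((λ A ¬𝒢A → off A (λ e → ¬𝒢A (proj₁ (𝒢'⁻ e)))) , bounded) , F-G
      where
      F-G : F G ≡ 0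
      F-G = off G (λ e → proj₂ (𝒢'⁻ e) refl)
      bounded : ∀ A → 𝒢 A ≡ true → F A + r (V ∅ₛ F A) < r A
      bounded A 𝒢A with A ≟ₛ G
      ... | yes refl = subst (λ x → x + r (V ∅ₛ F G) < r G) (sym F-G) lt
      ... | no A≢G   = bound A (𝒢'⁺ 𝒢A A≢G)

  raised : Raised ≅ (Exponents k ⊠ StdR ⊠ StdC)
  raised = record
    { to = id ; from = id ; to-valid = λ ((_ , v) , p) → p , v ; from-valid = λ (p , v) → (tt , v) , p ; to-cong = id ; from-cong = id
    ; to-from = λ _ → GradedSet.≈-refl Triples ; from-to = λ _ → GradedSet.≈-refl Triples ; to-deg = λ _ → refl }

  -- `Lowered` is the link: for `𝒢` it is the part emptied by the exchange, and for `𝒢'` it consists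
  -- of the functions whose support spans `G`. Joined to the core it restores `Std'` and leaves the
  -- product.
  recursion : Std ≅ (Std' ⊞ (Exponents k ⊠ StdR ⊠ StdC))
  recursion =
    ≅-trans (split Std (λ F → F G ℕ.≟ 0) (λ e z → trans (sym (e G)) z))
    (≅-trans (⊞-cong core (≅-trans with-G (≅-trans raising (⊞-cong (≅-sym without-G) raised))))
    (≅-trans (⊞-assoc {Std' ∣ λ F → r (V ∅ₛ F G) < r G} {Std' ∣ λ F → ¬ (r (V ∅ₛ F G) < r G)} {Exponents k ⊠ StdR ⊠ StdC})
      (⊞-cong (≅-sym (split Std' (λ F → r (V ∅ₛ F G) <? r G) (λ e → subst (λ W → r W < r G) (V-cong (λ c _ → e c))))) identity)))
    where
    identity : (Exponents k ⊠ StdR ⊠ StdC) ≅ (Exponents k ⊠ StdR ⊠ StdC)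
    identity = ≅-trans (≅-sym raised) raised

-- A basis in the sense of `HasDim` has as many elements as there are standard functions of that
-- degree, so the identity compares two enumerations of one finite set.
theorem5p1 : ∀ {n : ℕ} (M : Matroid n) → Loopless M →
    (𝒢 : SetOfSubsets n) → IsBuildingSet M 𝒢 →
    (G : Subset n) → 𝒢 G ≡ true → IsBuildingSet M (removeB 𝒢 G) →
    (h h' hR hC : ℕ → ℕ) →
    (∀ i → Chow.HasDim M ∅ₛ 𝒢 i (h i)) →
    (∀ i → Chow.HasDim M ∅ₛ (removeB 𝒢 G) i (h' i)) →
    (∀ i → Chow.HasDim M ∅ₛ (restrictB (removeB 𝒢 G) G) i (hR i)) →
    (∀ i → Chow.HasDim M G (contractB M (removeB 𝒢 G) G) i (hC i)) →
    ∀ i → h i ≡ h' i + conv (geomCoeff (length (maxBelow (removeB 𝒢 G) G))) (conv hR hC) i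
theorem5p1 M loopless 𝒢 bs G 𝒢G bs' h h' hR hC dim dim' dimR dimC i = counts-unique {Std' ⊞ (Exponents k ⊠ StdR ⊠ StdC)}
  (counts-≅ {Std} {Std' ⊞ (Exponents k ⊠ StdR ⊠ StdC)} recursion (counts-HasDim closed𝒢 (dim i)))
  (counts-⊞ {Std'} {Exponents k ⊠ StdR ⊠ StdC} (counts-HasDim closed𝒢' (dim' i))
    (counts-⊠ {Exponents k} {StdR ⊠ StdC} (counts-Exponents k)
      (counts-⊠ {StdR} {StdC} (λ i → counts-HasDim closedℛ (dimR i)) (λ i → counts-HasDim closed𝒞 (dimC i))) i))
  where
  open Recursion loopless bs 𝒢G bs'
  open Deletion loopless bs 𝒢G bs'
  open Decomposition loopless bs 𝒢G bs'
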